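{- Let $L$ be a valid lattice and $\{v_0^*,v_1^*\}$ a flux-connecting basis of $L^*$. Decompose $\mathscr{F}(L)$ in lines parallel to $v_0^*$ and in lines parallel to $v_1^*$. Then, along any given one of those lines, the sign change between two adjacent fluxes is always the same; moreover, for parallel and adjacent lines, the sign changes along the two lines are different. Explicitly, let $\{i,j\}=\{0,1\}$ and let $\varphi,\varphi'$ be such that $\varphi,\ \varphi+v_i^*,\ \varphi',\ \varphi'+v_i^*\in\mathscr{F}(L)$. If $\varphi'-\varphi\in\mathbb{Z}v_i^*$, then $$\frac{\operatorname{sgn}(\varphi)}{\operatorname{sgn}(\varphi+v_i^*)}=\frac{\operatorname{sgn}(\varphi')}{\operatorname{sgn}(\varphi'+v_i^*)},$$ and if $\varphi'-\varphi\in v_j^*+\mathbb{Z}v_i^*$, then $$\frac{\operatorname{sgn}(\varphi)}{\operatorname{sgn}(\varphi+v_i^*)}=-\frac{\operatorname{sgn}(\varphi')}{\operatorname{sgn}(\varphi'+v_i^*)}.$$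
   Context: Tilings: the unit square $[i,i+1]\times[j,j+1]$ ($i,j\in\mathbb{Z}$) is black if $i+j$ is even and white otherwise. A domino is the union of two unit squares sharing a side; a tiling of $\mathbb{Z}^2$ is a set of dominoes with pairwise disjoint interiors covering $\mathbb{R}^2$. Let $\mathscr{E}=2\mathbb{Z}^2$, $\mathscr{O}=2\mathbb{Z}^2+(1,1)$. A valid lattice is a subgroup $L\subset\mathbb{Z}^2$ generated by two linearly independent vectors in $\mathscr{E}\sqcup\mathscr{O}$. A tiling of $\mathbb{T}_L=\mathbb{R}^2/L$ is identified with an $L$-periodic tiling of $\mathbb{Z}^2$. Height functions and flux: each unit edge between neighboring points of $\mathbb{Z}^2$ is oriented so that the boundary of every black square is oriented clockwise. The height function $h_t:\mathbb{Z}^2\to\mathbb{Z}$ of a tiling $t$ satisfies $h_t(0)=0$ and, for every edge oriented from $u$ to $w$: $h_t(w)=h_t(u)+1$ if the edge is not the common side of the two squares of a domino of $t$, and $h_t(w)=h_t(u)-3$ otherwise. For a tiling $t$ of $\mathbb{T}_L$, the flux is the unique $\varphi_t\in\mathbb{R}^2$ with $4\langle\varphi_t,v\rangle=h_t(u+v)-h_t(u)$ for all $v\in L$, $u\in\mathbb{Z}^2$. $\mathscr{F}(L)$ is the set of fluxes of all tilings of $\mathbb{T}_L$. The dual lattice is $L^*=\{f\in\mathbb{R}^2:\langle f,v\rangle\in\mathbb{Z}\ \forall v\in L\}$; differences of elements of $\mathscr{F}(L)$ lie in $L^*$. Flux-connecting basis: a basis $\{v_0^*,v_1^*\}$ of $L^*$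 such that any two elements of $\mathscr{F}(L)$ can be joined by a finite sequence of elements of $\mathscr{F}(L)$ whose consecutive differences all lie in $\{\pm v_0^*,\pm v_1^*\}$. Kasteleyn matrix: let $x_0$ be the smallest positive integer with $v_0=(x_0,0)\in L$, $y_1$ the smallest positive integer such that $L$ contains a vector with second coordinate $y_1$, and $v_1=(x_1,y_1)$ the unique such vector in $L$ with $0\le x_1<x_0$; $\{v_0,v_1\}$ generates $L$. The rectangle $D_L=[0,x_0]\times[0,y_1]$ is a fundamental domain with equally many black and white squares; fix enumerations $b_1,\dots,b_m$ of its black and $w_1,\dots,w_m$ of its white squares. Let $G(\mathbb{Z}^2)$ be the graph whose vertices are the centers of unit squares, with edges joining centers of squares sharing a side (edges correspond to dominoes). An edge has sign $-1$ if it is horizontal with black left endpoint and white right endpoint, and $+1$ otherwise. Let $u(0)$ be the straight lattice path from $(0,0)$ to $v_0$ and $u(1)$ the lattice path $(0,0)\to(0,y_1)\to(x_1,y_1)$. Each $L$-orbit $[e]_L$ of edges has weight: its sign, multiplied for each $k\in\{0,1\}$ by $q_k$ (resp. $q_k^{ -1}$) if some edge in $[e]_L$ crosses $u(k)$ with its black endpoint to the left (resp. right) of the oriented path $u(k)$. $K(i,j)$ is the sum of the weights of the $L$-orbits of edges joining an $L$-translate of $b_i$ to an $L$-translate of $w_j$. Sign of a flux: each tiling $t$ of $\mathbb{T}_L$ corresponds to a term $K_t=\pm q_0^{n_0}q_1^{n_1}$ in the combinatorial expansion of $\det K$ (permutation sign included), and all tilings with the same flux $\varphi$ yield the same monomial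 $q_0^{n_0}q_1^{n_1}$ with the same sign; this common sign is $\operatorname{sgn}(\varphi)$. Equivalently, $\operatorname{sgn}(\varphi)$ is the sign of the coefficient in $\det K$ of $q_0^{n_0}q_1^{n_1}$, where $n_0=\langle\varphi,v_0\rangle$, and $n_1=\langle\varphi,v_1\rangle$ if $v_1\in\mathscr{E}$, $n_1=\langle\varphi,v_1\rangle-\frac12$ if $v_1\in\mathscr{O}$. -}

module Defs where

open import Algebra.Bundles using (CommutativeMonoid)
open import Algebra.Construct.DirectProduct using (commutativeMonoid)
import Algebra.Properties.CommutativeMonoid.Sum as BigOperator
open import Data.Bool.Base using (if_then_else_)
open import Data.Empty using (⊥-elim)
open import Data.Fin.Base using (Fin; zero; suc)
open import Data.Fin.Permutation as Perm using (Permutation′; _⟨$⟩ʳ_)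
import Data.Fin.Properties as Fin
open import Data.Integer.Base hiding (∣_∣; suc)
import Data.Integer.DivMod as ℤ
open import Data.Integer.Divisibility.Signed
import Data.Integer.Properties as ℤ
open import Data.Integer.Tactic.RingSolver using (solve-∀)
open import Data.List.Base using (List; []; _∷_; _++_; applyUpTo; filter; map)
open import Data.List.Membership.Propositional using () renaming (_∈_ to _∈ˡ_)
open import Data.List.Membership.Propositional.Properties using (∈-filter⁺)
open import Data.List.Relation.Unary.Any using (Any; any?; here; there)
open import Data.Nat.Base as ℕ using (ℕ)
import Data.Nat.Properties as ℕ
open import Data.Product.Base using (Σ-syntax; ∃; ∃₂; _×_; _,_; proj₁; proj₂)
open import Data.Rational.Base as ℚ using (ℚ)
open import Data.Rational.Literals using (fromℤ)
open import Data.Sign.Base as Sign using (Sign)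
import Data.Sign.Properties as Sign
open import Data.Sum.Base using (_⊎_; inj₁; inj₂)
open import Function.Definitions using (Injective)
open import Level using (0ℓ)
open import Relation.Binary.Construct.Closure.ReflexiveTransitive using (Star)
open import Relation.Binary.PropositionalEquality
  using (_≡_; _≢_; refl; sym; trans; cong; cong₂; subst; subst₂; module ≡-Reasoning)
open import Relation.Binary.Definitions using (tri<; tri≈; tri>)
open import Relation.Nullary using (Dec; yes; no; does; ¬_; contradiction; _×-dec_)
open import Relation.Nullary.Decidable using (map′; from-no)
open import Relation.Unary using (Pred; _∈_; _∉_)

------------------------------------------------------------------------
-- Vectors

ℤ² : Set
ℤ² = ℤ × ℤ

infixl 6 _⊕_ _⊝_
infixr 7 _·_

_⊕_ : ℤ² → ℤ² → ℤ²
(a , b) ⊕ (c , d) = a + c , b + d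

_⊝_ : ℤ² → ℤ² → ℤ²
(a , b) ⊝ (c , d) = a - c , b - d

_·_ : ℤ → ℤ² → ℤ²
k · (a , b) = k * a , k * b

0² : ℤ²
0² = 0ℤ , 0ℤ

-- Fluxes and dual lattices of rank-two sublattices of ℤ² consist of vectors
-- with rational coordinates, so ℚ² replaces ℝ².
ℚ² : Set
ℚ² = ℚ × ℚ

infixl 6 _⊕ℚ_ _⊝ℚ_
infixr 7 _·ℚ_

_⊕ℚ_ : ℚ² → ℚ² → ℚ²
(a , b) ⊕ℚ (c , d) = a ℚ.+ c , b ℚ.+ d

_⊝ℚ_ : ℚ² → ℚ² → ℚ²
(a , b) ⊝ℚ (c , d) = a ℚ.- c , b ℚ.- d

-ℚ_ : ℚ² → ℚ²
-ℚ (a , b) = ℚ.- a , ℚ.- b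

_·ℚ_ : ℤ → ℚ² → ℚ²
k ·ℚ (a , b) = fromℤ k ℚ.* a , fromℤ k ℚ.* b

0ℚ² : ℚ²
0ℚ² = ℚ.0ℚ , ℚ.0ℚ

⟨_,_⟩ : ℚ² → ℤ² → ℚ
⟨ (a , b) , (x , y) ⟩ = a ℚ.* fromℤ x ℚ.+ b ℚ.* fromℤ y

------------------------------------------------------------------------
-- Squares, dominoes and unit edges

-- (i , j) stands for the unit square [i,i+1]×[j,j+1].
Square : Set
Square = ℤ²

Black White : Pred Square 0ℓ
Black (i , j) = + 2 ∣ i + j
White s       = ¬ Black s

black? : ∀ s → Dec (Black s)
black? (i , j) = + 2 ∣? i + j

data Axis : Set where
  horizontal vertical : Axis

unit : Axis → ℤ²
unit horizontal = 1ℤ , 0ℤ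
unit vertical   = 0ℤ , 1ℤ

_≟ₐ_ : (a b : Axis) → Dec (a ≡ b)
horizontal ≟ₐ horizontal = yes refl
horizontal ≟ₐ vertical   = no λ ()
vertical   ≟ₐ horizontal = no λ ()
vertical   ≟ₐ vertical   = yes refl

-- The union of the squares s and s ⊕ unit a, where s is the left or the bottom
-- one; also the edge of G(ℤ²) joining the centres of these squares.
record Domino : Set where
  constructor domino
  field
    corner : Square
    axis   : Axis

  far : Square
  far = corner ⊕ unit axis

  blackCell whiteCell : Square
  blackCell = if does (black? corner) then corner else far
  whiteCell = if does (black? corner) then far else corner

open Domino public

data Covers (d : Domino) : Square → Set where
  near : Covers d (corner d)
  away : Covers d (far d)

shift : ℤ² → Domino → Domino
shift v (domino s a) = domino (s ⊕ v) a

dominoesAt : Square → List Domino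
dominoesAt s =
  domino s horizontal ∷ domino (s ⊝ unit horizontal) horizontal ∷
  domino s vertical   ∷ domino (s ⊝ unit vertical)   vertical   ∷ []

-- The segment from p to p ⊕ unit a, with p and p ⊕ unit a points of ℤ².
record UnitEdge : Set where
  constructor unitEdge
  field
    start     : ℤ²
    direction : Axis

  end : ℤ²
  end = start ⊕ unit direction

open UnitEdge public

-- The squares on the two sides of a unit edge traversed from start to end.
leftOf rightOf : UnitEdge → Square
leftOf  (unitEdge p horizontal) = p
leftOf  (unitEdge p vertical)   = p ⊝ unit horizontal
rightOf (unitEdge p horizontal) = p ⊝ unit vertical
rightOf (unitEdge p vertical)   = p

-- The domino whose two squares have the given unit edge as common side.
across : UnitEdge → Domino
across (unitEdge p horizontal) = domino (p ⊝ unit vertical)   vertical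
across (unitEdge p vertical)   = domino (p ⊝ unit horizontal) horizontal

-- Boundaries of black squares are oriented clockwise, so an oriented edge has
-- its black square on the right.
tail head : UnitEdge → ℤ²
tail e = if does (black? (rightOf e)) then start e else end e
head e = if does (black? (rightOf e)) then end e else start e

------------------------------------------------------------------------
-- Valid lattices and their tilings

𝓔 𝓞 : Pred ℤ² 0ℓ
𝓔 (x , y) = + 2 ∣ x × + 2 ∣ y
𝓞 (x , y) = + 2 ∣ x - 1ℤ × + 2 ∣ y - 1ℤ

record ValidLattice : Set where
  field
    gen₀ gen₁   : ℤ²
    gen₀-valid  : gen₀ ∈ 𝓔 ⊎ gen₀ ∈ 𝓞
    gen₁-valid  : gen₁ ∈ 𝓔 ⊎ gen₁ ∈ 𝓞
    independent : ∀ m n → m · gen₀ ⊕ n · gen₁ ≡ 0² → m ≡ 0ℤ × n ≡ 0ℤ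

  vectors : Pred ℤ² 0ℓ
  vectors v = ∃₂ λ m n → v ≡ m · gen₀ ⊕ n · gen₁

open ValidLattice public using (vectors)

-- A tiling of the torus, seen as a periodic tiling of the plane.
record Tiling (L : ValidLattice) : Set₁ where
  field
    dominoes : Pred Domino 0ℓ
    covering : ∀ s → ∃ λ d → d ∈ dominoes × Covers d s
    disjoint : ∀ {d d′ s} → d ∈ dominoes → d′ ∈ dominoes →
               Covers d s → Covers d′ s → d ≡ d′
    periodic : ∀ {v d} → v ∈ vectors L → d ∈ dominoes → shift v d ∈ dominoes

open Tiling public

------------------------------------------------------------------------
-- Height functions and fluxes

record IsHeight {L} (t : Tiling L) (h : ℤ² → ℤ) : Set where
  field
    origin : h 0² ≡ 0ℤ
    along  : ∀ e → across e ∉ dominoes t → h (head e) ≡ h (tail e) + 1ℤ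
    inside : ∀ e → across e ∈ dominoes t → h (head e) ≡ h (tail e) - + 3

IsFlux : ∀ {L} → Tiling L → ℚ² → Set
IsFlux {L} t φ = ∃ λ h → IsHeight t h ×
  (∀ {v} → v ∈ vectors L → ∀ u →
     fromℤ (+ 4) ℚ.* ⟨ φ , v ⟩ ≡ fromℤ (h (u ⊕ v) - h u))

𝓕 : ValidLattice → Pred ℚ² (Level.suc 0ℓ)
𝓕 L φ = Σ[ t ∈ Tiling L ] IsFlux t φ

Dual : ValidLattice → Pred ℚ² 0ℓ
Dual L f = ∀ {v} → v ∈ vectors L → ∃ λ n → ⟨ f , v ⟩ ≡ fromℤ n

record IsBasis (L : ValidLattice) (b : Fin 2 → ℚ²) : Set where
  private
    b₀ = b zero
    b₁ = b (suc zero)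
  field
    dual        : ∀ i → b i ∈ Dual L
    generating  : ∀ {f} → f ∈ Dual L → ∃₂ λ m n → f ≡ m ·ℚ b₀ ⊕ℚ n ·ℚ b₁
    independent : ∀ m n → m ·ℚ b₀ ⊕ℚ n ·ℚ b₁ ≡ 0ℚ² → m ≡ 0ℤ × n ≡ 0ℤ

record FluxStep (L : ValidLattice) (b : Fin 2 → ℚ²) (φ ψ : ℚ²) : Set₁ where
  field
    source : φ ∈ 𝓕 L
    target : ψ ∈ 𝓕 L
    step   : ∃ λ i → ψ ⊝ℚ φ ≡ b i ⊎ ψ ⊝ℚ φ ≡ -ℚ b i

record IsFluxConnectingBasis (L : ValidLattice) (b : Fin 2 → ℚ²) : Set₁ where
  field
    isBasis    : IsBasis L b
    connecting : ∀ {φ ψ} → φ ∈ 𝓕 L → ψ ∈ 𝓕 L → Star (FluxStep L b) φ ψ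

------------------------------------------------------------------------
-- Signs and signed Laurent monomials

module _ where
  open BigOperator Sign.*-commutativeMonoid using () renaming (sum to ∏)

  -- (-1) to the number of inversions.
  permSign : ∀ {n} → Permutation′ n → Sign
  permSign π = ∏ λ i → ∏ λ j →
    if does (i Fin.<? j ×-dec (π ⟨$⟩ʳ j) Fin.<? (π ⟨$⟩ʳ i)) then Sign.- else Sign.+

-- A sign is its own inverse.
infixl 7 _÷_
_÷_ : Sign → Sign → Sign
s ÷ s′ = s Sign.* s′

-- (s , n₀ , n₁) stands for s q₀^n₀ q₁^n₁.
monomials : CommutativeMonoid 0ℓ 0ℓ
monomials = commutativeMonoid Sign.*-commutativeMonoid
  (commutativeMonoid ℤ.+-0-commutativeMonoid ℤ.+-0-commutativeMonoid)

open CommutativeMonoid monomials public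
  using () renaming (Carrier to Monomial; _∙_ to _⊛_)

open BigOperator monomials public using () renaming (sum to product)

------------------------------------------------------------------------
-- Parity

2∤1 : ¬ (+ 2 ∣ 1ℤ)
2∤1 = from-no (+ 2 ∣? 1ℤ)

even⇒odd : ∀ {n} → + 2 ∣ n → ¬ (+ 2 ∣ n + 1ℤ)
even⇒odd p q = 2∤1 (∣m+n∣m⇒∣n q p)

odd⇒even : ∀ {n} → ¬ (+ 2 ∣ n) → + 2 ∣ n + 1ℤ
odd⇒even {n} ¬p with n ℤ.%ℕ 2 | ℤ.n%ℕd<d n 2 | ℤ.a≡a%ℕn+[a/ℕn]*n n 2
... | 0 | _ | eq = ⊥-elim (¬p (divides (n ℤ./ℕ 2) (trans eq (ℤ.+-identityˡ _))))
... | 1 | _ | eq = divides (1ℤ + n ℤ./ℕ 2) (trans (cong (_+ 1ℤ) eq) (lemma (n ℤ./ℕ 2)))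
  where
  lemma : ∀ q → 1ℤ + q * + 2 + 1ℤ ≡ (1ℤ + q) * + 2
  lemma = solve-∀
... | ℕ.suc (ℕ.suc _) | ℕ.s≤s (ℕ.s≤s ()) | _

sum-unit : ∀ s a → proj₁ (s ⊕ unit a) + proj₂ (s ⊕ unit a) ≡ proj₁ s + proj₂ s + 1ℤ
sum-unit (i , j) horizontal = lemma i j
  where
  lemma : ∀ i j → i + 1ℤ + (j + 0ℤ) ≡ i + j + 1ℤ
  lemma = solve-∀
sum-unit (i , j) vertical = lemma i j
  where
  lemma : ∀ i j → i + 0ℤ + (j + 1ℤ) ≡ i + j + 1ℤ
  lemma = solve-∀

far-white : ∀ d → Black (corner d) → White (far d)
far-white (domino s a) p q = even⇒odd p (subst (+ 2 ∣_) (sum-unit s a) q)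

far-black : ∀ d → White (corner d) → Black (far d)
far-black (domino s a) p = subst (+ 2 ∣_) (sym (sum-unit s a)) (odd⇒even p)

if-yes : ∀ {A B : Set} (A? : Dec A) {x y : B} → A → (if does A? then x else y) ≡ x
if-yes (yes _) _ = refl
if-yes (no ¬a) a = contradiction a ¬a

if-no : ∀ {A B : Set} (A? : Dec A) {x y : B} → ¬ A → (if does A? then x else y) ≡ y
if-no (yes a) ¬a = contradiction a ¬a
if-no (no _)  _  = refl

blackCell-unique : ∀ {d s} → Covers d s → Black s → blackCell d ≡ s
blackCell-unique {d} near b = if-yes (black? (corner d)) b
blackCell-unique {d} away b = if-no (black? (corner d)) λ p → far-white d p b

whiteCell-unique : ∀ {d s} → Covers d s → White s → whiteCell d ≡ s
whiteCell-unique {d} near w = if-no (black? (corner d)) w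
whiteCell-unique {d} away w with black? (corner d)
... | yes p = if-yes (black? (corner d)) p
... | no ¬p = contradiction (far-black d ¬p) w

blackCell-black : ∀ d → Black (blackCell d)
blackCell-black d with black? (corner d)
... | yes p = subst Black (sym (if-yes (black? (corner d)) p)) p
... | no ¬p = subst Black (sym (if-no (black? (corner d)) ¬p)) (far-black d ¬p)

whiteCell-white : ∀ d → White (whiteCell d)
whiteCell-white d with black? (corner d)
... | yes p = subst White (sym (if-yes (black? (corner d)) p)) (far-white d p)
... | no ¬p = subst White (sym (if-no (black? (corner d)) ¬p)) ¬p

covers-blackCell : ∀ d → Covers d (blackCell d)
covers-blackCell d with black? (corner d)
... | yes p = subst (Covers d) (sym (if-yes (black? (corner d)) p)) near
... | no ¬p = subst (Covers d) (sym (if-no (black? (corner d)) ¬p)) away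

covers-whiteCell : ∀ d → Covers d (whiteCell d)
covers-whiteCell d with black? (corner d)
... | yes p = subst (Covers d) (sym (if-yes (black? (corner d)) p)) away
... | no ¬p = subst (Covers d) (sym (if-no (black? (corner d)) ¬p)) near

⊕-⊝-cancel : ∀ s v → s ≡ s ⊕ v ⊝ v
⊕-⊝-cancel (i , j) (x , y) = cong₂ _,_ (lemma i x) (lemma j y)
  where
  lemma : ∀ i x → i ≡ i + x - x
  lemma = solve-∀

covers⇒dominoesAt : ∀ {d s} → Covers d s → d ∈ˡ dominoesAt s
covers⇒dominoesAt {domino _ horizontal} near = here refl
covers⇒dominoesAt {domino s vertical}   near = there (there (here refl))
covers⇒dominoesAt {domino s horizontal} away =
  there (here (cong (λ z → domino z horizontal) (⊕-⊝-cancel s _)))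
covers⇒dominoesAt {domino s vertical}   away =
  there (there (there (here (cong (λ z → domino z vertical) (⊕-⊝-cancel s _)))))

covers-shift : ∀ {d s} v → Covers d s → Covers (shift v d) (s ⊕ v)
covers-shift v near = near
covers-shift {domino (i , j) a} (x , y) away = subst (Covers _)
  (cong₂ _,_ (lemma i (proj₁ (unit a)) x) (lemma j (proj₂ (unit a)) y)) away
  where
  lemma : ∀ i u x → i + x + u ≡ i + u + x
  lemma = solve-∀

------------------------------------------------------------------------
-- Congruence modulo a lattice

infix 4 _∼[_]_ _∼ᵈ[_]_

_∼[_]_ : ℤ² → ValidLattice → ℤ² → Set
s ∼[ L ] s′ = s ⊝ s′ ∈ vectors L

_∼ᵈ[_]_ : Domino → ValidLattice → Domino → Set
d ∼ᵈ[ L ] d′ = corner d ∼[ L ] corner d′ × axis d ≡ axis d′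

module _ (L : ValidLattice) where
  open ValidLattice L hiding (vectors)

  private
    a₁ = proj₁ gen₀
    a₂ = proj₂ gen₀
    b₁ = proj₁ gen₁
    b₂ = proj₂ gen₁

    det : ℤ
    det = a₁ * b₂ - a₂ * b₁

    det≢0 : det ≢ 0ℤ
    det≢0 det≡0 = contradiction (proj₁ (independent 1ℤ 0ℤ gen₀≡0)) λ ()
      where
      lemma₁ : ∀ a₁ a₂ b₁ b₂ → b₂ * a₁ + - a₂ * b₁ ≡ a₁ * b₂ - a₂ * b₁
      lemma₁ = solve-∀
      lemma₂ : ∀ a₂ b₂ → b₂ * a₂ + - a₂ * b₂ ≡ 0ℤ
      lemma₂ = solve-∀
      lemma₃ : ∀ a₁ b₁ → b₁ * a₁ + - a₁ * b₁ ≡ 0ℤ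
      lemma₃ = solve-∀
      lemma₄ : ∀ a₁ a₂ b₁ b₂ → b₁ * a₂ + - a₁ * b₂ ≡ - (a₁ * b₂ - a₂ * b₁)
      lemma₄ = solve-∀
      a₂≡0 : a₂ ≡ 0ℤ
      a₂≡0 = ℤ.neg-injective (proj₂ (independent b₂ (- a₂)
        (cong₂ _,_ (trans (lemma₁ a₁ a₂ b₁ b₂) det≡0) (lemma₂ a₂ b₂))))
      a₁≡0 : a₁ ≡ 0ℤ
      a₁≡0 = ℤ.neg-injective (proj₂ (independent b₁ (- a₁)
        (cong₂ _,_ (lemma₃ a₁ b₁) (trans (lemma₄ a₁ a₂ b₁ b₂) (cong -_ det≡0)))))
      lemma₅ : ∀ b → 1ℤ * 0ℤ + 0ℤ * b ≡ 0ℤ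
      lemma₅ = solve-∀
      gen₀≡0 : 1ℤ · gen₀ ⊕ 0ℤ · gen₁ ≡ 0²
      gen₀≡0 = cong₂ _,_
        (trans (cong (λ z → 1ℤ * z + 0ℤ * b₁) a₁≡0) (lemma₅ b₁))
        (trans (cong (λ z → 1ℤ * z + 0ℤ * b₂) a₂≡0) (lemma₅ b₂))

  vectors? : ∀ v → Dec (v ∈ vectors L)
  vectors? (x , y) = map′ to from (det ∣? x * b₂ - y * b₁ ×-dec det ∣? a₁ * y - a₂ * x)
    where
    to : det ∣ x * b₂ - y * b₁ × det ∣ a₁ * y - a₂ * x → (x , y) ∈ vectors L
    to (divides m p , divides n q) = m , n , cong₂ _,_
      (ℤ.*-cancelʳ-≡ _ _ det {{≢-nonZero det≢0}} (begin
        x * det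
          ≡⟨ lemma₁ a₁ a₂ b₁ b₂ x y ⟩
        (x * b₂ - y * b₁) * a₁ + (a₁ * y - a₂ * x) * b₁
          ≡⟨ cong₂ (λ z w → z * a₁ + w * b₁) p q ⟩
        m * det * a₁ + n * det * b₁
          ≡⟨ lemma₃ m n det a₁ b₁ ⟩
        (m * a₁ + n * b₁) * det ∎))
      (ℤ.*-cancelʳ-≡ _ _ det {{≢-nonZero det≢0}} (begin
        y * det
          ≡⟨ lemma₂ a₁ a₂ b₁ b₂ x y ⟩
        (x * b₂ - y * b₁) * a₂ + (a₁ * y - a₂ * x) * b₂
          ≡⟨ cong₂ (λ z w → z * a₂ + w * b₂) p q ⟩
        m * det * a₂ + n * det * b₂
          ≡⟨ lemma₃ m n det a₂ b₂ ⟩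
        (m * a₂ + n * b₂) * det ∎))
      where
      open ≡-Reasoning
      lemma₁ : ∀ a₁ a₂ b₁ b₂ x y → x * (a₁ * b₂ - a₂ * b₁) ≡
               (x * b₂ - y * b₁) * a₁ + (a₁ * y - a₂ * x) * b₁
      lemma₁ = solve-∀
      lemma₂ : ∀ a₁ a₂ b₁ b₂ x y → y * (a₁ * b₂ - a₂ * b₁) ≡
               (x * b₂ - y * b₁) * a₂ + (a₁ * y - a₂ * x) * b₂
      lemma₂ = solve-∀
      lemma₃ : ∀ m n e a b → m * e * a + n * e * b ≡ (m * a + n * b) * e
      lemma₃ = solve-∀
    from : (x , y) ∈ vectors L → det ∣ x * b₂ - y * b₁ × det ∣ a₁ * y - a₂ * x
    from (m , n , refl) = divides m (lemma₁ a₁ a₂ b₁ b₂ m n) , divides n (lemma₂ a₁ a₂ b₁ b₂ m n)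
      where
      lemma₁ : ∀ a₁ a₂ b₁ b₂ m n → (m * a₁ + n * b₁) * b₂ - (m * a₂ + n * b₂) * b₁ ≡
               m * (a₁ * b₂ - a₂ * b₁)
      lemma₁ = solve-∀
      lemma₂ : ∀ a₁ a₂ b₁ b₂ m n → a₁ * (m * a₂ + n * b₂) - a₂ * (m * a₁ + n * b₁) ≡
               n * (a₁ * b₂ - a₂ * b₁)
      lemma₂ = solve-∀

  ∼? : ∀ s s′ → Dec (s ∼[ L ] s′)
  ∼? s s′ = vectors? (s ⊝ s′)

  ∼ᵈ? : ∀ d d′ → Dec (d ∼ᵈ[ L ] d′)
  ∼ᵈ? d d′ = ∼? (corner d) (corner d′) ×-dec (axis d ≟ₐ axis d′)

  combine : ∀ {u v} k l → u ∈ vectors L → v ∈ vectors L → k · u ⊕ l · v ∈ vectors L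
  combine k l (m , n , refl) (m′ , n′ , refl) =
    k * m + l * m′ , k * n + l * n′ ,
    cong₂ _,_ (lemma k l m n m′ n′ a₁ b₁) (lemma k l m n m′ n′ a₂ b₂)
    where
    lemma : ∀ k l m n m′ n′ a b → k * (m * a + n * b) + l * (m′ * a + n′ * b) ≡
            (k * m + l * m′) * a + (k * n + l * n′) * b
    lemma = solve-∀

  ∼-refl : ∀ s → s ∼[ L ] s
  ∼-refl (i , j) = 0ℤ , 0ℤ , cong₂ _,_ (lemma i a₁ b₁) (lemma j a₂ b₂)
    where
    lemma : ∀ i a b → i - i ≡ 0ℤ * a + 0ℤ * b
    lemma = solve-∀

  ∼-sym : ∀ {s s′} → s ∼[ L ] s′ → s′ ∼[ L ] s
  ∼-sym {i , j} {i′ , j′} p =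
    subst (vectors L) (cong₂ _,_ (lemma i i′) (lemma j j′)) (combine -1ℤ 0ℤ p p)
    where
    lemma : ∀ i i′ → -1ℤ * (i - i′) + 0ℤ * (i - i′) ≡ i′ - i
    lemma = solve-∀

  ∼-trans : ∀ {s s′ s″} → s ∼[ L ] s′ → s′ ∼[ L ] s″ → s ∼[ L ] s″
  ∼-trans {i , j} {i′ , j′} {i″ , j″} p q =
    subst (vectors L) (cong₂ _,_ (lemma i i′ i″) (lemma j j′ j″)) (combine 1ℤ 1ℤ p q)
    where
    lemma : ∀ i i′ i″ → 1ℤ * (i - i′) + 1ℤ * (i′ - i″) ≡ i - i″
    lemma = solve-∀

  vectors-even : ∀ {v} → v ∈ vectors L → + 2 ∣ proj₁ v + proj₂ v
  vectors-even (m , n , refl) = subst (+ 2 ∣_) (sym (lemma m n a₁ a₂ b₁ b₂))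
    (∣m∣n⇒∣m+n (∣n⇒∣m*n m (even gen₀-valid)) (∣n⇒∣m*n n (even gen₁-valid)))
    where
    lemma : ∀ m n a₁ a₂ b₁ b₂ →
            m * a₁ + n * b₁ + (m * a₂ + n * b₂) ≡ m * (a₁ + a₂) + n * (b₁ + b₂)
    lemma = solve-∀
    even : ∀ {v} → v ∈ 𝓔 ⊎ v ∈ 𝓞 → + 2 ∣ proj₁ v + proj₂ v
    even (inj₁ (p , q)) = ∣m∣n⇒∣m+n p q
    even {x , y} (inj₂ (p , q)) = subst (+ 2 ∣_) (rearr x y)
      (∣m∣n⇒∣m+n (∣m∣n⇒∣m+n p q) (∣-refl {+ 2}))
      where
      rearr : ∀ x y → x - 1ℤ + (y - 1ℤ) + + 2 ≡ x + y
      rearr = solve-∀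

  ∼-black : ∀ {s s′} → s ∼[ L ] s′ → Black s → Black s′
  ∼-black {i , j} {i′ , j′} p b = subst (+ 2 ∣_) (lemma i j i′ j′)
    (∣m∣n⇒∣m+n b (vectors-even (∼-sym {i , j} {i′ , j′} p)))
    where
    lemma : ∀ i j i′ j′ → i + j + (i′ - i + (j′ - j)) ≡ i′ + j′
    lemma = solve-∀

  ∼-white : ∀ {s s′} → s ∼[ L ] s′ → White s → White s′
  ∼-white {s} {s′} p w b = w (∼-black {s′} {s} (∼-sym {s} {s′} p) b)

------------------------------------------------------------------------
-- The Kasteleyn matrix

record Enumeration (P : Pred Square 0ℓ) (m : ℕ) : Set where
  field
    at        : Fin m → Square
    sound     : ∀ i → P (at i)
    injective : Injective _≡_ _≡_ at
    complete  : ∀ {s} → P s → ∃ λ i → at i ≡ s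

open Enumeration public

Rectangle : ℕ → ℕ → Pred Square 0ℓ
Rectangle x y (i , j) = (0ℤ ≤ i × i < + x) × (0ℤ ≤ j × j < + y)

-- The vectors v₀ = (x₀ , 0) and v₁ = (x₁ , y₁), and the enumerations of the
-- squares of the fundamental domain.
record KasteleynData (L : ValidLattice) : Set where
  field
    x₀ x₁ y₁ : ℕ

    x₀-positive : 0 ℕ.< x₀
    x₀-period   : (+ x₀ , 0ℤ) ∈ vectors L
    x₀-minimal  : ∀ {x} → 0 ℕ.< x → (+ x , 0ℤ) ∈ vectors L → x₀ ℕ.≤ x

    y₁-positive : 0 ℕ.< y₁
    y₁-minimal  : ∀ {x y} → 0 ℕ.< y → (x , + y) ∈ vectors L → y₁ ℕ.≤ y
    x₁-bound    : x₁ ℕ.< x₀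
    x₁y₁-period : (+ x₁ , + y₁) ∈ vectors L

    size   : ℕ
    blacks : Enumeration (λ s → s ∈ Rectangle x₀ y₁ × s ∈ Black) size
    whites : Enumeration (λ s → s ∈ Rectangle x₀ y₁ × s ∈ White) size

module Kasteleyn {L : ValidLattice} (X : KasteleynData L) where
  open KasteleynData X

  path : Fin 2 → List UnitEdge
  path zero    = applyUpTo (λ p → unitEdge (+ p , 0ℤ) horizontal) x₀
  path (suc _) = applyUpTo (λ q → unitEdge (0ℤ , + q) vertical) y₁
              ++ applyUpTo (λ p → unitEdge (+ p , + y₁) horizontal) x₁

  -- Some L-translate of d crosses path k, with its black endpoint to the left
  -- (resp. right).
  CrossesL CrossesR : Fin 2 → Domino → Set
  CrossesL k d = Any (λ e → across e ∼ᵈ[ L ] d × Black (leftOf e)) (path k)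
  CrossesR k d = Any (λ e → across e ∼ᵈ[ L ] d × Black (rightOf e)) (path k)

  crossesL? : ∀ k d → Dec (CrossesL k d)
  crossesL? k d = any? (λ e → ∼ᵈ? L (across e) d ×-dec black? (leftOf e)) (path k)

  crossesR? : ∀ k d → Dec (CrossesR k d)
  crossesR? k d = any? (λ e → ∼ᵈ? L (across e) d ×-dec black? (rightOf e)) (path k)

  exponent : Fin 2 → Domino → ℤ
  exponent k d = (if does (crossesL? k d) then 1ℤ else 0ℤ)
               - (if does (crossesR? k d) then 1ℤ else 0ℤ)

  edgeSign : Domino → Sign
  edgeSign (domino s horizontal) = if does (black? s) then Sign.- else Sign.+
  edgeSign (domino s vertical)   = Sign.+

  weight : Domino → Monomial
  weight d = edgeSign d , exponent zero d , exponent (suc zero) d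

  -- Every L-orbit of edges joining an L-translate of the i-th black square to
  -- an L-translate of the j-th white square has exactly one representative
  -- among the four edges at the i-th black square.
  orbits : Fin size → Fin size → List Domino
  orbits i j = filter (λ d → ∼? L (whiteCell d) (at whites j)) (dominoesAt (at blacks i))

  -- The entries of the Kasteleyn matrix, as formal sums of monomials.
  K : Fin size → Fin size → List Monomial
  K i j = map weight (orbits i j)

  -- The term of the expanded determinant corresponding to a tiling: a
  -- permutation σ and one summand of each entry K i (σ i).
  record Term (t : Tiling L) : Set where
    field
      σ        : Permutation′ size
      edge     : Fin size → Domino
      edge∈t   : ∀ i → edge i ∈ dominoes t
      edge∈row : ∀ i → edge i ∈ˡ orbits i (σ ⟨$⟩ʳ i)

    value : Monomial
    value = (permSign σ , 0ℤ , 0ℤ) ⊛ product (λ i → weight (edge i))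

  instance
    x₀≢0 : ℕ.NonZero x₀
    x₀≢0 = ℕ.>-nonZero x₀-positive
    y₁≢0 : ℕ.NonZero y₁
    y₁≢0 = ℕ.>-nonZero y₁-positive

  reduce : ∀ s → ∃ λ s′ → s′ ∈ Rectangle x₀ y₁ × s ∼[ L ] s′
  reduce (i , j) = (+ r , + r′) , ((+≤+ ℕ.z≤n , +<+ (ℤ.n%ℕd<d i′ x₀)) ,
                                   (+≤+ ℕ.z≤n , +<+ (ℤ.n%ℕd<d j y₁))) ,
    subst (vectors L) (cong₂ _,_ eq₁ eq₂) (combine L p q x₀-period x₁y₁-period)
    where
    q  = j ℤ./ℕ y₁
    r′ = j ℤ.%ℕ y₁
    i′ = i - q * + x₁
    p  = i′ ℤ./ℕ x₀
    r  = i′ ℤ.%ℕ x₀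
    lemma₁ : ∀ p q r x₀ x₁ → p * x₀ + q * x₁ ≡ r + p * x₀ + q * x₁ - r
    lemma₁ = solve-∀
    lemma₂ : ∀ i z → i - z + z ≡ i
    lemma₂ = solve-∀
    lemma₃ : ∀ p q r y → p * 0ℤ + q * y ≡ r + q * y - r
    lemma₃ = solve-∀
    eq₁ : p * + x₀ + q * + x₁ ≡ i - + r
    eq₁ = trans (lemma₁ p q (+ r) (+ x₀) (+ x₁)) (cong (_- + r)
      (trans (cong (_+ q * + x₁) (sym (ℤ.a≡a%ℕn+[a/ℕn]*n i′ x₀))) (lemma₂ i (q * + x₁))))
    eq₂ : p * 0ℤ + q * + y₁ ≡ j - + r′
    eq₂ = trans (lemma₃ p q (+ r′) (+ y₁))
      (cong (_- + r′) (sym (ℤ.a≡a%ℕn+[a/ℕn]*n j y₁)))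

  squeeze : ∀ {b} (P : ℤ → Set) → (∀ {n} → 0 ℕ.< n → P (+ n) → b ℕ.≤ n) →
            ∀ {k l} → 0ℤ ≤ k × k < + b → 0ℤ ≤ l × l < + b →
            P (k - l) → P (l - k) → k ≡ l
  squeeze {b} P min {+ k} {+ l} (_ , +<+ k<b) (_ , +<+ l<b) p q
    with ℕ.<-cmp k l
  ... | tri≈ _ k≡l _ = cong +_ k≡l
  ... | tri< k<l _ _ = contradiction (min (ℕ.m<n⇒0<n∸m k<l) (subst P eq q))
                         (ℕ.<⇒≱ (ℕ.≤-<-trans (ℕ.m∸n≤m l k) l<b))
    where
    eq : + l - + k ≡ + (l ℕ.∸ k)
    eq = trans (ℤ.m-n≡m⊖n l k) (ℤ.⊖-≥ (ℕ.<⇒≤ k<l))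
  ... | tri> _ _ l<k = contradiction (min (ℕ.m<n⇒0<n∸m l<k) (subst P eq p))
                         (ℕ.<⇒≱ (ℕ.≤-<-trans (ℕ.m∸n≤m k l) k<b))
    where
    eq : + k - + l ≡ + (k ℕ.∸ l)
    eq = trans (ℤ.m-n≡m⊖n k l) (ℤ.⊖-≥ (ℕ.<⇒≤ l<k))

  unique : ∀ {s s′} → s ∈ Rectangle x₀ y₁ → s′ ∈ Rectangle x₀ y₁ → s ∼[ L ] s′ → s ≡ s′
  unique {i , j} {i′ , j′} (ri , rj) (ri′ , rj′) p
    with refl ← squeeze (λ n → ∃ λ x → (x , n) ∈ vectors L) (λ n>0 v → y₁-minimal n>0 (proj₂ v))
                  rj rj′ (_ , p) (_ , ∼-sym L {i , j} {i′ , j′} p)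
    = cong (_, j) (squeeze (λ n → (n , 0ℤ) ∈ vectors L) x₀-minimal ri ri′
        (subst (λ z → (i - i′ , z) ∈ vectors L) (ℤ.+-inverseʳ j) p)
        (subst (λ z → (i′ - i , z) ∈ vectors L) (ℤ.+-inverseʳ j) (∼-sym L {i , j} {i′ , j} p)))

  blackIndex : ∀ s → Black s → ∃ λ i → s ∼[ L ] at blacks i
  blackIndex s b with s′ , r , p ← reduce s
    with i , refl ← complete blacks (r , ∼-black L {s} {s′} p b) = i , p

  whiteIndex : ∀ s → White s → ∃ λ j → s ∼[ L ] at whites j
  whiteIndex s w with s′ , r , p ← reduce s
    with j , refl ← complete whites (r , ∼-white L {s} {s′} p w) = j , p

  shift-∼ : ∀ d s s′ (t : Tiling L) → d ∈ dominoes t → Covers d s → s ∼[ L ] s′ →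
            shift (s′ ⊝ s) d ∈ dominoes t × Covers (shift (s′ ⊝ s) d) s′
  shift-∼ d (i , j) (i′ , j′) t d∈t c p =
    periodic t (∼-sym L {i , j} {i′ , j′} p) d∈t ,
    subst (Covers (shift _ d)) (cong₂ _,_ (lemma i i′) (lemma j j′)) (covers-shift _ c)
    where
    lemma : ∀ i i′ → i + (i′ - i) ≡ i′
    lemma = solve-∀

  module _ (t : Tiling L) where

    dominoAt : Square → Domino
    dominoAt s = proj₁ (covering t s)

    partner-∼ : ∀ {d d′ s s′} → d ∈ dominoes t → d′ ∈ dominoes t →
                Covers d s → Covers d′ s′ → s ∼[ L ] s′ →
                ∃ λ v → v ∈ vectors L × d′ ≡ shift v d
    partner-∼ {d} {d′} {s} {s′} d∈t d′∈t c c′ p =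
      s′ ⊝ s , ∼-sym L {s} {s′} p ,
      disjoint t d′∈t (proj₁ sh) c′ (proj₂ sh)
      where sh = shift-∼ d s s′ t d∈t c p

    shifted-black : ∀ d v → v ∈ vectors L → blackCell d ∼[ L ] blackCell (shift v d)
    shifted-black d v v∈L = subst (λ z → blackCell d ∼[ L ] z) (sym eq) rel
      where
      rel : blackCell d ∼[ L ] blackCell d ⊕ v
      rel = subst (vectors L) (cong₂ _,_ (lemma (proj₁ (blackCell d)) (proj₁ v))
                                         (lemma (proj₂ (blackCell d)) (proj₂ v)))
              (combine L -1ℤ 0ℤ v∈L v∈L)
        where
        lemma : ∀ i x → -1ℤ * x + 0ℤ * x ≡ i - (i + x)
        lemma = solve-∀
      eq : blackCell (shift v d) ≡ blackCell d ⊕ v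
      eq = blackCell-unique (covers-shift v (covers-blackCell d))
             (∼-black L {blackCell d} {blackCell d ⊕ v} rel (blackCell-black d))

    shifted-white : ∀ d v → v ∈ vectors L → whiteCell d ∼[ L ] whiteCell (shift v d)
    shifted-white d v v∈L = subst (λ z → whiteCell d ∼[ L ] z) (sym eq) rel
      where
      rel : whiteCell d ∼[ L ] whiteCell d ⊕ v
      rel = subst (vectors L) (cong₂ _,_ (lemma (proj₁ (whiteCell d)) (proj₁ v))
                                         (lemma (proj₂ (whiteCell d)) (proj₂ v)))
              (combine L -1ℤ 0ℤ v∈L v∈L)
        where
        lemma : ∀ i x → -1ℤ * x + 0ℤ * x ≡ i - (i + x)
        lemma = solve-∀
      eq : whiteCell (shift v d) ≡ whiteCell d ⊕ v
      eq = whiteCell-unique (covers-shift v (covers-whiteCell d))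
             (∼-white L {whiteCell d} {whiteCell d ⊕ v} rel (whiteCell-white d))

    black-∼ : ∀ {d d′ s s′} → d ∈ dominoes t → d′ ∈ dominoes t →
              Covers d s → Black s → Covers d′ s′ → whiteCell d ∼[ L ] s′ →
              s ∼[ L ] blackCell d′
    black-∼ {d} {d′} {s} {s′} d∈t d′∈t c b c′ p =
      subst₂ (λ z w → z ∼[ L ] w) (blackCell-unique c b) (cong blackCell (sym eq))
        (shifted-black d v v∈L)
      where
      q   = partner-∼ d∈t d′∈t (covers-whiteCell d) c′ p
      v   = proj₁ q
      v∈L = proj₁ (proj₂ q)
      eq  = proj₂ (proj₂ q)

    white-∼ : ∀ {d d′ s s′} → d ∈ dominoes t → d′ ∈ dominoes t →
              Covers d s → White s → Covers d′ s′ → blackCell d ∼[ L ] s′ →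
              s ∼[ L ] whiteCell d′
    white-∼ {d} {d′} {s} {s′} d∈t d′∈t c w c′ p =
      subst₂ (λ z w → z ∼[ L ] w) (whiteCell-unique c w) (cong whiteCell (sym eq))
        (shifted-white d v v∈L)
      where
      q   = partner-∼ d∈t d′∈t (covers-blackCell d) c′ p
      v   = proj₁ q
      v∈L = proj₁ (proj₂ q)
      eq  = proj₂ (proj₂ q)

    dᵇ dʷ : Fin size → Domino
    dᵇ i = dominoAt (at blacks i)
    dʷ j = dominoAt (at whites j)

    σʳ σˡ : Fin size → Fin size
    σʳ i = proj₁ (whiteIndex (whiteCell (dᵇ i)) (whiteCell-white (dᵇ i)))
    σˡ j = proj₁ (blackIndex (blackCell (dʷ j)) (blackCell-black (dʷ j)))

    σʳ-∼ : ∀ i → whiteCell (dᵇ i) ∼[ L ] at whites (σʳ i)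
    σʳ-∼ i = proj₂ (whiteIndex (whiteCell (dᵇ i)) (whiteCell-white (dᵇ i)))

    σˡ-∼ : ∀ j → blackCell (dʷ j) ∼[ L ] at blacks (σˡ j)
    σˡ-∼ j = proj₂ (blackIndex (blackCell (dʷ j)) (blackCell-black (dʷ j)))

    dᵇ∈t : ∀ i → dᵇ i ∈ dominoes t
    dᵇ∈t i = proj₁ (proj₂ (covering t (at blacks i)))

    dᵇ-covers : ∀ i → Covers (dᵇ i) (at blacks i)
    dᵇ-covers i = proj₂ (proj₂ (covering t (at blacks i)))

    dʷ∈t : ∀ j → dʷ j ∈ dominoes t
    dʷ∈t j = proj₁ (proj₂ (covering t (at whites j)))

    dʷ-covers : ∀ j → Covers (dʷ j) (at whites j)
    dʷ-covers j = proj₂ (proj₂ (covering t (at whites j)))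

    σˡσʳ : ∀ i → σˡ (σʳ i) ≡ i
    σˡσʳ i = injective blacks (sym (unique
      (proj₁ (sound blacks i)) (proj₁ (sound blacks (σˡ (σʳ i))))
      (∼-trans L {at blacks i} {blackCell (dʷ (σʳ i))} {at blacks (σˡ (σʳ i))}
        (black-∼ (dᵇ∈t i) (dʷ∈t (σʳ i)) (dᵇ-covers i) (proj₂ (sound blacks i))
          (dʷ-covers (σʳ i)) (σʳ-∼ i))
        (σˡ-∼ (σʳ i)))))

    σʳσˡ : ∀ j → σʳ (σˡ j) ≡ j
    σʳσˡ j = injective whites (sym (unique
      (proj₁ (sound whites j)) (proj₁ (sound whites (σʳ (σˡ j))))
      (∼-trans L {at whites j} {whiteCell (dᵇ (σˡ j))} {at whites (σʳ (σˡ j))}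
        (white-∼ (dʷ∈t j) (dᵇ∈t (σˡ j)) (dʷ-covers j) (proj₂ (sound whites j))
          (dᵇ-covers (σˡ j)) (σˡ-∼ j))
        (σʳ-∼ (σˡ j)))))

  ∈-orbits : ∀ {d i j} → Covers d (at blacks i) → whiteCell d ∼[ L ] at whites j →
             d ∈ˡ orbits i j
  ∈-orbits {j = j} c p =
    ∈-filter⁺ (λ d → ∼? L (whiteCell d) (at whites j)) (covers⇒dominoesAt c) p

  matching : Tiling L → Permutation′ size
  matching t = Perm.permutation (σʳ t) (σˡ t) (σʳσˡ t) (σˡσʳ t)

  matching-∼ : ∀ t i → whiteCell (dᵇ t i) ∼[ L ] at whites (matching t ⟨$⟩ʳ i)
  matching-∼ t i = σʳ-∼ t i

  edge∈orbits : ∀ t i → dᵇ t i ∈ˡ orbits i (matching t ⟨$⟩ʳ i)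
  edge∈orbits t i = ∈-orbits {dᵇ t i} {i} {matching t ⟨$⟩ʳ i} (dᵇ-covers t i) (matching-∼ t i)

  -- A term is determined by its specification, so its construction is hidden to
  -- keep types that mention it small.
  opaque
    term : (t : Tiling L) → Term t
    term t = record
      { σ        = matching t
      ; edge     = dᵇ t
      ; edge∈t   = dᵇ∈t t
      ; edge∈row = edge∈orbits t
      }

  -- The sign of the term of a tiling with flux φ; it does not depend on which
  -- such tiling the membership proof provides.
  sgn : ∀ φ → φ ∈ 𝓕 L → Sign
  sgn φ (t , _) = proj₁ (Term.value (term t))

{-# OPTIONS --safe #-}

-- A tiling of the torus is a perfect matching of the cells of the rectangle D_L.
-- Number these cells row by row and join matched cells by arcs: the sign of the
-- matching permutation is then, up to a constant factor, given by the parity of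
-- the number of crossing arcs. In a row, the cells to the left of a vertical
-- domino that belong to horizontal dominoes come in pairs, unless a domino wraps
-- around the row. This turns the number of crossings into a sum over the vertical
-- dominoes of their columns, which the Kasteleyn signs cancel up to boundary
-- terms. The sign of the term of a tiling thus has the parity
--   c + κ n₀ + (n₀ + 1) n₁,
-- where c and κ depend only on L and the enumerations, and n_k is the number of
-- dominoes crossing u(k). By means of the height function, n_k is ⟨φ , v_k⟩ modulo 2
-- up to a constant. The polar form of this quadratic form is the determinant,
-- which is odd on a basis of L*.

module Submission where

open import Defs
open import Algebra.Properties.AbelianGroup using (∙-cancelˡ)
import Algebra.Properties.CommutativeMonoid.Sum as MonoidSum
import Algebra.Properties.Semiring.Sum as SemiringSum
open import Algebra.Solver.Ring.AlmostCommutativeRing using (fromCommutativeRing)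
import Algebra.Solver.Ring.Simple as RingSolver
open import Data.Bool.Base using (true; false; if_then_else_)
open import Data.Fin.Base using (Fin; zero; suc)
open import Data.Fin.Permutation as Perm using (Permutation′; _⟨$⟩ʳ_)
import Data.Fin.Properties as Fin
open import Data.Integer.Base as ℤ
  using (ℤ; +_; -[1+_]; 0ℤ; 1ℤ; -1ℤ; ∣_∣; _⊖_; +≤+; +<+)
open import Data.Integer.Divisibility.Signed using (_∣_; divides)
import Data.Integer.DivMod as ℤ
import Data.Integer.Properties as ℤ
open import Data.Integer.Tactic.RingSolver using (solve-∀)
open import Data.List.Membership.Propositional using () renaming (_∈_ to _∈ˡ_)
open import Data.List.Membership.Propositional.Properties using (∈-filter⁻)
open import Data.List.Relation.Unary.Any using (here; there)
open import Data.Nat.Base as ℕ using (ℕ; zero; suc; parity)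
import Data.Nat.Properties as ℕ
-- The library gives addition of parities the precedence of multiplication.
open import Data.Parity.Base using (Parity; 0ℙ; 1ℙ; _*_; toSign) renaming (_+_ to infixl 6 _+_)
import Data.Parity.Properties as ℙ
open import Data.Product.Base using (∃; ∃₂; _×_; _,_; proj₁; proj₂)
open import Data.Rational.Base as ℚ using (ℚ; 0ℚ; 1ℚ; 1/_)
open import Data.Rational.Literals using (fromℤ)
import Data.Rational.Properties as ℚ
open import Data.Rational.Solver using (module +-*-Solver)
import Data.Rational.Unnormalised.Base as ℚᵘ
import Data.Rational.Unnormalised.Properties as ℚᵘ
open import Data.Sign.Base as Sign using (Sign; opposite)
import Data.Sign.Properties as Sign
open import Data.Sum.Base using (_⊎_; inj₁; inj₂)
open import Function.Definitions using (Injective)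
open import Relation.Binary.PropositionalEquality
  using (_≡_; _≢_; refl; sym; trans; cong; cong₂; subst; subst₂; module ≡-Reasoning)
open import Relation.Nullary using (Dec; yes; no; does; ¬_; contradiction; _×-dec_)
open import Relation.Nullary.Decidable using (map′)
open import Relation.Unary using (_∈_)

open SemiringSum ℙ.+-*-semiring
  using (∑-distrib-+; ∑-comm; ∑-permute; *-distribˡ-sum; *-distribʳ-sum; sum-replicate-zero)
  renaming (sum to ∑; sum-cong-≗ to ∑-cong)
open MonoidSum Sign.*-commutativeMonoid using () renaming (sum to ∏; sum-cong-≗ to ∏-cong)
open RingSolver (fromCommutativeRing ℙ.+-*-commutativeRing) ℙ._≟_
  using (solve; _:+_; _:*_; _:=_; con)
open +-*-Solver using () renaming
  ( solve to solveℚ; con to conℚ; _:=_ to infix 4 _⊜_; _:+_ to infixl 6 _⊞_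
  ; _:-_ to infixl 6 _⊟_; _:*_ to infixl 7 _⊠_; :-_ to ⊟_ )
open ≡-Reasoning

-- Sums modulo 2

-- Modulo 2, a summand symmetric in two indices may be summed over unordered pairs in any chosen
-- order. This freedom is used throughout: it exchanges the arbitrary enumerations for the row order
-- at the cost of a constant; it turns the comparisons of white with black cells into a constant up
-- to the matched pairs; and it lets the pairs of vertical dominoes be counted by the order of their
-- upper cells, which completes a count of all cells before a given one. The obstacle is the gluing:
-- a domino across the left side has the rest of its row between its cells, and dominoes across the
-- top side land in a rotated row. Since `x₀` is even, every row receives the same number of
-- vertical dominoes modulo 2, namely n₀, so these defects are expressed by n₀ and n₁. Colours link
-- columns to rows: comparing the two cells of a domino by colour contributes its direction, the
-- Kasteleyn signs remove this contribution from the horizontal dominoes, and on the vertical ones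
-- it changes column parities into row parities, whose sum is n₀ times a constant.

⟦_⟧ : ∀ {A : Set} → Dec A → Parity
⟦ A? ⟧ = if does A? then 1ℙ else 0ℙ

⟦⟧-yes : ∀ {A : Set} (A? : Dec A) → A → ⟦ A? ⟧ ≡ 1ℙ
⟦⟧-yes (yes _) _ = refl
⟦⟧-yes (no ¬a) a = contradiction a ¬a

⟦⟧-no : ∀ {A : Set} (A? : Dec A) → ¬ A → ⟦ A? ⟧ ≡ 0ℙ
⟦⟧-no (yes a) ¬a = contradiction a ¬a
⟦⟧-no (no _)  _  = refl

⟦⟧-cong : ∀ {A B : Set} (A? : Dec A) (B? : Dec B) → (A → B) → (B → A) → ⟦ A? ⟧ ≡ ⟦ B? ⟧
⟦⟧-cong (yes a) B? f g = sym (⟦⟧-yes B? (f a))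
⟦⟧-cong (no ¬a) B? f g = sym (⟦⟧-no B? λ b → ¬a (g b))

+-self : ∀ {x y} → x ≡ y → x + y ≡ 0ℙ
+-self {x} refl = ℙ.p+p≡0ℙ x

+-move : ∀ x y {z} → x + y ≡ z → x ≡ y + z
+-move x y refl = solve 2 (λ x y → x := y :+ (x :+ y)) refl x y

parity-suc : ∀ n → parity (suc n) ≡ parity n + 1ℙ
parity-suc n = trans (ℙ.+-homo-+ 1 n) (ℙ.+-comm 1ℙ (parity n))

∑-0 : ∀ {n} {f : Fin n → Parity} → (∀ i → f i ≡ 0ℙ) → ∑ f ≡ 0ℙ
∑-0 {n} f≡0 = trans (∑-cong f≡0) (sum-replicate-zero n)

∑-δ : ∀ {n} (k : Fin n) (f : Fin n → Parity) → ∑ (λ i → ⟦ i Fin.≟ k ⟧ * f i) ≡ f k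
∑-δ {suc n} zero f = trans (cong (λ z → f zero + z) (∑-0 {n} λ _ → refl)) (ℙ.+-identityʳ _)
∑-δ (suc k) f = ∑-δ k (λ i → f (suc i))

-- Off the diagonal the summands cancel in pairs.
∑∑-symmetric : ∀ {n} (f : Fin n → Fin n → Parity) → (∀ i j → f i j ≡ f j i) →
               ∑ (λ i → ∑ λ j → f i j) ≡ ∑ λ i → f i i
∑∑-symmetric {zero}  f f-sym = refl
∑∑-symmetric {suc n} f f-sym = begin
  f zero zero + row + ∑ (λ i → f (suc i) zero + ∑ λ j → f (suc i) (suc j))
    ≡⟨ cong (λ z → f zero zero + row + z) (∑-distrib-+ (λ i → f (suc i) zero) _) ⟩
  f zero zero + row + (∑ (λ i → f (suc i) zero) + ∑ (λ i → ∑ λ j → f (suc i) (suc j)))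
    ≡⟨ cong₂ (λ x y → f zero zero + row + (x + y))
         (∑-cong λ i → f-sym (suc i) zero)
         (∑∑-symmetric (λ i j → f (suc i) (suc j)) λ i j → f-sym (suc i) (suc j)) ⟩
  f zero zero + row + (row + diagonal)
    ≡⟨ solve 3 (λ x y z → x :+ y :+ (y :+ z) := x :+ z) refl (f zero zero) row diagonal ⟩
  f zero zero + diagonal ∎
  where
  row      = ∑ λ j → f zero (suc j)
  diagonal = ∑ λ i → f (suc i) (suc i)

∑∑-cong : ∀ {n} {f g : Fin n → Fin n → Parity} → (∀ i j → f i j ≡ g i j) →
          ∑ (λ i → ∑ λ j → f i j) ≡ ∑ (λ i → ∑ λ j → g i j)
∑∑-cong f≡g = ∑-cong λ i → ∑-cong λ j → f≡g i j

∑∑-distrib-+ : ∀ {n} (f g : Fin n → Fin n → Parity) →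
               ∑ (λ i → ∑ λ j → f i j + g i j) ≡ ∑ (λ i → ∑ (f i)) + ∑ (λ i → ∑ (g i))
∑∑-distrib-+ f g = trans (∑-cong λ i → ∑-distrib-+ (f i) (g i)) (∑-distrib-+ (λ i → ∑ (f i)) λ i → ∑ (g i))

∑∑-permute : ∀ {n} (f : Fin n → Fin n → Parity) (π : Permutation′ n) →
             ∑ (λ i → ∑ (f i)) ≡ ∑ λ i → ∑ λ j → f (π ⟨$⟩ʳ i) (π ⟨$⟩ʳ j)
∑∑-permute f π = trans (∑-permute (λ i → ∑ (f i)) π) (∑-cong λ i → ∑-permute (f (π ⟨$⟩ʳ i)) π)

∑∑-* : ∀ {n} (f g : Fin n → Parity) → ∑ (λ i → ∑ λ j → f i * g j) ≡ ∑ f * ∑ g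
∑∑-* f g = trans (∑-cong λ i → sym (*-distribˡ-sum (f i) g)) (sym (*-distribʳ-sum (∑ g) f))

-- A tournament selects one of the two orders of each pair of distinct indices, so that
-- `T i j * f i j` sums `f` over unordered pairs.
record IsTournament {n} (T : Fin n → Fin n → Parity) : Set where
  field
    irreflexive : ∀ i → T i i ≡ 0ℙ
    total       : ∀ {i j} → i ≢ j → T i j + T j i ≡ 1ℙ

open IsTournament

-- A sum over unordered pairs does not depend on how the pairs are ordered.
tournament-independent : ∀ {n} {T T′ f : Fin n → Fin n → Parity} → IsTournament T → IsTournament T′ →
  (∀ {i j} → i ≢ j → f i j ≡ f j i) →
  ∑ (λ i → ∑ λ j → T i j * f i j) ≡ ∑ (λ i → ∑ λ j → T′ i j * f i j)
tournament-independent {T = T} {T′} {f} t t′ f-sym = begin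
  ∑ (λ i → ∑ λ j → T i j * f i j)
    ≡⟨ ∑∑-cong (λ i j → solve 3 (λ x y z → x :* z := (x :+ y) :* z :+ y :* z) refl (T i j) (T′ i j) (f i j)) ⟩
  ∑ (λ i → ∑ λ j → d i j + T′ i j * f i j)
    ≡⟨ ∑∑-distrib-+ d _ ⟩
  ∑ (λ i → ∑ (d i)) + ∑ (λ i → ∑ λ j → T′ i j * f i j)
    ≡⟨ cong (_+ ∑ (λ i → ∑ λ j → T′ i j * f i j)) (trans (∑∑-symmetric d d-sym) (∑-0 d-diag)) ⟩
  ∑ (λ i → ∑ λ j → T′ i j * f i j) ∎
  where
  -- The difference of the two sums. As both tournaments are total, `T + T′` is symmetric off the
  -- diagonal; on the diagonal it vanishes.
  d : Fin _ → Fin _ → Parity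
  d i j = (T i j + T′ i j) * f i j
  d-diag : ∀ i → d i i ≡ 0ℙ
  d-diag i rewrite irreflexive t i | irreflexive t′ i = refl
  d-sym : ∀ i j → d i j ≡ d j i
  d-sym i j with i Fin.≟ j
  ... | yes refl = refl
  ... | no i≢j = cong₂ _*_ (ℙ.+-cancelʳ-≡ (T j i + T′ j i) _ _ (begin
      T i j + T′ i j + (T j i + T′ j i)
        ≡⟨ solve 4 (λ a b c d → a :+ b :+ (c :+ d) := a :+ c :+ (b :+ d)) refl (T i j) (T′ i j) (T j i) (T′ j i) ⟩
      T i j + T j i + (T′ i j + T′ j i)
        ≡⟨ cong₂ _+_ (total t i≢j) (total t′ i≢j) ⟩
      0ℙ
        ≡⟨ ℙ.p+p≡0ℙ (T j i + T′ j i) ⟨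
      T j i + T′ j i + (T j i + T′ j i) ∎)) (f-sym i≢j)

-- Each unordered pair contributes both `g i j` and `g j i`, which gives the full double sum without
-- its diagonal.
tournament-symmetrized : ∀ {n} {T : Fin n → Fin n → Parity} → IsTournament T → (g : Fin n → Fin n → Parity) →
  ∑ (λ i → ∑ λ j → T i j * (g i j + g j i)) ≡ ∑ (λ i → ∑ (g i)) + ∑ (λ i → g i i)
tournament-symmetrized {T = T} t g = begin
  ∑ (λ i → ∑ λ j → T i j * (g i j + g j i))
    ≡⟨ ∑∑-cong (λ i j → solve 2 (λ x y → x := y :+ (x :+ y)) refl (T i j * (g i j + g j i)) (g i j)) ⟩
  ∑ (λ i → ∑ λ j → g i j + h i j)
    ≡⟨ ∑∑-distrib-+ g h ⟩
  ∑ (λ i → ∑ (g i)) + ∑ (λ i → ∑ (h i))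
    ≡⟨ cong (λ z → ∑ (λ i → ∑ (g i)) + z) (trans (∑∑-symmetric h h-sym) (∑-cong h-diag)) ⟩
  ∑ (λ i → ∑ (g i)) + ∑ (λ i → g i i) ∎
  where
  -- Off the diagonal, `h i j` is `g j i` if `T i j` is odd and `g i j` otherwise, which is the same
  -- value for both orders of the pair.
  h : Fin _ → Fin _ → Parity
  h i j = T i j * (g i j + g j i) + g i j
  h-diag : ∀ i → h i i ≡ g i i
  h-diag i = solve 2 (λ x y → x :* (y :+ y) :+ y := y) refl (T i i) (g i i)
  h-sym : ∀ i j → h i j ≡ h j i
  h-sym i j with i Fin.≟ j
  ... | yes refl = refl
  ... | no i≢j = ℙ.+-cancelʳ-≡ (h j i) _ _ (begin
      h i j + h j i
        ≡⟨ solve 4 (λ a b x y → a :* (x :+ y) :+ x :+ (b :* (y :+ x) :+ y) := (a :+ b :+ con 1ℙ) :* (x :+ y))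
             refl (T i j) (T j i) (g i j) (g j i) ⟩
      (T i j + T j i + 1ℙ) * (g i j + g j i)
        ≡⟨ cong (λ z → (z + 1ℙ) * (g i j + g j i)) (total t i≢j) ⟩
      0ℙ
        ≡⟨ ℙ.p+p≡0ℙ (h j i) ⟨
      h j i + h j i ∎)

∑< : ℕ → (ℕ → Parity) → Parity
∑< zero    f = 0ℙ
∑< (suc n) f = ∑< n f + f n

∑<-cong : ∀ n {f g} → (∀ {k} → k ℕ.< n → f k ≡ g k) → ∑< n f ≡ ∑< n g
∑<-cong zero    f≡g = refl
∑<-cong (suc n) f≡g = cong₂ _+_ (∑<-cong n λ k<n → f≡g (ℕ.m<n⇒m<1+n k<n)) (f≡g (ℕ.n<1+n n))

∑<-distrib-+ : ∀ n f g → ∑< n (λ k → f k + g k) ≡ ∑< n f + ∑< n g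
∑<-distrib-+ zero    f g = refl
∑<-distrib-+ (suc n) f g = trans (cong (_+ (f n + g n)) (∑<-distrib-+ n f g))
  (solve 4 (λ a b c d → a :+ b :+ (c :+ d) := a :+ c :+ (b :+ d)) refl (∑< n f) (∑< n g) (f n) (g n))

*-distribˡ-∑< : ∀ n x f → x * ∑< n f ≡ ∑< n (λ k → x * f k)
*-distribˡ-∑< zero    x f = ℙ.*-zeroʳ x
*-distribˡ-∑< (suc n) x f = trans (ℙ.*-distribˡ-+ x (∑< n f) (f n)) (cong (_+ x * f n) (*-distribˡ-∑< n x f))

∑<-const : ∀ n x → ∑< n (λ _ → x) ≡ parity n * x
∑<-const zero    x = refl
∑<-const (suc n) x = begin
  ∑< n (λ _ → x) + x ≡⟨ cong (_+ x) (∑<-const n x) ⟩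
  parity n * x + x   ≡⟨ solve 2 (λ p x → p :* x :+ x := (p :+ con 1ℙ) :* x) refl (parity n) x ⟩
  (parity n + 1ℙ) * x ≡⟨ cong (_* x) (parity-suc n) ⟨
  parity (suc n) * x ∎

∑<-0 : ∀ n {f} → (∀ {k} → k ℕ.< n → f k ≡ 0ℙ) → ∑< n f ≡ 0ℙ
∑<-0 n f≡0 = trans (∑<-cong n f≡0) (trans (∑<-const n 0ℙ) (ℙ.*-zeroʳ (parity n)))

∑-∑<-comm : ∀ {m} n (f : Fin m → ℕ → Parity) → ∑ (λ i → ∑< n (f i)) ≡ ∑< n (λ k → ∑ λ i → f i k)
∑-∑<-comm {m} zero f = ∑-0 {m} λ _ → refl
∑-∑<-comm (suc n) f = trans (∑-distrib-+ (λ i → ∑< n (f i)) (λ i → f i n)) (cong (_+ ∑ λ i → f i n) (∑-∑<-comm n f))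

∑<-truncate : ∀ {k n} → k ℕ.≤ n → (f : ℕ → Parity) → ∑< n (λ i → ⟦ i ℕ.<? k ⟧ * f i) ≡ ∑< k f
∑<-truncate {k} {zero} ℕ.z≤n f = refl
∑<-truncate {k} {suc n} k≤1+n f with ℕ.m≤n⇒m<n∨m≡n k≤1+n
... | inj₁ (ℕ.s≤s k≤n) = trans (cong₂ _+_ (∑<-truncate k≤n f)
        (cong (_* f n) (⟦⟧-no (n ℕ.<? k) (ℕ.≤⇒≯ k≤n)))) (ℙ.+-identityʳ (∑< k f))
... | inj₂ refl = ∑<-cong k λ {i} i<k → cong (_* f i) (⟦⟧-yes (i ℕ.<? k) i<k)

∑<-count : ∀ {k n} → k ℕ.≤ n → ∑< n (λ i → ⟦ i ℕ.<? k ⟧) ≡ parity k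
∑<-count {k} {n} k≤n = begin
  ∑< n (λ i → ⟦ i ℕ.<? k ⟧)      ≡⟨ ∑<-cong n (λ _ → sym (ℙ.*-identityʳ _)) ⟩
  ∑< n (λ i → ⟦ i ℕ.<? k ⟧ * 1ℙ) ≡⟨ ∑<-truncate k≤n (λ _ → 1ℙ) ⟩
  ∑< k (λ _ → 1ℙ)                ≡⟨ ∑<-const k 1ℙ ⟩
  parity k * 1ℙ                  ≡⟨ ℙ.*-identityʳ _ ⟩
  parity k                       ∎

∑<-δ : ∀ {k n} → k ℕ.< n → (f : ℕ → Parity) → ∑< n (λ i → ⟦ i ℕ.≟ k ⟧ * f i) ≡ f k
∑<-δ {k} {suc n} k<1+n f with ℕ.m≤n⇒m<n∨m≡n k<1+n
... | inj₁ (ℕ.s≤s k<n) = trans (cong₂ _+_ (∑<-δ k<n f)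
        (cong (_* f n) (⟦⟧-no (n ℕ.≟ k) λ n≡k → ℕ.<⇒≢ k<n (sym n≡k)))) (ℙ.+-identityʳ (f k))
... | inj₂ refl = cong₂ _+_
        (∑<-0 k {λ i → ⟦ i ℕ.≟ k ⟧ * f i} λ {i} i<k → cong (_* f i) (⟦⟧-no (i ℕ.≟ k) (ℕ.<⇒≢ i<k)))
        (cong (_* f k) (⟦⟧-yes (k ℕ.≟ k) refl))

-- Crossings in a matching of the glued rectangle

Cell : Set
Cell = ℕ × ℕ

col row : Cell → ℕ
col = proj₁
row = proj₂

-- `before` is the strict row-major order; its two summands exclude each other, so their sum is a
-- disjunction.
sameRow before : Cell → Cell → Parity
sameRow s s′ = ⟦ row s ℕ.≟ row s′ ⟧
before  s s′ = ⟦ row s ℕ.<? row s′ ⟧ + sameRow s s′ * ⟦ col s ℕ.<? col s′ ⟧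

<-irrefl-⟦⟧ : ∀ n → ⟦ n ℕ.<? n ⟧ ≡ 0ℙ
<-irrefl-⟦⟧ n = ⟦⟧-no (n ℕ.<? n) (ℕ.<-irrefl refl)

<-total-⟦⟧ : ∀ {m n} → m ≢ n → ⟦ m ℕ.<? n ⟧ + ⟦ n ℕ.<? m ⟧ ≡ 1ℙ
<-total-⟦⟧ {m} {n} m≢n with ℕ.<-≤-connex m n
... | inj₁ m<n = cong₂ _+_ (⟦⟧-yes (m ℕ.<? n) m<n) (⟦⟧-no (n ℕ.<? m) (ℕ.<⇒≯ m<n))
... | inj₂ n≤m = cong₂ _+_ (⟦⟧-no (m ℕ.<? n) (ℕ.≤⇒≯ n≤m))
                            (⟦⟧-yes (n ℕ.<? m) (ℕ.≤∧≢⇒< n≤m λ n≡m → m≢n (sym n≡m)))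

before-row : ∀ c c′ r → before (c , r) (c′ , r) ≡ ⟦ c ℕ.<? c′ ⟧
before-row c c′ r = cong₂ (λ x y → x + y * ⟦ c ℕ.<? c′ ⟧) (<-irrefl-⟦⟧ r) (⟦⟧-yes (r ℕ.≟ r) refl)

before-irrefl : ∀ s → before s s ≡ 0ℙ
before-irrefl (c , r) = trans (before-row c c r) (<-irrefl-⟦⟧ c)

before-total : ∀ {s s′} → s ≢ s′ → before s s′ + before s′ s ≡ 1ℙ
before-total {c , r} {c′ , r′} s≢s′ with r ℕ.≟ r′
... | yes refl = trans (cong₂ _+_ (before-row c c′ r) (before-row c′ c r))
                   (<-total-⟦⟧ λ c≡c′ → s≢s′ (cong (_, r) c≡c′))
... | no r≢r′ = begin
  ⟦ r ℕ.<? r′ ⟧ + ⟦ r ℕ.≟ r′ ⟧ * ⟦ c ℕ.<? c′ ⟧ + (⟦ r′ ℕ.<? r ⟧ + ⟦ r′ ℕ.≟ r ⟧ * ⟦ c′ ℕ.<? c ⟧)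
    ≡⟨ cong₂ (λ x y → ⟦ r ℕ.<? r′ ⟧ + x * ⟦ c ℕ.<? c′ ⟧ + (⟦ r′ ℕ.<? r ⟧ + y * ⟦ c′ ℕ.<? c ⟧))
         (⟦⟧-no (r ℕ.≟ r′) r≢r′) (⟦⟧-no (r′ ℕ.≟ r) λ r′≡r → r≢r′ (sym r′≡r)) ⟩
  ⟦ r ℕ.<? r′ ⟧ + 0ℙ + (⟦ r′ ℕ.<? r ⟧ + 0ℙ)
    ≡⟨ cong₂ _+_ (ℙ.+-identityʳ ⟦ r ℕ.<? r′ ⟧) (ℙ.+-identityʳ ⟦ r′ ℕ.<? r ⟧) ⟩
  ⟦ r ℕ.<? r′ ⟧ + ⟦ r′ ℕ.<? r ⟧
    ≡⟨ <-total-⟦⟧ r≢r′ ⟩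
  1ℙ ∎

before-flip : ∀ {s s′} → s ≢ s′ → before s′ s ≡ 1ℙ + before s s′
before-flip {s} {s′} s≢s′ = trans (+-move (before s′ s) (before s s′)
  (trans (ℙ.+-comm (before s′ s) (before s s′)) (before-total s≢s′))) (ℙ.+-comm (before s s′) 1ℙ)

Inside : ℕ → ℕ → Cell → Set
Inside x₀ y₁ (c , r) = c ℕ.< x₀ × r ℕ.< y₁

-- A domino of the torus, from its left or bottom cell to the other one; the
-- fundamental rectangle is glued by (x₀ , 0) and (x₁ , y₁).
data Step (x₀ x₁ y₁ : ℕ) : Cell → Cell → Set where
  right  : ∀ {c r} → Step x₀ x₁ y₁ (c , r) (suc c , r)
  right↺ : ∀ {c r} → suc c ≡ x₀ → Step x₀ x₁ y₁ (c , r) (0 , r)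
  up     : ∀ {c r} → Step x₀ x₁ y₁ (c , r) (c , suc r)
  -- The cell above the top row is (c , y₁), congruent to (c - x₁ , 0) and, if this column is
  -- negative, to (c + x₀ - x₁ , 0). The equations avoid truncated subtraction.
  up↺<   : ∀ {c c′ r} → c ℕ.< x₁ → c′ ℕ.+ x₁ ≡ c ℕ.+ x₀ → suc r ≡ y₁ → Step x₀ x₁ y₁ (c , r) (c′ , 0)
  up↺≥   : ∀ {c c′ r} → c′ ℕ.+ x₁ ≡ c → suc r ≡ y₁ → Step x₀ x₁ y₁ (c , r) (c′ , 0)

module _ {x₀ x₁ y₁ : ℕ} where

  -- isWrap and isLift mark the dominoes crossing the left and the bottom side of
  -- the rectangle, isTwist those crossing the horizontal part of u(1).
  isVertical isWrap isLift isTwist : ∀ {p q} → Step x₀ x₁ y₁ p q → Parity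
  isVertical right          = 0ℙ
  isVertical (right↺ _)     = 0ℙ
  isVertical up             = 1ℙ
  isVertical (up↺< _ _ _)   = 1ℙ
  isVertical (up↺≥ _ _)     = 1ℙ
  isWrap right              = 0ℙ
  isWrap (right↺ _)         = 1ℙ
  isWrap up                 = 0ℙ
  isWrap (up↺< _ _ _)       = 0ℙ
  isWrap (up↺≥ _ _)         = 0ℙ
  isLift right              = 0ℙ
  isLift (right↺ _)         = 0ℙ
  isLift up                 = 0ℙ
  isLift (up↺< _ _ _)       = 1ℙ
  isLift (up↺≥ _ _)         = 1ℙ
  isTwist right             = 0ℙ
  isTwist (right↺ _)        = 0ℙ
  isTwist up                = 0ℙ
  isTwist (up↺< _ _ _)      = 1ℙ
  isTwist (up↺≥ _ _)        = 0ℙ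

  -- The cells of a horizontal domino are consecutive in the row order unless it wraps. Then they
  -- are the two ends of their row, and exactly the other cells of that row lie between them. The
  -- factor `1ℙ + isVertical e` selects horizontal dominoes.
  horizontal-before : ∀ {p q s} (e : Step x₀ x₁ y₁ p q) → Inside x₀ y₁ s → s ≢ p → s ≢ q →
    (1ℙ + isVertical e) * (before s p + before s q) ≡ isWrap e * sameRow s p
  horizontal-before {c , r} {s = c′ , r′} right _ s≢p s≢q with r′ ℕ.≟ r
  ... | no r′≢r = trans (cong (λ x → ⟦ r′ ℕ.<? r ⟧ + x * ⟦ c′ ℕ.<? c ⟧ + (⟦ r′ ℕ.<? r ⟧ + x * ⟦ c′ ℕ.<? suc c ⟧))
                    (⟦⟧-no (r′ ℕ.≟ r) r′≢r)) (ℙ.p+p≡0ℙ (⟦ r′ ℕ.<? r ⟧ + 0ℙ))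
  ... | yes refl = +-self (trans (before-row c′ c r) (trans
          (⟦⟧-cong (c′ ℕ.<? c) (c′ ℕ.<? suc c) ℕ.m<n⇒m<1+n
            λ where (ℕ.s≤s c′≤c) → ℕ.≤∧≢⇒< c′≤c λ c′≡c → s≢p (cong (_, r) c′≡c))
          (sym (before-row c′ (suc c) r))))
  horizontal-before {c , r} {s = c′ , r′} (right↺ refl) (ℕ.s≤s c′≤c , _) s≢p s≢q with r′ ℕ.≟ r
  ... | no r′≢r = trans (cong (λ x → ⟦ r′ ℕ.<? r ⟧ + x * ⟦ c′ ℕ.<? c ⟧ + (⟦ r′ ℕ.<? r ⟧ + x * ⟦ c′ ℕ.<? 0 ⟧))
                    (⟦⟧-no (r′ ℕ.≟ r) r′≢r)) (trans (ℙ.p+p≡0ℙ (⟦ r′ ℕ.<? r ⟧ + 0ℙ))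
                      (sym (⟦⟧-no (r′ ℕ.≟ r) r′≢r)))
  ... | yes refl = trans (cong₂ _+_ (trans (before-row c′ c r) (⟦⟧-yes (c′ ℕ.<? c)
                      (ℕ.≤∧≢⇒< c′≤c λ c′≡c → s≢p (cong (_, r) c′≡c)))) (before-row c′ 0 r))
                     (sym (⟦⟧-yes (r ℕ.≟ r) refl))
  horizontal-before up           _ _ _ = refl
  horizontal-before (up↺< _ _ _) _ _ _ = refl
  horizontal-before (up↺≥ _ _)   _ _ _ = refl

  before-horizontal : ∀ {p q s} (e : Step x₀ x₁ y₁ p q) → Inside x₀ y₁ s → s ≢ p → s ≢ q →
    (1ℙ + isVertical e) * (before p s + before q s) ≡ isWrap e * sameRow s p
  before-horizontal {p} {q} {s} e s∈ s≢p s≢q = trans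
    (cong₂ (λ x y → h * (x + y)) (before-flip s≢p) (before-flip s≢q))
    (trans (solve 3 (λ h x y → h :* (con 1ℙ :+ x :+ (con 1ℙ :+ y)) := h :* (x :+ y)) refl
              h (before s p) (before s q))
      (horizontal-before e s∈ s≢p s≢q))
    where h = 1ℙ + isVertical e

  horizontal-row : ∀ {p q} (e : Step x₀ x₁ y₁ p q) r → (1ℙ + isVertical e) * (⟦ row p ℕ.≟ r ⟧ + ⟦ row q ℕ.≟ r ⟧) ≡ 0ℙ
  horizontal-row {_ , r} right      r′ = ℙ.p+p≡0ℙ ⟦ r ℕ.≟ r′ ⟧
  horizontal-row {_ , r} (right↺ _) r′ = ℙ.p+p≡0ℙ ⟦ r ℕ.≟ r′ ⟧
  horizontal-row up           _ = refl
  horizontal-row (up↺< _ _ _) _ = refl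
  horizontal-row (up↺≥ _ _)   _ = refl

  horizontal-wrap : ∀ {p q} (e : Step x₀ x₁ y₁ p q) → (1ℙ + isVertical e) * before p q ≡ 1ℙ + isVertical e + isWrap e
  horizontal-wrap {c , r} right      = trans (before-row c (suc c) r) (⟦⟧-yes (c ℕ.<? suc c) (ℕ.n<1+n c))
  horizontal-wrap {c , r} (right↺ _) = before-row c 0 r
  horizontal-wrap up           = refl
  horizontal-wrap (up↺< _ _ _) = refl
  horizontal-wrap (up↺≥ _ _)   = refl

  wrap-horizontal : ∀ {p q} (e : Step x₀ x₁ y₁ p q) → isVertical e * isWrap e ≡ 0ℙ
  wrap-horizontal right        = refl
  wrap-horizontal (right↺ _)   = refl
  wrap-horizontal up           = refl
  wrap-horizontal (up↺< _ _ _) = refl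
  wrap-horizontal (up↺≥ _ _)   = refl

  lift-vertical : ∀ {p q} (e : Step x₀ x₁ y₁ p q) → isVertical e * isLift e ≡ isLift e
  lift-vertical right        = refl
  lift-vertical (right↺ _)   = refl
  lift-vertical up           = refl
  lift-vertical (up↺< _ _ _) = refl
  lift-vertical (up↺≥ _ _)   = refl

  lift-twist : ∀ {p q} (e : Step x₀ x₁ y₁ p q) → isLift e * isTwist e ≡ isTwist e
  lift-twist right        = refl
  lift-twist (right↺ _)   = refl
  lift-twist up           = refl
  lift-twist (up↺< _ _ _) = refl
  lift-twist (up↺≥ _ _)   = refl

  vertical-bottom : ∀ {p q} (e : Step x₀ x₁ y₁ p q) → isVertical e * ⟦ row q ℕ.≟ 0 ⟧ ≡ isLift e
  vertical-bottom right        = refl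
  vertical-bottom (right↺ _)   = refl
  vertical-bottom up           = refl
  vertical-bottom (up↺< _ _ _) = refl
  vertical-bottom (up↺≥ _ _)   = refl

  wrap-left : ∀ {p q} (e : Step x₀ x₁ y₁ p q) → ⟦ col q ℕ.≟ 0 ⟧ * (1ℙ + isVertical e) ≡ isWrap e
  wrap-left right        = refl
  wrap-left (right↺ _)   = refl
  wrap-left up           = ℙ.*-zeroʳ _
  wrap-left (up↺< _ _ _) = ℙ.*-zeroʳ _
  wrap-left (up↺≥ _ _)   = ℙ.*-zeroʳ _

  -- That `q` lies in the rectangle excludes an `up` step from the top row, and `up↺≥` starts at a
  -- column not below `x₁`.
  twist-top : ∀ {p q} (e : Step x₀ x₁ y₁ p q) → Inside x₀ y₁ q →
    ⟦ suc (row p) ℕ.≟ y₁ ⟧ * ⟦ col p ℕ.<? x₁ ⟧ * isVertical e ≡ isTwist e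
  twist-top right      _ = ℙ.*-zeroʳ _
  twist-top (right↺ _) _ = ℙ.*-zeroʳ _
  twist-top {c , r} up (_ , 1+r<y₁) =
    cong (λ x → x * ⟦ c ℕ.<? x₁ ⟧ * 1ℙ) (⟦⟧-no (suc r ℕ.≟ y₁) (ℕ.<⇒≢ 1+r<y₁))
  twist-top {c , r} (up↺< c<x₁ _ refl) _ =
    cong₂ (λ x y → x * y * 1ℙ) (⟦⟧-yes (suc r ℕ.≟ suc r) refl) (⟦⟧-yes (c ℕ.<? x₁) c<x₁)
  twist-top {c , r} {d , _} (up↺≥ eq refl) _ =
    cong₂ (λ x y → x * y * 1ℙ) (⟦⟧-yes (suc r ℕ.≟ suc r) refl)
      (⟦⟧-no (c ℕ.<? x₁) (ℕ.≤⇒≯ (ℕ.m+n≤o⇒n≤o d (ℕ.≤-reflexive eq))))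

  -- A lifting domino starts in the top row and ends in the bottom row, so it is counted on neither
  -- side.
  vertical-row : ∀ {p q r} (e : Step x₀ x₁ y₁ p q) → suc r ℕ.< y₁ →
    isVertical e * ⟦ row p ℕ.≟ r ⟧ ≡ isVertical e * ⟦ row q ℕ.≟ suc r ⟧
  vertical-row right      _ = refl
  vertical-row (right↺ _) _ = refl
  vertical-row up         _ = refl
  vertical-row {_ , r′} {r = r} (up↺< _ _ refl) r<r′ = ⟦⟧-no (r′ ℕ.≟ r) λ r′≡r → ℕ.<⇒≢ r<r′ (cong suc (sym r′≡r))
  vertical-row {_ , r′} {r = r} (up↺≥ _ refl)   r<r′ = ⟦⟧-no (r′ ℕ.≟ r) λ r′≡r → ℕ.<⇒≢ r<r′ (cong suc (sym r′≡r))

  -- Translation by a vertical domino preserves the order of the cells, except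
  -- that it moves the top row to the bottom and rotates it by x₁.
  vertical-before : ∀ {p q p′ q′} (e : Step x₀ x₁ y₁ p q) (e′ : Step x₀ x₁ y₁ p′ q′) →
    Inside x₀ y₁ p → Inside x₀ y₁ q → Inside x₀ y₁ p′ → Inside x₀ y₁ q′ →
    isVertical e * isVertical e′ * (before p p′ + before q q′) ≡
    isVertical e′ * (isLift e * (1ℙ + isLift e′)) + isLift e * isLift e′ * isTwist e +
    (isVertical e * (isLift e′ * (1ℙ + isLift e)) + isLift e′ * isLift e * isTwist e′)
  vertical-before right      right         _ _ _ _ = refl
  vertical-before right      (right↺ _)    _ _ _ _ = refl
  vertical-before right      up            _ _ _ _ = refl
  vertical-before right      (up↺< _ _ _)  _ _ _ _ = refl
  vertical-before right      (up↺≥ _ _)    _ _ _ _ = refl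
  vertical-before (right↺ _) right         _ _ _ _ = refl
  vertical-before (right↺ _) (right↺ _)    _ _ _ _ = refl
  vertical-before (right↺ _) up            _ _ _ _ = refl
  vertical-before (right↺ _) (up↺< _ _ _)  _ _ _ _ = refl
  vertical-before (right↺ _) (up↺≥ _ _)    _ _ _ _ = refl
  vertical-before up           right       _ _ _ _ = refl
  vertical-before up           (right↺ _)  _ _ _ _ = refl
  vertical-before (up↺< _ _ _) right       _ _ _ _ = refl
  vertical-before (up↺< _ _ _) (right↺ _)  _ _ _ _ = refl
  vertical-before (up↺≥ _ _)   right       _ _ _ _ = refl
  vertical-before (up↺≥ _ _)   (right↺ _)  _ _ _ _ = refl
  vertical-before {p} {p′ = p′} up up _ _ _ _ = ℙ.p+p≡0ℙ (before p p′)
  -- A lifting domino leaves the last row for the first, so its order relative to every `up` step is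
  -- reversed.
  vertical-before {c , r} {p′ = c′ , r′} up (up↺< _ _ refl) _ (_ , ℕ.s≤s r<r′) _ _ = trans (ℙ.+-identityʳ _)
    (cong₂ (λ x y → x + y * ⟦ c ℕ.<? c′ ⟧) (⟦⟧-yes (r ℕ.<? r′) r<r′) (⟦⟧-no (r ℕ.≟ r′) (ℕ.<⇒≢ r<r′)))
  vertical-before {c , r} {p′ = c′ , r′} up (up↺≥ _ refl) _ (_ , ℕ.s≤s r<r′) _ _ = trans (ℙ.+-identityʳ _)
    (cong₂ (λ x y → x + y * ⟦ c ℕ.<? c′ ⟧) (⟦⟧-yes (r ℕ.<? r′) r<r′) (⟦⟧-no (r ℕ.≟ r′) (ℕ.<⇒≢ r<r′)))
  vertical-before {c , r} {p′ = c′ , r′} (up↺< _ _ refl) up _ _ _ (_ , ℕ.s≤s r′<r) = cong₂ (λ x y → x + y * ⟦ c ℕ.<? c′ ⟧ + 1ℙ)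
      (⟦⟧-no (r ℕ.<? r′) (ℕ.<⇒≯ r′<r)) (⟦⟧-no (r ℕ.≟ r′) λ r≡r′ → ℕ.<⇒≢ r′<r (sym r≡r′))
  vertical-before {c , r} {p′ = c′ , r′} (up↺≥ _ refl) up _ _ _ (_ , ℕ.s≤s r′<r) = cong₂ (λ x y → x + y * ⟦ c ℕ.<? c′ ⟧ + 1ℙ)
      (⟦⟧-no (r ℕ.<? r′) (ℕ.<⇒≯ r′<r)) (⟦⟧-no (r ℕ.≟ r′) λ r≡r′ → ℕ.<⇒≢ r′<r (sym r≡r′))
  vertical-before {c , r} {d , _} {c′ , _} {d′ , _} (up↺< _ d≡ refl) (up↺< _ d′≡ refl) _ _ _ _ =
    +-self (trans (before-row c c′ r) (trans (⟦⟧-cong (c ℕ.<? c′) (d ℕ.<? d′)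
      (λ c<c′ → ℕ.+-cancelʳ-< x₁ d d′ (subst₂ ℕ._<_ (sym d≡) (sym d′≡) (ℕ.+-monoˡ-< x₀ c<c′)))
      (λ d<d′ → ℕ.+-cancelʳ-< x₀ c c′ (subst₂ ℕ._<_ d≡ d′≡ (ℕ.+-monoˡ-< x₁ d<d′))))
      (sym (before-row d d′ 0))))
  vertical-before {c , r} {d , _} {c′ , _} {d′ , _} (up↺≥ d≡ refl) (up↺≥ d′≡ refl) _ _ _ _ =
    +-self (trans (before-row c c′ r) (trans (⟦⟧-cong (c ℕ.<? c′) (d ℕ.<? d′)
      (λ c<c′ → ℕ.+-cancelʳ-< x₁ d d′ (subst₂ ℕ._<_ (sym d≡) (sym d′≡) c<c′))
      (λ d<d′ → subst₂ ℕ._<_ d≡ d′≡ (ℕ.+-monoˡ-< x₁ d<d′)))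
      (sym (before-row d d′ 0))))
  -- The rotation puts the columns below `x₁` behind the others, so two lifting dominoes change
  -- order exactly when one of them twists.
  vertical-before {c , r} {d , _} {c′ , _} {d′ , _} (up↺< c<x₁ d≡ refl) (up↺≥ d′≡ refl) _ _ (c′<x₀ , _) _ =
    cong₂ _+_ (trans (before-row c c′ r) (⟦⟧-yes (c ℕ.<? c′) (ℕ.<-≤-trans c<x₁
                (ℕ.m+n≤o⇒n≤o d′ (ℕ.≤-reflexive d′≡)))))
              (trans (before-row d d′ 0) (⟦⟧-no (d ℕ.<? d′) (ℕ.<⇒≯ (ℕ.+-cancelʳ-< x₁ d′ d
                (subst₂ ℕ._<_ (sym d′≡) (sym d≡) (ℕ.<-≤-trans c′<x₀ (ℕ.m≤n+m x₀ c)))))))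
  vertical-before {c , r} {d , _} {c′ , _} {d′ , _} (up↺≥ d≡ refl) (up↺< c′<x₁ d′≡ refl) (c<x₀ , _) _ _ _ =
    cong₂ _+_ (trans (before-row c c′ r) (⟦⟧-no (c ℕ.<? c′) (ℕ.<⇒≯ (ℕ.<-≤-trans c′<x₁
                (ℕ.m+n≤o⇒n≤o d (ℕ.≤-reflexive d≡))))))
              (trans (before-row d d′ 0) (⟦⟧-yes (d ℕ.<? d′) (ℕ.+-cancelʳ-< x₁ d d′
                (subst₂ ℕ._<_ (sym d≡) (sym d′≡) (ℕ.<-≤-trans c<x₀ (ℕ.m≤n+m x₀ c′))))))

record TorusMatching (x₀ x₁ y₁ m : ℕ) : Set where
  field
    p q       : Fin m → Cell
    step      : ∀ i → Step x₀ x₁ y₁ (p i) (q i)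
    p-inside  : ∀ i → Inside x₀ y₁ (p i)
    q-inside  : ∀ i → Inside x₀ y₁ (q i)
    p≢p       : ∀ {i j} → i ≢ j → p i ≢ p j
    q≢q       : ∀ {i j} → i ≢ j → q i ≢ q j
    p≢q       : ∀ i j → p i ≢ q j
    -- With the inequalities above, this says that the ends exhaust the rectangle, each cell once,
    -- in the form in which cells get counted.
    partition : (F : Cell → Parity) → ∑ (λ i → F (p i)) + ∑ (λ i → F (q i)) ≡ ∑< y₁ λ r → ∑< x₀ λ c → F (c , r)

-- Counting vertical dominoes and crossings

module _ {x₀ x₁ y₁ m} (M : TorusMatching x₀ x₁ y₁ m) where
  open TorusMatching M

  private
    v h ω z a : Fin m → Parity
    v i = isVertical (step i)
    h i = 1ℙ + v i
    ω i = isWrap (step i)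
    z i = isLift (step i)
    a i = isTwist (step i)

  verticals wraps lifts twists : Parity
  verticals = ∑ v
  wraps     = ∑ ω
  lifts     = ∑ z
  twists    = ∑ a

  -- Compare each end of one arc with each end of the other: an even number of the four comparisons
  -- hold if the arcs are disjoint or nested, an odd number if they cross.
  crossing : Fin m → Fin m → Parity
  crossing i j = before (p i) (p j) + before (q i) (q j) + (before (p i) (q j) + before (q i) (p j))

  -- Used to count the pairs of vertical dominoes by the order of their targets: together with the
  -- comparisons of sources with `q j`, this ranges over all ends of vertical dominoes before `q j`.
  precedence-isTournament : IsTournament λ i j → before (q i) (q j)
  precedence-isTournament .irreflexive i = before-irrefl (q i)
  precedence-isTournament .total i≢j = before-total (q≢q i≢j)

  module _ (x₀-even : parity x₀ ≡ 0ℙ) where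

    row-even : ∀ r → ∑ (λ i → ⟦ row (p i) ℕ.≟ r ⟧) + ∑ (λ i → ⟦ row (q i) ℕ.≟ r ⟧) ≡ 0ℙ
    row-even r = trans (partition λ s → ⟦ row s ℕ.≟ r ⟧) (∑<-0 y₁ λ {r′} _ →
      trans (∑<-const x₀ ⟦ r′ ℕ.≟ r ⟧) (cong (_* ⟦ r′ ℕ.≟ r ⟧) x₀-even))

    -- A row has evenly many cells, and horizontal dominoes occupy them in pairs, so as many
    -- vertical dominoes leave the row as enter it, modulo 2.
    vertical-row-even : ∀ r → ∑ (λ i → v i * ⟦ row (p i) ℕ.≟ r ⟧) ≡ ∑ (λ i → v i * ⟦ row (q i) ℕ.≟ r ⟧)
    vertical-row-even r = trans (+-move _ _ (begin
      ∑ (λ i → v i * P i) + ∑ (λ i → v i * Q i)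
        ≡⟨ ∑-distrib-+ (λ i → v i * P i) (λ i → v i * Q i) ⟨
      ∑ (λ i → v i * P i + v i * Q i)
        ≡⟨ ∑-cong (λ i → trans
             (solve 3 (λ v p q → v :* p :+ v :* q := p :+ q :+ (con 1ℙ :+ v) :* (p :+ q)) refl (v i) (P i) (Q i))
             (trans (cong (λ z → P i + Q i + z) (horizontal-row (step i) r)) (ℙ.+-identityʳ (P i + Q i)))) ⟩
      ∑ (λ i → P i + Q i)
        ≡⟨ ∑-distrib-+ P Q ⟩
      ∑ P + ∑ Q
        ≡⟨ row-even r ⟩
      0ℙ ∎)) (ℙ.+-identityʳ _)
      where
      P Q : Fin m → Parity
      P i = ⟦ row (p i) ℕ.≟ r ⟧
      Q i = ⟦ row (q i) ℕ.≟ r ⟧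

    -- Induction upwards from the bottom row: what enters a row also leaves it modulo 2, and then
    -- enters the next one.
    vertical-row-count : ∀ {r} → r ℕ.< y₁ → ∑ (λ i → v i * ⟦ row (q i) ℕ.≟ r ⟧) ≡ lifts
    vertical-row-count {zero}  _     = ∑-cong λ i → vertical-bottom (step i)
    vertical-row-count {suc r} r<y₁ = begin
      ∑ (λ i → v i * ⟦ row (q i) ℕ.≟ suc r ⟧) ≡⟨ ∑-cong (λ i → vertical-row (step i) r<y₁) ⟨
      ∑ (λ i → v i * ⟦ row (p i) ℕ.≟ r ⟧)     ≡⟨ vertical-row-even r ⟩
      ∑ (λ i → v i * ⟦ row (q i) ℕ.≟ r ⟧)     ≡⟨ vertical-row-count (ℕ.<-trans (ℕ.n<1+n r) r<y₁) ⟩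
      lifts ∎

    -- All rows receive equally many vertical dominoes modulo 2, so a weight that depends on the row
    -- alone factors out.
    ∑-vertical-row : ∀ F → ∑ (λ i → v i * F (row (q i))) ≡ lifts * ∑< y₁ F
    ∑-vertical-row F = begin
      ∑ (λ i → v i * F (row (q i)))
        ≡⟨ ∑-cong (λ i → cong (v i *_) (trans
             (sym (∑<-δ (proj₂ (q-inside i)) F))
             (∑<-cong y₁ λ {r} _ → cong (_* F r) (⟦⟧-cong (r ℕ.≟ row (q i)) (row (q i) ℕ.≟ r) sym sym)))) ⟩
      ∑ (λ i → v i * ∑< y₁ (λ r → ⟦ row (q i) ℕ.≟ r ⟧ * F r))
        ≡⟨ ∑-cong (λ i → *-distribˡ-∑< y₁ (v i) _) ⟩
      ∑ (λ i → ∑< y₁ (λ r → v i * (⟦ row (q i) ℕ.≟ r ⟧ * F r)))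
        ≡⟨ ∑-∑<-comm {m} y₁ _ ⟩
      ∑< y₁ (λ r → ∑ (λ i → v i * (⟦ row (q i) ℕ.≟ r ⟧ * F r)))
        ≡⟨ ∑<-cong y₁ (λ {r} r<y₁ → trans
             (∑-cong λ i → sym (ℙ.*-assoc (v i) _ (F r)))
             (trans (sym (*-distribʳ-sum (F r) (λ i → v i * ⟦ row (q i) ℕ.≟ r ⟧)))
               (cong (_* F r) (vertical-row-count r<y₁)))) ⟩
      ∑< y₁ (λ r → lifts * F r)
        ≡⟨ *-distribˡ-∑< y₁ lifts F ⟨
      lifts * ∑< y₁ F ∎

    verticals-count : verticals ≡ lifts * parity y₁
    verticals-count = begin
      ∑ v                     ≡⟨ ∑-cong (λ i → sym (ℙ.*-identityʳ (v i))) ⟩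
      ∑ (λ i → v i * 1ℙ)      ≡⟨ ∑-vertical-row (λ _ → 1ℙ) ⟩
      lifts * ∑< y₁ (λ _ → 1ℙ) ≡⟨ cong (lifts *_) (trans (∑<-const y₁ 1ℙ) (ℙ.*-identityʳ _)) ⟩
      lifts * parity y₁       ∎

    -- The rows below `s` are full and of even length; its own row contributes `col s` cells.
    before-count : ∀ {s} → Inside x₀ y₁ s → ∑ (λ i → before (p i) s) + ∑ (λ i → before (q i) s) ≡ parity (col s)
    before-count {c , r} (c<x₀ , r<y₁) = begin
      ∑ (λ i → before (p i) (c , r)) + ∑ (λ i → before (q i) (c , r))
        ≡⟨ partition (λ s → before s (c , r)) ⟩
      ∑< y₁ (λ r′ → ∑< x₀ λ c′ → ⟦ r′ ℕ.<? r ⟧ + ⟦ r′ ℕ.≟ r ⟧ * ⟦ c′ ℕ.<? c ⟧)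
        ≡⟨ ∑<-cong y₁ (λ {r′} _ → trans (∑<-distrib-+ x₀ (λ _ → ⟦ r′ ℕ.<? r ⟧) _) (cong₂ _+_
             (trans (∑<-const x₀ ⟦ r′ ℕ.<? r ⟧) (cong (_* ⟦ r′ ℕ.<? r ⟧) x₀-even))
             (trans (sym (*-distribˡ-∑< x₀ ⟦ r′ ℕ.≟ r ⟧ _))
               (cong (⟦ r′ ℕ.≟ r ⟧ *_) (∑<-count (ℕ.<⇒≤ c<x₀)))))) ⟩
      ∑< y₁ (λ r′ → ⟦ r′ ℕ.≟ r ⟧ * parity c)
        ≡⟨ ∑<-δ r<y₁ (λ _ → parity c) ⟩
      parity c ∎

    private
      -- `Y` stems from wrapping horizontal dominoes, `J` from the change of order that the vertical
      -- gluing causes, and `G` compares the source of one vertical domino with the target of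
      -- another.
      Y J G : Fin m → Fin m → Parity
      Y i j = ω j * (sameRow (p i) (p j) + sameRow (q i) (p j))
      J i j = v j * (z i * (1ℙ + z j)) + z i * z j * a i
      G i j = v i * v j * before (p i) (q j)

      -- The comparisons are split by whether `i` and `j` are vertical. A horizontal domino counts
      -- only if it wraps; for two vertical ones `vertical-before` treats the comparisons of like
      -- ends. The summand `v i * v j` comes from reversing `before (q i) (p j)`.
      crossing-decomposition : ∀ {i j} → i ≢ j →
        crossing i j ≡ (Y i j + Y j i) + (J i j + J j i) + (G i j + G j i) + v i * v j
      crossing-decomposition {i} {j} i≢j = begin
        crossing i j
          ≡⟨ solve 6 (λ v v′ pp qq pq qp →
               pp :+ qq :+ (pq :+ qp) :=
               ((con 1ℙ :+ v′) :* (pp :+ pq) :+ (con 1ℙ :+ v′) :* (qp :+ qq)) :+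
               v′ :* ((con 1ℙ :+ v) :* (pp :+ qp) :+ (con 1ℙ :+ v) :* (pq :+ qq)) :+
               v :* v′ :* (pp :+ qq) :+ v :* v′ :* (pq :+ qp))
               refl (v i) (v j) (before (p i) (p j)) (before (q i) (q j)) (before (p i) (q j)) (before (q i) (p j)) ⟩
        (h j * (before (p i) (p j) + before (p i) (q j)) + h j * (before (q i) (p j) + before (q i) (q j))) +
        v j * (h i * (before (p i) (p j) + before (q i) (p j)) + h i * (before (p i) (q j) + before (q i) (q j))) +
        v i * v j * (before (p i) (p j) + before (q i) (q j)) + v i * v j * (before (p i) (q j) + before (q i) (p j))
          ≡⟨ cong₂ _+_ (cong₂ _+_ (cong₂ _+_ (cong₂ _+_
               (horizontal-before (step j) (p-inside i) (p≢p i≢j) (p≢q i j))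
               (horizontal-before (step j) (q-inside i) (λ e → p≢q j i (sym e)) (q≢q i≢j)))
               (cong (v j *_) (cong₂ _+_
                 (before-horizontal (step i) (p-inside j) (λ e → p≢p i≢j (sym e)) (p≢q j i))
                 (before-horizontal (step i) (q-inside j) (λ e → p≢q i j (sym e)) (λ e → q≢q i≢j (sym e))))))
               (vertical-before (step i) (step j) (p-inside i) (q-inside i) (p-inside j) (q-inside j)))
               (cong (λ x → v i * v j * (before (p i) (q j) + x)) (before-flip (p≢q j i))) ⟩
        (ω j * sameRow (p i) (p j) + ω j * sameRow (q i) (p j)) +
        v j * (ω i * sameRow (p j) (p i) + ω i * sameRow (q j) (p i)) +
        (J i j + J j i) + v i * v j * (before (p i) (q j) + (1ℙ + before (p j) (q i)))
          ≡⟨ cong (λ x → (ω j * sameRow (p i) (p j) + ω j * sameRow (q i) (p j)) + x +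
               (J i j + J j i) + v i * v j * (before (p i) (q j) + (1ℙ + before (p j) (q i)))) v*Y ⟩
        (ω j * sameRow (p i) (p j) + ω j * sameRow (q i) (p j)) + Y j i +
        (J i j + J j i) + v i * v j * (before (p i) (q j) + (1ℙ + before (p j) (q i)))
          ≡⟨ solve 9 (λ ω s s′ y J v v′ b b′ →
               (ω :* s :+ ω :* s′) :+ y :+ J :+ v :* v′ :* (b :+ (con 1ℙ :+ b′)) :=
               (ω :* (s :+ s′) :+ y) :+ J :+ (v :* v′ :* b :+ v′ :* v :* b′) :+ v :* v′) refl
               (ω j) (sameRow (p i) (p j)) (sameRow (q i) (p j)) (Y j i) (J i j + J j i) (v i) (v j)
               (before (p i) (q j)) (before (p j) (q i)) ⟩
        (Y i j + Y j i) + (J i j + J j i) + (G i j + G j i) + v i * v j ∎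
        where
        v*Y : v j * (ω i * sameRow (p j) (p i) + ω i * sameRow (q j) (p i)) ≡ Y j i
        v*Y = begin
          v j * (ω i * sameRow (p j) (p i) + ω i * sameRow (q j) (p i))
            ≡⟨ solve 4 (λ v ω s s′ → v :* (ω :* s :+ ω :* s′) := ω :* (s :+ s′) :+ ω :* ((con 1ℙ :+ v) :* (s :+ s′)))
                 refl (v j) (ω i) (sameRow (p j) (p i)) (sameRow (q j) (p i)) ⟩
          Y j i + ω i * (h j * (sameRow (p j) (p i) + sameRow (q j) (p i)))
            ≡⟨ cong (λ x → Y j i + ω i * x) (horizontal-row (step j) (row (p i))) ⟩
          Y j i + ω i * 0ℙ
            ≡⟨ solve 2 (λ y ω → y :+ ω :* con 0ℙ := y) refl (Y j i) (ω i) ⟩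
          Y j i ∎

      -- For fixed `j`, the sum over `i` counts the cells in the row of `p j`, which are evenly
      -- many.
      ∑∑Y : ∑ (λ i → ∑ (Y i)) ≡ 0ℙ
      ∑∑Y = trans (∑-comm Y) (∑-0 λ j → trans (sym (*-distribˡ-sum {m} (ω j) _))
        (trans (cong (ω j *_) (trans (∑-distrib-+ (λ i → sameRow (p i) (p j)) _) (row-even (row (p j)))))
          (ℙ.*-zeroʳ (ω j))))

      Yᵢᵢ : ∀ i → Y i i ≡ 0ℙ
      Yᵢᵢ i = begin
        Y i i
          ≡⟨ solve 3 (λ w v x → w :* x := (v :* w) :* x :+ w :* ((con 1ℙ :+ v) :* x)) refl (ω i) (v i) rows ⟩
        v i * ω i * rows + ω i * (h i * rows)
          ≡⟨ cong₂ (λ x y → x * rows + ω i * y) (wrap-horizontal (step i)) (horizontal-row (step i) (row (p i))) ⟩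
        ω i * 0ℙ
          ≡⟨ ℙ.*-zeroʳ (ω i) ⟩
        0ℙ ∎
        where rows = sameRow (p i) (p i) + sameRow (q i) (p i)

      ∑∑J : ∑ (λ i → ∑ (J i)) ≡ lifts * (verticals + lifts) + lifts * twists
      ∑∑J = begin
        ∑ (λ i → ∑ (J i))
          ≡⟨ ∑∑-cong (λ i j → trans
               (solve 4 (λ v z z′ a → v :* (z :* (con 1ℙ :+ z′)) :+ z :* z′ :* a :=
                 z :* v :+ z :* (v :* z′) :+ (z :* a) :* z′) refl (v j) (z i) (z j) (a i))
               (cong₂ (λ x y → z i * v j + z i * x + y * z j) (lift-vertical (step j)) (lift-twist (step i)))) ⟩
        ∑ (λ i → ∑ λ j → z i * v j + z i * z j + a i * z j)
          ≡⟨ trans (∑∑-distrib-+ (λ i j → z i * v j + z i * z j) (λ i j → a i * z j))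
               (cong₂ _+_ (trans (∑∑-distrib-+ (λ i j → z i * v j) (λ i j → z i * z j))
                 (cong₂ _+_ (∑∑-* z v) (∑∑-* z z))) (∑∑-* a z)) ⟩
        lifts * verticals + lifts * lifts + twists * lifts
          ≡⟨ solve 3 (λ n v a → n :* v :+ n :* n :+ a :* n := n :* (v :+ n) :+ n :* a) refl lifts verticals twists ⟩
        lifts * (verticals + lifts) + lifts * twists ∎

      ∑Jᵢᵢ : ∑ (λ i → J i i) ≡ twists
      ∑Jᵢᵢ = ∑-cong Jᵢᵢ
        where
        Jᵢᵢ : ∀ i → J i i ≡ a i
        Jᵢᵢ i = begin
          v i * (z i * (1ℙ + z i)) + z i * z i * a i
            ≡⟨ solve 3 (λ v z a → v :* (z :* (con 1ℙ :+ z)) :+ z :* z :* a := v :* (z :+ z :* z) :+ z :* z :* a)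
                 refl (v i) (z i) (a i) ⟩
          v i * (z i + z i * z i) + z i * z i * a i
            ≡⟨ cong (λ x → v i * (z i + x) + x * a i) (ℙ.*-idem (z i)) ⟩
          v i * (z i + z i) + z i * a i
            ≡⟨ cong₂ (λ x y → v i * x + y) (ℙ.p+p≡0ℙ (z i)) (lift-twist (step i)) ⟩
          v i * 0ℙ + a i
            ≡⟨ cong (_+ a i) (ℙ.*-zeroʳ (v i)) ⟩
          a i ∎

      Gᵢᵢ : ∀ i → G i i ≡ v i * before (p i) (q i)
      Gᵢᵢ i = cong (_* before (p i) (q i)) (ℙ.*-idem (v i))

      -- Among the cells before q j, those of a horizontal domino come in pairs
      -- unless it wraps around the row of q j.
      ∑∑G : ∑ (λ i → ∑ (G i)) + ∑ (λ i → ∑ λ j → before (q i) (q j) * (v i * v j)) ≡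
            ∑ (λ j → v j * parity (col (q j))) + wraps * lifts
      ∑∑G = begin
        ∑ (λ i → ∑ (G i)) + ∑ (λ i → ∑ λ j → before (q i) (q j) * (v i * v j))
          ≡⟨ trans (sym (∑∑-distrib-+ G _)) (∑-comm (λ i j → G i j + before (q i) (q j) * (v i * v j))) ⟩
        ∑ (λ j → ∑ λ i → G i j + before (q i) (q j) * (v i * v j))
          ≡⟨ ∑∑-cong pointwise ⟩
        ∑ (λ j → ∑ λ i → v j * (before (p i) (q j) + before (q i) (q j)) + ω i * (v j * sameRow (q j) (p i)))
          ≡⟨ ∑∑-distrib-+ (λ j i → v j * (before (p i) (q j) + before (q i) (q j))) _ ⟩
        ∑ (λ j → ∑ λ i → v j * (before (p i) (q j) + before (q i) (q j))) +
        ∑ (λ j → ∑ λ i → ω i * (v j * sameRow (q j) (p i)))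
          ≡⟨ cong₂ _+_
               (∑-cong λ j → trans (sym (*-distribˡ-sum {m} (v j) _)) (cong (v j *_)
                 (trans (∑-distrib-+ (λ i → before (p i) (q j)) _) (before-count (q-inside j)))))
               -- For each wrapping `i`, the vertical dominoes entering the row of `p i` number
               -- `lifts` modulo 2.
               (trans (∑-comm (λ j i → ω i * (v j * sameRow (q j) (p i)))) (trans
                 (∑-cong λ i → trans (sym (*-distribˡ-sum {m} (ω i) _))
                   (cong (ω i *_) (vertical-row-count (proj₂ (p-inside i)))))
                 (sym (*-distribʳ-sum lifts ω)))) ⟩
        ∑ (λ j → v j * parity (col (q j))) + wraps * lifts ∎
        where
        pointwise : ∀ j i → G i j + before (q i) (q j) * (v i * v j) ≡
          v j * (before (p i) (q j) + before (q i) (q j)) + ω i * (v j * sameRow (q j) (p i))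
        pointwise j i with i Fin.≟ j
        ... | yes refl = begin
          v i * v i * before (p i) (q i) + before (q i) (q i) * (v i * v i)
            ≡⟨ cong (λ x → x * before (p i) (q i) + before (q i) (q i) * x) (ℙ.*-idem (v i)) ⟩
          v i * before (p i) (q i) + before (q i) (q i) * v i
            ≡⟨ solve 3 (λ v b b′ → v :* b :+ b′ :* v := v :* (b :+ b′) :+ con 0ℙ) refl
                 (v i) (before (p i) (q i)) (before (q i) (q i)) ⟩
          v i * (before (p i) (q i) + before (q i) (q i)) + 0ℙ
            ≡⟨ cong (λ x → v i * (before (p i) (q i) + before (q i) (q i)) + x * sameRow (q i) (p i)) (wrap-horizontal (step i)) ⟨
          v i * (before (p i) (q i) + before (q i) (q i)) + v i * ω i * sameRow (q i) (p i)
            ≡⟨ cong (λ z → v i * (before (p i) (q i) + before (q i) (q i)) + z)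
                 (solve 3 (λ v w s → v :* w :* s := w :* (v :* s)) refl (v i) (ω i) (sameRow (q i) (p i))) ⟩
          v i * (before (p i) (q i) + before (q i) (q i)) + ω i * (v i * sameRow (q i) (p i)) ∎
        ... | no i≢j = begin
          v i * v j * before (p i) (q j) + before (q i) (q j) * (v i * v j)
            ≡⟨ solve 4 (λ v v′ b b′ → v :* v′ :* b :+ b′ :* (v :* v′) :=
                 v′ :* (b :+ b′) :+ v′ :* ((con 1ℙ :+ v) :* (b :+ b′))) refl
                 (v i) (v j) (before (p i) (q j)) (before (q i) (q j)) ⟩
          v j * (before (p i) (q j) + before (q i) (q j)) + v j * (h i * (before (p i) (q j) + before (q i) (q j)))
            ≡⟨ cong (λ x → v j * (before (p i) (q j) + before (q i) (q j)) + v j * x)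
                 (before-horizontal (step i) (q-inside j) (λ e → p≢q i j (sym e)) (λ e → q≢q i≢j (sym e))) ⟩
          v j * (before (p i) (q j) + before (q i) (q j)) + v j * (ω i * sameRow (q j) (p i))
            ≡⟨ cong (λ z → v j * (before (p i) (q j) + before (q i) (q j)) + z)
                 (solve 3 (λ v w s → v :* (w :* s) := w :* (v :* s)) refl (v j) (ω i) (sameRow (q j) (p i))) ⟩
          v j * (before (p i) (q j) + before (q i) (q j)) + ω i * (v j * sameRow (q j) (p i)) ∎

    -- `T` is arbitrary because `crossing` is symmetric off the diagonal. Apart from boundary
    -- counts, only the columns and the order of the ends of single vertical dominoes survive.
    crossing-count : ∀ {T} → IsTournament T →
      ∑ (λ i → ∑ λ j → T i j * crossing i j) ≡
      ∑ (λ i → v i * parity (col (q i))) + ∑ (λ i → v i * before (p i) (q i)) +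
      (wraps * lifts + lifts * (verticals + lifts) + lifts * twists + twists)
    crossing-count {T} t = begin
      ∑ (λ i → ∑ λ j → T i j * crossing i j)
        ≡⟨ ∑∑-cong pointwise ⟩
      ∑ (λ i → ∑ λ j → T i j * (Y i j + Y j i) + T i j * (J i j + J j i) + T i j * (G i j + G j i) + T i j * (v i * v j))
        ≡⟨ trans (∑∑-distrib-+ (λ i j → T i j * (Y i j + Y j i) + T i j * (J i j + J j i) + T i j * (G i j + G j i)) _)
             (cong (_+ ∑ (λ i → ∑ λ j → T i j * (v i * v j)))
           (trans (∑∑-distrib-+ (λ i j → T i j * (Y i j + Y j i) + T i j * (J i j + J j i)) _)
             (cong (_+ ∑ (λ i → ∑ λ j → T i j * (G i j + G j i)))
           (∑∑-distrib-+ (λ i j → T i j * (Y i j + Y j i)) _)))) ⟩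
      ∑ (λ i → ∑ λ j → T i j * (Y i j + Y j i)) + ∑ (λ i → ∑ λ j → T i j * (J i j + J j i)) +
      ∑ (λ i → ∑ λ j → T i j * (G i j + G j i)) + ∑ (λ i → ∑ λ j → T i j * (v i * v j))
        ≡⟨ cong₂ _+_ (cong₂ _+_ (cong₂ _+_
             (trans (tournament-symmetrized t Y) (cong₂ _+_ ∑∑Y (∑-0 Yᵢᵢ)))
             (trans (tournament-symmetrized t J) (cong₂ _+_ ∑∑J ∑Jᵢᵢ)))
             (trans (tournament-symmetrized t G) (cong (λ z → ∑ (λ i → ∑ (G i)) + z) (∑-cong Gᵢᵢ))))
             (tournament-independent t precedence-isTournament (λ {i} {j} _ → ℙ.*-comm (v i) (v j))) ⟩
      0ℙ + (lifts * (verticals + lifts) + lifts * twists + twists) +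
      (∑ (λ i → ∑ (G i)) + ∑ (λ i → v i * before (p i) (q i))) +
      ∑ (λ i → ∑ λ j → before (q i) (q j) * (v i * v j))
        ≡⟨ solve 4 (λ x g d c → con 0ℙ :+ x :+ (g :+ d) :+ c := g :+ c :+ d :+ x) refl
             (lifts * (verticals + lifts) + lifts * twists + twists) (∑ (λ i → ∑ (G i)))
             (∑ (λ i → v i * before (p i) (q i))) (∑ (λ i → ∑ λ j → before (q i) (q j) * (v i * v j))) ⟩
      ∑ (λ i → ∑ (G i)) + ∑ (λ i → ∑ λ j → before (q i) (q j) * (v i * v j)) + ∑ (λ i → v i * before (p i) (q i)) +
      (lifts * (verticals + lifts) + lifts * twists + twists)
        ≡⟨ cong (λ x → x + ∑ (λ i → v i * before (p i) (q i)) + (lifts * (verticals + lifts) + lifts * twists + twists)) ∑∑G ⟩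
      ∑ (λ i → v i * parity (col (q i))) + wraps * lifts + ∑ (λ i → v i * before (p i) (q i)) +
      (lifts * (verticals + lifts) + lifts * twists + twists)
        ≡⟨ solve 6 (λ c w d l x y → c :+ w :+ d :+ (l :+ x :+ y) := c :+ d :+ (w :+ l :+ x :+ y)) refl
             (∑ (λ i → v i * parity (col (q i)))) (wraps * lifts) (∑ (λ i → v i * before (p i) (q i)))
             (lifts * (verticals + lifts)) (lifts * twists) twists ⟩
      ∑ (λ i → v i * parity (col (q i))) + ∑ (λ i → v i * before (p i) (q i)) +
      (wraps * lifts + lifts * (verticals + lifts) + lifts * twists + twists) ∎
      where
      pointwise : ∀ i j → T i j * crossing i j ≡
        T i j * (Y i j + Y j i) + T i j * (J i j + J j i) + T i j * (G i j + G j i) + T i j * (v i * v j)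
      pointwise i j with i Fin.≟ j
      ... | yes refl rewrite irreflexive t i = refl
      ... | no i≢j = trans (cong (T i j *_) (crossing-decomposition i≢j))
        (solve 5 (λ t y j g v → t :* (y :+ j :+ g :+ v) := t :* y :+ t :* j :+ t :* g :+ t :* v) refl
          (T i j) (Y i j + Y j i) (J i j + J j i) (G i j + G j i) (v i * v j))

-- Signs of matchings

toSign-∑ : ∀ {n} (f : Fin n → Parity) → toSign (∑ f) ≡ ∏ (λ i → toSign (f i))
toSign-∑ {zero}  f = refl
toSign-∑ {suc n} f = trans (ℙ.+-homo-* (f zero) _) (cong (toSign (f zero) Sign.*_) (toSign-∑ λ i → f (suc i)))

toSign-⟦⟧ : ∀ {A : Set} (A? : Dec A) → toSign ⟦ A? ⟧ ≡ (if does A? then Sign.- else Sign.+)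
toSign-⟦⟧ (yes _) = refl
toSign-⟦⟧ (no _)  = refl

module _ {n : ℕ} where

  order : Fin n → Fin n → Parity
  order i j = ⟦ i Fin.<? j ⟧

  order-isTournament : IsTournament order
  order-isTournament .irreflexive i = ⟦⟧-no (i Fin.<? i) (ℕ.<-irrefl refl)
  order-isTournament .total i≢j = <-total-⟦⟧ λ e → i≢j (Fin.toℕ-injective e)

  inversions : Permutation′ n → Parity
  inversions σ = ∑ λ i → ∑ λ j → ⟦ i Fin.<? j ×-dec (σ ⟨$⟩ʳ j) Fin.<? (σ ⟨$⟩ʳ i) ⟧

  permSign-inversions : ∀ σ → permSign σ ≡ toSign (inversions σ)
  permSign-inversions σ = sym (trans (toSign-∑ {n} _) (∏-cong λ i →
    trans (toSign-∑ {n} _) (∏-cong λ j → toSign-⟦⟧ (i Fin.<? j ×-dec (σ ⟨$⟩ʳ j) Fin.<? (σ ⟨$⟩ʳ i)))))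

  -- The number of pairs `i < j` that the tournament `T` puts in the opposite order.
  disagreements : (Fin n → Fin n → Parity) → Parity
  disagreements T = ∑ λ i → ∑ λ j → order i j * (order i j + T i j)

  -- Measuring the arguments by `S` and the values by `T` instead of by their indices changes the
  -- count by terms free of `σ`: the discrepancy `Δ` between `order` and `T` is symmetric, so its
  -- sum over all pairs is the same after permuting them.
  inversions-tournament : ∀ {S T} → IsTournament T → (σ : Permutation′ n) →
    inversions σ ≡ disagreements S + disagreements T +
                   ∑ (λ i → ∑ λ j → order i j * (S i j + T (σ ⟨$⟩ʳ i) (σ ⟨$⟩ʳ j)))
  inversions-tournament {S} {T} t σ = begin
    inversions σ
      ≡⟨ ∑∑-cong pointwise ⟩
    ∑ (λ i → ∑ λ j → order i j * (order i j + S i j) + order i j * Δ (σ ⟨$⟩ʳ i) (σ ⟨$⟩ʳ j) +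
                     order i j * (S i j + T (σ ⟨$⟩ʳ i) (σ ⟨$⟩ʳ j)))
      ≡⟨ trans (∑∑-distrib-+ (λ i j → order i j * (order i j + S i j) + order i j * Δ (σ ⟨$⟩ʳ i) (σ ⟨$⟩ʳ j)) _)
           (cong (_+ ∑ (λ i → ∑ λ j → order i j * (S i j + T (σ ⟨$⟩ʳ i) (σ ⟨$⟩ʳ j))))
             (trans (∑∑-distrib-+ (λ i j → order i j * (order i j + S i j)) _)
               (cong (λ z → disagreements S + z) reindex))) ⟩
    disagreements S + disagreements T + ∑ (λ i → ∑ λ j → order i j * (S i j + T (σ ⟨$⟩ʳ i) (σ ⟨$⟩ʳ j))) ∎
    where
    Δ : Fin n → Fin n → Parity
    Δ i j = order i j + T i j
    σ-injective : ∀ {i j} → i ≢ j → σ ⟨$⟩ʳ i ≢ σ ⟨$⟩ʳ j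
    σ-injective i≢j e = i≢j (trans (sym (Perm.inverseˡ σ)) (trans (cong (σ Perm.⟨$⟩ˡ_) e) (Perm.inverseˡ σ)))
    order∘σ-isTournament : IsTournament λ i j → order (σ ⟨$⟩ʳ i) (σ ⟨$⟩ʳ j)
    order∘σ-isTournament .irreflexive i = irreflexive order-isTournament (σ ⟨$⟩ʳ i)
    order∘σ-isTournament .total i≢j = total order-isTournament (σ-injective i≢j)
    Δ-sym : ∀ {i j} → i ≢ j → Δ i j ≡ Δ j i
    Δ-sym {i} {j} i≢j = trans (+-move (Δ i j) (Δ j i) (begin
      order i j + T i j + (order j i + T j i)
        ≡⟨ solve 4 (λ a b c d → a :+ b :+ (c :+ d) := a :+ c :+ (b :+ d)) refl (order i j) (T i j) (order j i) (T j i) ⟩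
      order i j + order j i + (T i j + T j i)
        ≡⟨ cong₂ _+_ (total order-isTournament i≢j) (total t i≢j) ⟩
      0ℙ ∎)) (ℙ.+-identityʳ (Δ j i))
    reindex : ∑ (λ i → ∑ λ j → order i j * Δ (σ ⟨$⟩ʳ i) (σ ⟨$⟩ʳ j)) ≡ disagreements T
    reindex = trans
      (tournament-independent order-isTournament order∘σ-isTournament λ i≢j → Δ-sym (σ-injective i≢j))
      (sym (∑∑-permute (λ i j → order i j * Δ i j) σ))
    inverted : ∀ i j → ⟦ i Fin.<? j ×-dec (σ ⟨$⟩ʳ j) Fin.<? (σ ⟨$⟩ʳ i) ⟧ ≡ order i j * order (σ ⟨$⟩ʳ j) (σ ⟨$⟩ʳ i)
    inverted i j with does (i Fin.<? j)
    ... | true  = refl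
    ... | false = refl
    pointwise : ∀ i j → ⟦ i Fin.<? j ×-dec (σ ⟨$⟩ʳ j) Fin.<? (σ ⟨$⟩ʳ i) ⟧ ≡
      order i j * (order i j + S i j) + order i j * Δ (σ ⟨$⟩ʳ i) (σ ⟨$⟩ʳ j) +
      order i j * (S i j + T (σ ⟨$⟩ʳ i) (σ ⟨$⟩ʳ j))
    pointwise i j with i Fin.≟ j
    ... | yes refl = trans (inverted i i) (begin
      order i i * order (σ ⟨$⟩ʳ i) (σ ⟨$⟩ʳ i)
        ≡⟨ cong (_* order (σ ⟨$⟩ʳ i) (σ ⟨$⟩ʳ i)) (irreflexive order-isTournament i) ⟩
      0ℙ
        ≡⟨ cong (λ x → x * (x + S i i) + x * Δ (σ ⟨$⟩ʳ i) (σ ⟨$⟩ʳ i) + x * (S i i + T (σ ⟨$⟩ʳ i) (σ ⟨$⟩ʳ i)))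
             (irreflexive order-isTournament i) ⟨
      order i i * (order i i + S i i) + order i i * Δ (σ ⟨$⟩ʳ i) (σ ⟨$⟩ʳ i) +
      order i i * (S i i + T (σ ⟨$⟩ʳ i) (σ ⟨$⟩ʳ i)) ∎)
    ... | no i≢j = trans (inverted i j) (begin
      o * order (σ ⟨$⟩ʳ j) (σ ⟨$⟩ʳ i)
        ≡⟨ cong (o *_) (+-move _ _ (total order-isTournament (σ-injective λ j≡i → i≢j (sym j≡i)))) ⟩
      o * (o′ + 1ℙ)
        ≡⟨ solve 2 (λ o o′ → o :* (o′ :+ con 1ℙ) := o :* o′ :+ o) refl o o′ ⟩
      o * o′ + o
        ≡⟨ cong (λ z → o * o′ + z) (ℙ.*-idem o) ⟨
      o * o′ + o * o
        ≡⟨ solve 4 (λ o o′ s t → o :* o′ :+ o :* o := o :* (o :+ s) :+ o :* (o′ :+ t) :+ o :* (s :+ t)) refl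
             o o′ (S i j) (T (σ ⟨$⟩ʳ i) (σ ⟨$⟩ʳ j)) ⟩
      o * (o + S i j) + o * Δ (σ ⟨$⟩ʳ i) (σ ⟨$⟩ʳ j) + o * (S i j + T (σ ⟨$⟩ʳ i) (σ ⟨$⟩ʳ j)) ∎)
      where
      o  = order i j
      o′ = order (σ ⟨$⟩ʳ i) (σ ⟨$⟩ʳ j)

-- Coloured cells and the permutation they are matched by

δ : Cell → Cell → Parity
δ (c , r) (c′ , r′) = ⟦ r ℕ.≟ r′ ⟧ * ⟦ c ℕ.≟ c′ ⟧

δ-refl : ∀ s → δ s s ≡ 1ℙ
δ-refl (c , r) = cong₂ _*_ (⟦⟧-yes (r ℕ.≟ r) refl) (⟦⟧-yes (c ℕ.≟ c) refl)

δ-≢ : ∀ {s s′} → s ≢ s′ → δ s s′ ≡ 0ℙ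
δ-≢ {c , r} {c′ , r′} s≢s′ with r ℕ.≟ r′
... | yes refl = trans (cong (⟦ r ℕ.≟ r ⟧ *_) (⟦⟧-no (c ℕ.≟ c′) λ c≡c′ → s≢s′ (cong (_, r) c≡c′))) (ℙ.*-zeroʳ _)
... | no r≢r′  = cong (_* ⟦ c ℕ.≟ c′ ⟧) (⟦⟧-no (r ℕ.≟ r′) r≢r′)

record Board (x₀ y₁ m : ℕ) : Set where
  field
    b w      : Fin m → Cell
    b-inside : ∀ i → Inside x₀ y₁ (b i)
    w-inside : ∀ i → Inside x₀ y₁ (w i)
    b-inj    : Injective _≡_ _≡_ b
    w-inj    : Injective _≡_ _≡_ w
    exhaustive : ∀ {s} → Inside x₀ y₁ s → (∃ λ i → b i ≡ s) ⊎ (∃ λ i → w i ≡ s)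
    b-colour : ∀ i → parity (col (b i)) + parity (row (b i)) ≡ 0ℙ
    w-colour : ∀ i → parity (col (w i)) + parity (row (w i)) ≡ 1ℙ

  b≢w : ∀ i j → b i ≢ w j
  b≢w i j e with () ← trans (sym (b-colour i)) (trans (cong (λ s → parity (col s) + parity (row s)) e) (w-colour j))

  -- Both sums are spread over the rectangle, where every cell occurs once among the black and white
  -- ones together.
  ∑-cells : (F : Cell → Parity) → ∑ (λ i → F (b i)) + ∑ (λ i → F (w i)) ≡ ∑< y₁ λ r → ∑< x₀ λ c → F (c , r)
  ∑-cells F = begin
    ∑ (λ i → F (b i)) + ∑ (λ i → F (w i))
      ≡⟨ cong₂ _+_ (spread b b-inside) (spread w w-inside) ⟩
    ∑< y₁ (λ r → ∑< x₀ λ c → count b (c , r) * F (c , r)) + ∑< y₁ (λ r → ∑< x₀ λ c → count w (c , r) * F (c , r))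
      ≡⟨ trans (sym (∑<-distrib-+ y₁ _ _)) (∑<-cong y₁ λ _ → sym (∑<-distrib-+ x₀ _ _)) ⟩
    ∑< y₁ (λ r → ∑< x₀ λ c → count b (c , r) * F (c , r) + count w (c , r) * F (c , r))
      ≡⟨ ∑<-cong y₁ (λ {r} r<y₁ → ∑<-cong x₀ λ {c} c<x₀ → trans
           (sym (ℙ.*-distribʳ-+ (F (c , r)) (count b (c , r)) (count w (c , r))))
           (cong (_* F (c , r)) (once (c<x₀ , r<y₁)))) ⟩
    ∑< y₁ (λ r → ∑< x₀ λ c → F (c , r)) ∎
    where
    count : (Fin m → Cell) → Cell → Parity
    count f s = ∑ λ i → δ s (f i)
    spread : (f : Fin m → Cell) → (∀ i → Inside x₀ y₁ (f i)) →
             ∑ (λ i → F (f i)) ≡ ∑< y₁ λ r → ∑< x₀ λ c → count f (c , r) * F (c , r)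
    spread f inside = begin
      ∑ (λ i → F (f i))
        ≡⟨ ∑-cong (λ i → begin
             F (f i)
               ≡⟨ ∑<-δ (proj₂ (inside i)) (λ r → F (col (f i) , r)) ⟨
             ∑< y₁ (λ r → ⟦ r ℕ.≟ row (f i) ⟧ * F (col (f i) , r))
               ≡⟨ ∑<-cong y₁ (λ {r} _ → cong (⟦ r ℕ.≟ row (f i) ⟧ *_) (sym (∑<-δ (proj₁ (inside i)) (λ c → F (c , r))))) ⟩
             ∑< y₁ (λ r → ⟦ r ℕ.≟ row (f i) ⟧ * ∑< x₀ (λ c → ⟦ c ℕ.≟ col (f i) ⟧ * F (c , r)))
               ≡⟨ ∑<-cong y₁ (λ {r} _ → trans (*-distribˡ-∑< x₀ ⟦ r ℕ.≟ row (f i) ⟧ _)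
                    (∑<-cong x₀ λ {c} _ → sym (ℙ.*-assoc ⟦ r ℕ.≟ row (f i) ⟧ ⟦ c ℕ.≟ col (f i) ⟧ (F (c , r))))) ⟩
             ∑< y₁ (λ r → ∑< x₀ λ c → δ (c , r) (f i) * F (c , r)) ∎) ⟩
      ∑ (λ i → ∑< y₁ λ r → ∑< x₀ λ c → δ (c , r) (f i) * F (c , r))
        ≡⟨ trans (∑-∑<-comm {m} y₁ _) (∑<-cong y₁ λ _ → ∑-∑<-comm {m} x₀ _) ⟩
      ∑< y₁ (λ r → ∑< x₀ λ c → ∑ λ i → δ (c , r) (f i) * F (c , r))
        ≡⟨ ∑<-cong y₁ (λ {r} _ → ∑<-cong x₀ λ {c} _ → sym (*-distribʳ-sum {m} (F (c , r)) _)) ⟩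
      ∑< y₁ (λ r → ∑< x₀ λ c → count f (c , r) * F (c , r)) ∎
    hit : (f : Fin m → Cell) → Injective _≡_ _≡_ f → ∀ i → count f (f i) ≡ 1ℙ
    hit f inj i = trans (∑-cong λ j → δ≡⟦⟧ j) (∑-δ i (λ _ → 1ℙ))
      where
      δ≡⟦⟧ : ∀ j → δ (f i) (f j) ≡ ⟦ j Fin.≟ i ⟧ * 1ℙ
      δ≡⟦⟧ j with j Fin.≟ i
      ... | yes refl = δ-refl (f i)
      ... | no j≢i   = δ-≢ λ e → j≢i (inj (sym e))
    once : ∀ {s} → Inside x₀ y₁ s → count b s + count w s ≡ 1ℙ
    once s∈ with exhaustive s∈
    ... | inj₁ (i , refl) = cong₂ _+_ (hit b b-inj i) (∑-0 {m} λ j → δ-≢ (b≢w i j))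
    ... | inj₂ (i , refl) = cong₂ _+_ (∑-0 {m} λ j → δ-≢ λ e → b≢w j i (sym e)) (hit w w-inj i)

  -- All that signs retain of the enumerations: their disagreements with the row order, the
  -- comparisons of white with black cells, the number of index pairs and the number of indices.
  signConstant : Parity
  signConstant =
    disagreements (λ i j → before (b i) (b j)) + disagreements (λ i j → before (w i) (w j)) +
    (∑ (λ i → ∑ λ j → before (w i) (b j)) + ∑ (λ (i : Fin m) → ∑ λ j → order i j * 1ℙ)) + ∑ (λ (_ : Fin m) → 1ℙ)

module _ {x₀ x₁ y₁ : ℕ} where

  -- A step runs rightwards or upwards, so the black cell of a domino may be its source or its
  -- target.
  Joined : Cell → Cell → Set
  Joined s s′ = Step x₀ x₁ y₁ s s′ ⊎ Step x₀ x₁ y₁ s′ s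

  source target : ∀ {s s′} → Joined s s′ → Cell
  source {s}      (inj₁ _) = s
  source {s′ = s} (inj₂ _) = s
  target {s′ = s} (inj₁ _) = s
  target {s}      (inj₂ _) = s

  joined-step : ∀ {s s′} (e : Joined s s′) → Step x₀ x₁ y₁ (source e) (target e)
  joined-step (inj₁ e) = e
  joined-step (inj₂ e) = e

  isForward : ∀ {s s′} → Joined s s′ → Parity
  isForward (inj₁ _) = 1ℙ
  isForward (inj₂ _) = 0ℙ

  joined-elim : (P : Cell → Cell → Set) → ∀ {s s′} (e : Joined s s′) → P s s′ → P s′ s → P (source e) (target e)
  joined-elim P (inj₁ _) x y = x
  joined-elim P (inj₂ _) x y = y

  module _ {m} (B : Board x₀ y₁ m) where
    open Board B

    module _ (σ : Permutation′ m) (e : ∀ i → Joined (b i) (w (σ ⟨$⟩ʳ i))) where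

      private
        w′ p q : Fin m → Cell
        w′ i = w (σ ⟨$⟩ʳ i)
        p i = source (e i)
        q i = target (e i)

        w′-inj : ∀ {i j} → i ≢ j → w′ i ≢ w′ j
        w′-inj i≢j eq = i≢j (trans (sym (Perm.inverseˡ σ)) (trans (cong (σ Perm.⟨$⟩ˡ_) (w-inj eq)) (Perm.inverseˡ σ)))

        -- Stated for all four ends at once, so that it survives exchanging the ends of either
        -- domino.
        Apart : Cell → Cell → Cell → Cell → Set
        Apart s s′ t t′ = (s ≢ t × s ≢ t′) × (s′ ≢ t × s′ ≢ t′)

        apart : ∀ {i j} → i ≢ j → Apart (p i) (q i) (p j) (q j)
        apart {i} {j} i≢j = joined-elim (λ s s′ → Apart s s′ (p j) (q j)) (e i) forward (proj₂ forward , proj₁ forward)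
          where
          forward : Apart (b i) (w′ i) (p j) (q j)
          forward = joined-elim (Apart (b i) (w′ i)) (e j)
            (((λ eq → i≢j (b-inj eq)) , b≢w i _) , ((λ eq → b≢w j _ (sym eq)) , w′-inj i≢j))
            ((b≢w i _ , λ eq → i≢j (b-inj eq)) , (w′-inj i≢j , λ eq → b≢w j _ (sym eq)))

      torusMatching : TorusMatching x₀ x₁ y₁ m
      torusMatching = record
        { p         = p
        ; q         = q
        ; step      = λ i → joined-step (e i)
        ; p-inside  = λ i → joined-elim (λ s _ → Inside x₀ y₁ s) (e i) (b-inside i) (w-inside _)
        ; q-inside  = λ i → joined-elim (λ _ s → Inside x₀ y₁ s) (e i) (w-inside _) (b-inside i)
        ; p≢p       = λ i≢j → proj₁ (proj₁ (apart i≢j))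
        ; q≢q       = λ i≢j → proj₂ (proj₂ (apart i≢j))
        ; p≢q       = p≢q
        ; partition = partition
        }
        where
        p≢q : ∀ i j → p i ≢ q j
        p≢q i j with i Fin.≟ j
        ... | yes refl = joined-elim _≢_ (e i) (b≢w i _) (λ eq → b≢w i _ (sym eq))
        ... | no i≢j   = proj₂ (proj₁ (apart i≢j))
        partition : (F : Cell → Parity) → ∑ (λ i → F (p i)) + ∑ (λ i → F (q i)) ≡ ∑< y₁ λ r → ∑< x₀ λ c → F (c , r)
        partition F = begin
          ∑ (λ i → F (p i)) + ∑ (λ i → F (q i))
            ≡⟨ ∑-distrib-+ (λ i → F (p i)) _ ⟨
          ∑ (λ i → F (p i) + F (q i))
            ≡⟨ ∑-cong (λ i → joined-elim (λ s s′ → F s + F s′ ≡ F (b i) + F (w′ i)) (e i) refl (ℙ.+-comm (F (w′ i)) _)) ⟩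
          ∑ (λ i → F (b i) + F (w′ i))
            ≡⟨ ∑-distrib-+ (λ i → F (b i)) _ ⟩
          ∑ (λ i → F (b i)) + ∑ (λ i → F (w′ i))
            ≡⟨ cong (λ z → ∑ (λ i → F (b i)) + z) (∑-permute (λ i → F (w i)) σ) ⟨
          ∑ (λ i → F (b i)) + ∑ (λ i → F (w i))
            ≡⟨ ∑-cells F ⟩
          ∑< y₁ (λ r → ∑< x₀ λ c → F (c , r)) ∎

    module _ (x₀-even : parity x₀ ≡ 0ℙ) (σ : Permutation′ m) (e : ∀ i → Joined (b i) (w (σ ⟨$⟩ʳ i))) where

      private
        M = torusMatching σ e
        open TorusMatching M

        w′ : Fin m → Cell
        w′ i = w (σ ⟨$⟩ʳ i)

        v h κ ω : Fin m → Parity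
        v i = isVertical (step i)
        h i = 1ℙ + v i
        κ i = isForward (e i)
        ω i = isWrap (step i)

        n H A V : Parity
        n = lifts M
        H = wraps M
        A = twists M
        V = verticals M

        -- The comparisons of like colours are `crossing` plus the mixed comparisons. The latter,
        -- symmetrized, run over all pairs of a white and a black cell, so `σ` enters only through
        -- the matched pairs on the diagonal.
        pairs : ∑ (λ i → ∑ λ j → order i j * (before (b i) (b j) + before (w′ i) (w′ j))) ≡
                ∑ (λ i → ∑ λ j → order i j * crossing M i j) +
                (∑ (λ i → ∑ λ j → before (w i) (b j)) + ∑ (λ i → before (w′ i) (b i)) +
                 ∑ (λ (i : Fin m) → ∑ λ j → order i j * 1ℙ))
        pairs = begin
          ∑ (λ i → ∑ λ j → order i j * (before (b i) (b j) + before (w′ i) (w′ j)))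
            ≡⟨ ∑∑-cong pointwise ⟩
          ∑ (λ i → ∑ λ j → order i j * crossing M i j + (order i j * (g i j + g j i) + order i j * 1ℙ))
            ≡⟨ trans (∑∑-distrib-+ (λ i j → order i j * crossing M i j) _)
                 (cong (λ z → ∑ (λ i → ∑ λ j → order i j * crossing M i j) + z)
                   (∑∑-distrib-+ (λ i j → order i j * (g i j + g j i)) _)) ⟩
          ∑ (λ i → ∑ λ j → order i j * crossing M i j) +
          (∑ (λ i → ∑ λ j → order i j * (g i j + g j i)) + ∑ (λ (i : Fin m) → ∑ λ j → order i j * 1ℙ))
            ≡⟨ cong (λ x → ∑ (λ i → ∑ λ j → order i j * crossing M i j) +
                 (x + ∑ (λ (i : Fin m) → ∑ λ j → order i j * 1ℙ)))
                 (trans (tournament-symmetrized order-isTournament g)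
                   (cong (_+ ∑ (λ i → g i i)) (sym (∑-permute (λ i → ∑ λ j → before (w i) (b j)) σ)))) ⟩
          ∑ (λ i → ∑ λ j → order i j * crossing M i j) +
          (∑ (λ i → ∑ λ j → before (w i) (b j)) + ∑ (λ i → before (w′ i) (b i)) +
           ∑ (λ (i : Fin m) → ∑ λ j → order i j * 1ℙ)) ∎
          where
          g : Fin m → Fin m → Parity
          g i j = before (w′ i) (b j)
          cross : Cell → Cell → Cell → Cell → Parity
          cross s s′ t t′ = before s t + before s′ t′ + (before s t′ + before s′ t)
          cross-swapˡ : ∀ s s′ t t′ → cross s′ s t t′ ≡ cross s s′ t t′
          cross-swapˡ s s′ t t′ = solve 4 (λ a b c d → c :+ d :+ (b :+ a) := a :+ b :+ (d :+ c)) refl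
            (before s t) (before s′ t′) (before s′ t) (before s t′)
          cross-swapʳ : ∀ s s′ t t′ → cross s s′ t′ t ≡ cross s s′ t t′
          cross-swapʳ s s′ t t′ = solve 4 (λ a b c d → c :+ d :+ (a :+ b) := a :+ b :+ (c :+ d)) refl
            (before s t) (before s′ t′) (before s t′) (before s′ t)
          crossing-colours : ∀ i j → crossing M i j ≡ cross (b i) (w′ i) (b j) (w′ j)
          crossing-colours i j = trans
            (joined-elim (λ s s′ → cross s s′ (p j) (q j) ≡ cross (b i) (w′ i) (p j) (q j)) (e i)
              refl (cross-swapˡ (b i) (w′ i) (p j) (q j)))
            (joined-elim (λ t t′ → cross (b i) (w′ i) t t′ ≡ cross (b i) (w′ i) (b j) (w′ j)) (e j)
              refl (cross-swapʳ (b i) (w′ i) (b j) (w′ j)))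
          pointwise : ∀ i j → order i j * (before (b i) (b j) + before (w′ i) (w′ j)) ≡
            order i j * crossing M i j + (order i j * (g i j + g j i) + order i j * 1ℙ)
          pointwise i j = begin
            order i j * (before (b i) (b j) + before (w′ i) (w′ j))
              ≡⟨ solve 5 (λ o s s′ t t′ → o :* (s :+ s′) :=
                   o :* (s :+ s′ :+ (t :+ t′)) :+ (o :* (t′ :+ (con 1ℙ :+ t)) :+ o :* con 1ℙ)) refl
                   (order i j) (before (b i) (b j)) (before (w′ i) (w′ j)) (before (b i) (w′ j)) (before (w′ i) (b j)) ⟩
            order i j * cross (b i) (w′ i) (b j) (w′ j) +
            (order i j * (g i j + (1ℙ + before (b i) (w′ j))) + order i j * 1ℙ)
              ≡⟨ cong₂ (λ x y → order i j * x + (order i j * (g i j + y) + order i j * 1ℙ))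
                   (crossing-colours i j) (before-flip (b≢w i (σ ⟨$⟩ʳ j))) ⟨
            order i j * crossing M i j + (order i j * (g i j + g j i) + order i j * 1ℙ) ∎

        before-colours : ∀ i → before (w′ i) (b i) ≡ κ i + before (p i) (q i)
        before-colours i with e i
        ... | inj₁ _ = before-flip (b≢w i (σ ⟨$⟩ʳ i))
        ... | inj₂ _ = refl

        -- Chessboard colouring: `q i` is white exactly when the black cell is the source.
        row-colour : ∀ i → parity (col (q i)) + κ i ≡ parity (row (q i))
        row-colour i with e i
        ... | inj₁ _ = begin
          parity (col (w′ i)) + 1ℙ
            ≡⟨ cong (λ z → parity (col (w′ i)) + z) (w-colour (σ ⟨$⟩ʳ i)) ⟨
          parity (col (w′ i)) + (parity (col (w′ i)) + parity (row (w′ i)))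
            ≡⟨ solve 2 (λ c r → c :+ (c :+ r) := r) refl (parity (col (w′ i))) (parity (row (w′ i))) ⟩
          parity (row (w′ i)) ∎
        ... | inj₂ _ = begin
          parity (col (b i)) + 0ℙ
            ≡⟨ cong (λ z → parity (col (b i)) + z) (b-colour i) ⟨
          parity (col (b i)) + (parity (col (b i)) + parity (row (b i)))
            ≡⟨ solve 2 (λ c r → c :+ (c :+ r) := r) refl (parity (col (b i))) (parity (row (b i))) ⟩
          parity (row (b i)) ∎

        -- The Kasteleyn sign `h i * κ i` cancels the colour term `κ i` of horizontal dominoes. On
        -- vertical ones `κ i` turns the column parity of `q i` into its row parity, whose sum
        -- depends on `n` alone.
        local : ∑ (λ i → v i * parity (col (q i))) + ∑ (λ i → v i * before (p i) (q i)) +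
                ∑ (λ i → before (w′ i) (b i)) + ∑ (λ i → h i * κ i) ≡
                n * ∑< y₁ parity + (∑ (λ (_ : Fin m) → 1ℙ) + V + H)
        local = begin
          ∑ (λ i → v i * c i) + ∑ (λ i → v i * o i) + ∑ (λ i → before (w′ i) (b i)) + ∑ (λ i → h i * κ i)
            ≡⟨ trans (cong (λ x → x + ∑ (λ i → before (w′ i) (b i)) + ∑ (λ i → h i * κ i)) (sym (∑-distrib-+ (λ i → v i * c i) _)))
                 (trans (cong (_+ ∑ (λ i → h i * κ i)) (sym (∑-distrib-+ (λ i → v i * c i + v i * o i) _)))
                   (sym (∑-distrib-+ (λ i → v i * c i + v i * o i + before (w′ i) (b i)) _))) ⟩
          ∑ (λ i → v i * c i + v i * o i + before (w′ i) (b i) + h i * κ i)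
            ≡⟨ ∑-cong (λ i → begin
                 v i * c i + v i * o i + before (w′ i) (b i) + h i * κ i
                   ≡⟨ cong (λ x → v i * c i + v i * o i + x + h i * κ i) (before-colours i) ⟩
                 v i * c i + v i * o i + (κ i + o i) + h i * κ i
                   ≡⟨ solve 4 (λ v c o k → v :* c :+ v :* o :+ (k :+ o) :+ (con 1ℙ :+ v) :* k :=
                        v :* (c :+ k) :+ (con 1ℙ :+ v) :* o) refl (v i) (c i) (o i) (κ i) ⟩
                 v i * (c i + κ i) + h i * o i
                   ≡⟨ cong₂ (λ x y → v i * x + y) (row-colour i) (horizontal-wrap (step i)) ⟩
                 v i * parity (row (q i)) + (1ℙ + v i + ω i) ∎) ⟩
          ∑ (λ i → v i * parity (row (q i)) + (1ℙ + v i + ω i))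
            ≡⟨ trans (∑-distrib-+ (λ i → v i * parity (row (q i))) _) (cong₂ _+_
                 (∑-vertical-row M x₀-even parity)
                 (trans (∑-distrib-+ (λ i → 1ℙ + v i) ω) (cong (_+ H) (∑-distrib-+ (λ _ → 1ℙ) v)))) ⟩
          n * ∑< y₁ parity + (∑ (λ (_ : Fin m) → 1ℙ) + V + H) ∎
          where
          c o : Fin m → Parity
          c i = parity (col (q i))
          o i = before (p i) (q i)

      -- `local` and `crossing-count` leave the terms `V` and `n * V`; they cancel because `V` is
      -- `n * parity y₁` and `n * n` is `n`.
      sign-formula : inversions σ + ∑ (λ i → h i * κ i) ≡
        signConstant + n * (∑< y₁ parity + 1ℙ) + (n + 1ℙ) * (H + A)
      sign-formula = begin
        inversions σ + ∑ (λ i → h i * κ i)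
          ≡⟨ cong (_+ ∑ (λ i → h i * κ i)) (trans
               (inversions-tournament {S = λ i j → before (b i) (b j)} {T = λ i j → before (w i) (w j)} w-isTournament σ)
               (cong (λ z → dB + dW + z) (trans pairs (cong (_+ (WB + ∑ (λ i → before (w′ i) (b i)) + O))
                 (crossing-count M x₀-even order-isTournament))))) ⟩
        dB + dW + (C + D + (H * n + n * (V + n) + n * A + A) + (WB + E + O)) + ∑ (λ i → h i * κ i)
          ≡⟨ solve 8 (λ d c d′ x wb e o k →
               d :+ (c :+ d′ :+ x :+ (wb :+ e :+ o)) :+ k := d :+ (wb :+ o) :+ x :+ (c :+ d′ :+ e :+ k)) refl
               (dB + dW) C D (H * n + n * (V + n) + n * A + A) WB E O (∑ (λ i → h i * κ i)) ⟩
        dB + dW + (WB + O) + (H * n + n * (V + n) + n * A + A) + (C + D + E + ∑ (λ i → h i * κ i))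
          ≡⟨ cong₂ (λ x y → dB + dW + (WB + O) + (H * n + n * (x + n) + n * A + A) + y)
               (verticals-count M x₀-even)
               (trans local (cong (λ x → n * R + (one + x + H)) (verticals-count M x₀-even))) ⟩
        dB + dW + (WB + O) + (H * n + n * (n * y + n) + n * A + A) + (n * R + (one + n * y + H))
          ≡⟨ solve 7 (λ d H n y A R one →
               d :+ (H :* n :+ n :* (n :* y :+ n) :+ n :* A :+ A) :+ (n :* R :+ (one :+ n :* y :+ H)) :=
               d :+ one :+ (n :* R :+ n :* n) :+ (n :+ con 1ℙ) :* (H :+ A) :+ (n :* n :+ n) :* y) refl
               (dB + dW + (WB + O)) H n y A R one ⟩
        signConstant + (n * R + n * n) + (n + 1ℙ) * (H + A) + (n * n + n) * y
          ≡⟨ cong (λ x → signConstant + (n * R + x) + (n + 1ℙ) * (H + A) + (x + n) * y) (ℙ.*-idem n) ⟩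
        signConstant + (n * R + n) + (n + 1ℙ) * (H + A) + (n + n) * y
          ≡⟨ solve 5 (λ s n R x y → s :+ (n :* R :+ n) :+ x :+ (n :+ n) :* y := s :+ n :* (R :+ con 1ℙ) :+ x) refl
               signConstant n R ((n + 1ℙ) * (H + A)) y ⟩
        signConstant + n * (R + 1ℙ) + (n + 1ℙ) * (H + A) ∎
        where
        dB  = disagreements (λ i j → before (b i) (b j))
        dW  = disagreements (λ i j → before (w i) (w j))
        WB  = ∑ (λ i → ∑ λ j → before (w i) (b j))
        O   = ∑ (λ (i : Fin m) → ∑ λ j → order i j * 1ℙ)
        one = ∑ (λ (_ : Fin m) → 1ℙ)
        C   = ∑ (λ i → v i * parity (col (q i)))
        D   = ∑ (λ i → v i * before (p i) (q i))
        E   = ∑ (λ i → before (w′ i) (b i))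
        R   = ∑< y₁ parity
        y   = parity y₁
        w-isTournament : IsTournament λ i j → before (w i) (w j)
        w-isTournament .irreflexive i = before-irrefl (w i)
        w-isTournament .total i≢j = before-total λ eq → i≢j (w-inj eq)

-- The fundamental rectangle

parityℤ : ℤ → Parity
parityℤ i = parity ∣ i ∣

parityℤ-⊖ : ∀ m n → parityℤ (m ⊖ n) ≡ parity m + parity n
parityℤ-⊖ zero    zero    = refl
parityℤ-⊖ zero    (suc n) = refl
parityℤ-⊖ (suc m) zero    = sym (ℙ.+-identityʳ _)
parityℤ-⊖ (suc m) (suc n) = begin
  parityℤ (suc m ⊖ suc n)         ≡⟨ cong parityℤ (ℤ.[1+m]⊖[1+n]≡m⊖n m n) ⟩
  parityℤ (m ⊖ n)                 ≡⟨ parityℤ-⊖ m n ⟩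
  parity m + parity n             ≡⟨ solve 2 (λ x y → x :+ y := x :+ con 1ℙ :+ (y :+ con 1ℙ)) refl (parity m) (parity n) ⟩
  parity m + 1ℙ + (parity n + 1ℙ) ≡⟨ cong₂ _+_ (parity-suc m) (parity-suc n) ⟨
  parity (suc m) + parity (suc n) ∎

parityℤ-+ : ∀ i j → parityℤ (i ℤ.+ j) ≡ parityℤ i + parityℤ j
parityℤ-+ (+ m)    (+ n)    = ℙ.+-homo-+ m n
parityℤ-+ (+ m)    -[1+ n ] = parityℤ-⊖ m (suc n)
parityℤ-+ -[1+ m ] (+ n)    = trans (parityℤ-⊖ n (suc m)) (ℙ.+-comm (parity n) _)
parityℤ-+ -[1+ m ] -[1+ n ] = trans (cong (λ k → parity (suc k)) (sym (ℕ.+-suc m n))) (ℙ.+-homo-+ (suc m) (suc n))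

parityℤ-* : ∀ i j → parityℤ (i ℤ.* j) ≡ parityℤ i * parityℤ j
parityℤ-* i j = trans (cong parity (ℤ.abs-* i j)) (ℙ.*-homo-* ∣ i ∣ ∣ j ∣)

parityℤ-even : ∀ {i} → + 2 ∣ i → parityℤ i ≡ 0ℙ
parityℤ-even (divides q refl) = trans (parityℤ-* q (+ 2)) (ℙ.*-zeroʳ (parityℤ q))

parityℤ-odd : ∀ {i} → ¬ + 2 ∣ i → parityℤ i ≡ 1ℙ
parityℤ-odd {i} ¬2∣i = +-move (parityℤ i) 1ℙ (trans (sym (parityℤ-+ i 1ℤ)) (parityℤ-even (odd⇒even {i} ¬2∣i)))

cell : Square → Cell
cell (i , j) = ∣ i ∣ , ∣ j ∣

square : Cell → Square
square (c , r) = + c , + r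

isVerticalAxis : Axis → Parity
isVerticalAxis horizontal = 0ℙ
isVerticalAxis vertical   = 1ℙ

module _ {L : ValidLattice} (X : KasteleynData L) where
  open KasteleynData X
  open Kasteleyn X

  inside⇒rectangle : ∀ {s} → Inside x₀ y₁ s → square s ∈ Rectangle x₀ y₁
  inside⇒rectangle (c<x₀ , r<y₁) = (+≤+ ℕ.z≤n , +<+ c<x₀) , (+≤+ ℕ.z≤n , +<+ r<y₁)

  square-cell : ∀ {s} → s ∈ Rectangle x₀ y₁ → square (cell s) ≡ s
  square-cell ((0≤i , _) , (0≤j , _)) = cong₂ _,_ (ℤ.0≤i⇒+∣i∣≡i 0≤i) (ℤ.0≤i⇒+∣i∣≡i 0≤j)

  cell-inside : ∀ {s} → s ∈ Rectangle x₀ y₁ → Inside x₀ y₁ (cell s)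
  cell-inside ((0≤i , i<x₀) , (0≤j , j<y₁)) =
    ℤ.drop‿+<+ (subst (ℤ._< + x₀) (sym (ℤ.0≤i⇒+∣i∣≡i 0≤i)) i<x₀) ,
    ℤ.drop‿+<+ (subst (ℤ._< + y₁) (sym (ℤ.0≤i⇒+∣i∣≡i 0≤j)) j<y₁)

  cell-injective : ∀ {s s′} → s ∈ Rectangle x₀ y₁ → s′ ∈ Rectangle x₀ y₁ → cell s ≡ cell s′ → s ≡ s′
  cell-injective s∈ s′∈ eq = trans (sym (square-cell s∈)) (trans (cong square eq) (square-cell s′∈))

  -- Lattice vectors have even coordinate sum, and that of (x₀ , 0) is `x₀`.
  x₀-even : parity x₀ ≡ 0ℙ
  x₀-even = trans (cong parity (sym (ℕ.+-identityʳ x₀))) (parityℤ-even (vectors-even L x₀-period))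

  board : Board x₀ y₁ size
  board = record
    { b        = λ i → cell (at blacks i)
    ; w        = λ i → cell (at whites i)
    ; b-inside = λ i → cell-inside (proj₁ (sound blacks i))
    ; w-inside = λ i → cell-inside (proj₁ (sound whites i))
    ; b-inj    = λ {i} {j} eq → injective blacks (cell-injective (proj₁ (sound blacks i)) (proj₁ (sound blacks j)) eq)
    ; w-inj    = λ {i} {j} eq → injective whites (cell-injective (proj₁ (sound whites i)) (proj₁ (sound whites j)) eq)
    ; exhaustive = exhaustive
    ; b-colour = λ i → trans (sym (parityℤ-+ (proj₁ (at blacks i)) (proj₂ (at blacks i)))) (parityℤ-even (proj₂ (sound blacks i)))
    ; w-colour = λ i → trans (sym (parityℤ-+ (proj₁ (at whites i)) (proj₂ (at whites i))))
                         (parityℤ-odd {proj₁ (at whites i) ℤ.+ proj₂ (at whites i)} (proj₂ (sound whites i)))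
    }
    where
    exhaustive : ∀ {s} → Inside x₀ y₁ s → (∃ λ i → cell (at blacks i) ≡ s) ⊎ (∃ λ i → cell (at whites i) ≡ s)
    exhaustive {s} s∈ with black? (square s)
    ... | yes black = let i , eq = complete blacks (inside⇒rectangle s∈ , black) in inj₁ (i , cong cell eq)
    ... | no white  = let i , eq = complete whites (inside⇒rectangle s∈ , white) in inj₂ (i , cong cell eq)

  StepAlong : Axis → Cell → Cell → Set
  StepAlong a s s′ = ∃ λ (e : Step x₀ x₁ y₁ s s′) → isVertical e ≡ isVerticalAxis a

  -- In each case a cell of the rectangle congruent to the neighbouring square is exhibited;
  -- uniqueness of representatives identifies it with `s′`.
  stepAlong : ∀ a {s s′} → Inside x₀ y₁ s → Inside x₀ y₁ s′ → square s ⊕ unit a ∼[ L ] square s′ → StepAlong a s s′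
  stepAlong a {s} {s′} s∈ s′∈ s∼s′ = go a s∈ s∼s′
    where
    land : ∀ u t → u ∼[ L ] square s′ → Inside x₀ y₁ t → square t ⊝ u ∈ vectors L → t ≡ s′
    land u t u∼s′ t∈ t∼u =
      cong cell (unique (inside⇒rectangle t∈) (inside⇒rectangle s′∈) (∼-trans L {square t} {u} {square s′} t∼u u∼s′))
    right-∈ : ∀ c r → square (suc c , r) ⊝ (square (c , r) ⊕ unit horizontal) ∈ vectors L
    right-∈ c r = subst (vectors L) (cong₂ _,_ (lemma (+ c)) (lemma′ (+ r))) (∼-refl L 0²)
      where
      lemma : ∀ i → 0ℤ ≡ 1ℤ ℤ.+ i ℤ.- (i ℤ.+ 1ℤ)
      lemma = solve-∀
      lemma′ : ∀ i → 0ℤ ≡ i ℤ.- (i ℤ.+ 0ℤ)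
      lemma′ = solve-∀
    right↺-∈ : ∀ c r → suc c ≡ x₀ → square (0 , r) ⊝ (square (c , r) ⊕ unit horizontal) ∈ vectors L
    right↺-∈ c r refl = subst (vectors L) (cong₂ _,_ (lemma (+ c)) (lemma′ (+ r)))
      (combine L -1ℤ 0ℤ x₀-period x₀-period)
      where
      lemma : ∀ i → -1ℤ ℤ.* (1ℤ ℤ.+ i) ℤ.+ 0ℤ ℤ.* (1ℤ ℤ.+ i) ≡ 0ℤ ℤ.- (i ℤ.+ 1ℤ)
      lemma = solve-∀
      lemma′ : ∀ i → -1ℤ ℤ.* 0ℤ ℤ.+ 0ℤ ℤ.* 0ℤ ≡ i ℤ.- (i ℤ.+ 0ℤ)
      lemma′ = solve-∀
    up-∈ : ∀ c r → square (c , suc r) ⊝ (square (c , r) ⊕ unit vertical) ∈ vectors L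
    up-∈ c r = subst (vectors L) (cong₂ _,_ (lemma′ (+ c)) (lemma (+ r))) (∼-refl L 0²)
      where
      lemma : ∀ i → 0ℤ ≡ 1ℤ ℤ.+ i ℤ.- (i ℤ.+ 1ℤ)
      lemma = solve-∀
      lemma′ : ∀ i → 0ℤ ≡ i ℤ.- (i ℤ.+ 0ℤ)
      lemma′ = solve-∀
    up↺<-∈ : ∀ c d r → d ℕ.+ x₁ ≡ c ℕ.+ x₀ → suc r ≡ y₁ →
             square (d , 0) ⊝ (square (c , r) ⊕ unit vertical) ∈ vectors L
    up↺<-∈ c d r eq refl = subst (vectors L) (cong₂ _,_
      (trans (lemma₁ (+ c) (+ x₀) (+ x₁)) (trans (cong (λ i → + i ℤ.- + x₁ ℤ.- (+ c ℤ.+ 0ℤ)) (sym eq)) (lemma₂ (+ d) (+ x₁) (+ c))))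
      (lemma₃ (+ r))) (combine L 1ℤ -1ℤ x₀-period x₁y₁-period)
      where
      lemma₁ : ∀ c x₀ x₁ → 1ℤ ℤ.* x₀ ℤ.+ -1ℤ ℤ.* x₁ ≡ c ℤ.+ x₀ ℤ.- x₁ ℤ.- (c ℤ.+ 0ℤ)
      lemma₁ = solve-∀
      lemma₂ : ∀ d x₁ c → d ℤ.+ x₁ ℤ.- x₁ ℤ.- (c ℤ.+ 0ℤ) ≡ d ℤ.- (c ℤ.+ 0ℤ)
      lemma₂ = solve-∀
      lemma₃ : ∀ r → 1ℤ ℤ.* 0ℤ ℤ.+ -1ℤ ℤ.* (1ℤ ℤ.+ r) ≡ 0ℤ ℤ.- (r ℤ.+ 1ℤ)
      lemma₃ = solve-∀
    up↺≥-∈ : ∀ c d r → d ℕ.+ x₁ ≡ c → suc r ≡ y₁ → square (d , 0) ⊝ (square (c , r) ⊕ unit vertical) ∈ vectors L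
    up↺≥-∈ c d r refl refl = subst (vectors L) (cong₂ _,_ (lemma₁ (+ d) (+ x₁)) (lemma₂ (+ r)))
      (combine L -1ℤ 0ℤ x₁y₁-period x₁y₁-period)
      where
      lemma₁ : ∀ d x₁ → -1ℤ ℤ.* x₁ ℤ.+ 0ℤ ℤ.* x₁ ≡ d ℤ.- (d ℤ.+ x₁ ℤ.+ 0ℤ)
      lemma₁ = solve-∀
      lemma₂ : ∀ r → -1ℤ ℤ.* (1ℤ ℤ.+ r) ℤ.+ 0ℤ ℤ.* (1ℤ ℤ.+ r) ≡ 0ℤ ℤ.- (r ℤ.+ 1ℤ)
      lemma₂ = solve-∀
    back : ∀ c → c ℕ.+ x₀ ℕ.∸ x₁ ℕ.+ x₁ ≡ c ℕ.+ x₀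
    back c = ℕ.m∸n+n≡m (ℕ.≤-trans (ℕ.<⇒≤ x₁-bound) (ℕ.m≤n+m x₀ c))
    go : ∀ a {s} → Inside x₀ y₁ s → square s ⊕ unit a ∼[ L ] square s′ → StepAlong a s s′
    go horizontal {c , r} (c<x₀ , r<y₁) s∼s′ with ℕ.m≤n⇒m<n∨m≡n c<x₀
    ... | inj₁ 1+c<x₀ with refl ← land (square (c , r) ⊕ unit horizontal) (suc c , r) s∼s′ (1+c<x₀ , r<y₁) (right-∈ c r) = right , refl
    ... | inj₂ 1+c≡x₀ with refl ← land (square (c , r) ⊕ unit horizontal) (0 , r) s∼s′ (ℕ.<-≤-trans ℕ.z<s c<x₀ , r<y₁) (right↺-∈ c r 1+c≡x₀) =
      right↺ 1+c≡x₀ , refl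
    go vertical {c , r} (c<x₀ , r<y₁) s∼s′ with ℕ.m≤n⇒m<n∨m≡n r<y₁
    ... | inj₁ 1+r<y₁ with refl ← land (square (c , r) ⊕ unit vertical) (c , suc r) s∼s′ (c<x₀ , 1+r<y₁) (up-∈ c r) = up , refl
    ... | inj₂ 1+r≡y₁ with ℕ.<-≤-connex c x₁
    -- Subtracting (x₁ , y₁) makes the column negative; adding (x₀ , 0) corrects it.
    ...   | inj₁ c<x₁ with refl ← land (square (c , r) ⊕ unit vertical) (c ℕ.+ x₀ ℕ.∸ x₁ , 0) s∼s′
              (ℕ.+-cancelʳ-< x₁ _ x₀ (subst₂ ℕ._<_ (sym (back c)) (ℕ.+-comm x₁ x₀) (ℕ.+-monoˡ-< x₀ c<x₁)) , ℕ.<-≤-trans ℕ.z<s r<y₁)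
              (up↺<-∈ c (c ℕ.+ x₀ ℕ.∸ x₁) r (back c) 1+r≡y₁) = up↺< c<x₁ (back c) 1+r≡y₁ , refl
    ...   | inj₂ x₁≤c with refl ← land (square (c , r) ⊕ unit vertical) (c ℕ.∸ x₁ , 0) s∼s′ (ℕ.≤-<-trans (ℕ.m∸n≤m c x₁) c<x₀ , ℕ.<-≤-trans ℕ.z<s r<y₁)
              (up↺≥-∈ c (c ℕ.∸ x₁) r (ℕ.m∸n+n≡m x₁≤c) 1+r≡y₁) = up↺≥ (ℕ.m∸n+n≡m x₁≤c) 1+r≡y₁ , refl

-- The dominoes of a tiling seen from their cells

private
  ⊝-⊕-cancel : ∀ s v → s ⊝ v ⊕ v ≡ s
  ⊝-⊕-cancel (i , j) (x , y) = cong₂ _,_ (lemma i x) (lemma j y)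
    where
    lemma : ∀ i x → i ℤ.- x ℤ.+ x ≡ i
    lemma = solve-∀

_≟ᵈ_ : (d d′ : Domino) → Dec (d ≡ d′)
domino (i , j) a ≟ᵈ domino (i′ , j′) a′ =
  map′ (λ where (refl , refl , refl) → refl) (λ where refl → refl , refl , refl)
    (i ℤ.≟ i′ ×-dec j ℤ.≟ j′ ×-dec a ≟ₐ a′)

⟦≟vertical⟧ : ∀ a → ⟦ a ≟ₐ vertical ⟧ ≡ isVerticalAxis a
⟦≟vertical⟧ horizontal = refl
⟦≟vertical⟧ vertical   = refl

⟦≟horizontal⟧ : ∀ a → ⟦ a ≟ₐ horizontal ⟧ ≡ 1ℙ + isVerticalAxis a
⟦≟horizontal⟧ horizontal = refl
⟦≟horizontal⟧ vertical   = refl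

s≢s⊝unit : ∀ {s} a → s ≢ s ⊝ unit a
s≢s⊝unit {i , j} horizontal eq with () ← ∙-cancelˡ ℤ.+-0-abelianGroup i 0ℤ -1ℤ (trans (ℤ.+-identityʳ i) (cong proj₁ eq))
s≢s⊝unit {i , j} vertical   eq with () ← ∙-cancelˡ ℤ.+-0-abelianGroup j 0ℤ -1ℤ (trans (ℤ.+-identityʳ j) (cong proj₂ eq))

module _ {L : ValidLattice} (t : Tiling L) where

  -- The predicate `dominoes t` is decided through `covering`: by disjointness, its witness over the
  -- corner of `d` is the only candidate.
  member? : ∀ d → Dec (d ∈ dominoes t)
  member? d with covering t (corner d)
  ... | d′ , d′∈t , c = map′ (λ d′≡d → subst (dominoes t) d′≡d d′∈t) (λ d∈t → disjoint t d′∈t d∈t c near) (d′ ≟ᵈ d)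

  -- Functions of the square alone, hence summable over the whole rectangle, where the index of a
  -- domino is no longer available.
  leaves arrives : Axis → Square → Parity
  leaves  a s = ⟦ member? (domino s a) ⟧
  arrives a s = ⟦ member? (domino (s ⊝ unit a) a) ⟧

  covers-arrival : ∀ s a → Covers (domino (s ⊝ unit a) a) s
  covers-arrival s a = subst (Covers _) (⊝-⊕-cancel s (unit a)) away

  leave-∈ : ∀ {d s} → d ∈ dominoes t → s ∼[ L ] corner d → domino s (axis d) ∈ dominoes t
  leave-∈ {domino (i , j) a} {x , y} d∈t s∼ =
    subst (λ s → domino s a ∈ dominoes t) (cong₂ _,_ (lemma i x) (lemma j y)) (periodic t s∼ d∈t)
    where
    lemma : ∀ i x → i ℤ.+ (x ℤ.- i) ≡ x
    lemma = solve-∀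

  arrive-∈ : ∀ {d s} → d ∈ dominoes t → s ∼[ L ] far d → domino (s ⊝ unit (axis d)) (axis d) ∈ dominoes t
  arrive-∈ {domino (i , j) a} {x , y} d∈t s∼ =
    subst (λ s → domino s a ∈ dominoes t)
      (cong₂ _,_ (lemma i x (proj₁ (unit a))) (lemma j y (proj₂ (unit a)))) (periodic t s∼ d∈t)
    where
    lemma : ∀ i x u → i ℤ.+ (x ℤ.- (i ℤ.+ u)) ≡ x ℤ.- u
    lemma = solve-∀

  module _ {d : Domino} (d∈t : d ∈ dominoes t) (a : Axis) {s : Square} where

    arrives-far : s ∼[ L ] far d → arrives a s ≡ ⟦ axis d ≟ₐ a ⟧
    arrives-far s∼ = ⟦⟧-cong (member? _) (axis d ≟ₐ a)
      (λ ∈t → cong axis (disjoint t (arrive-∈ {s = s} d∈t s∼) ∈t (covers-arrival s (axis d)) (covers-arrival s a)))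
      (λ where refl → arrive-∈ {s = s} d∈t s∼)

    arrives-corner : s ∼[ L ] corner d → arrives a s ≡ 0ℙ
    arrives-corner s∼ = ⟦⟧-no (member? _) λ ∈t →
      s≢s⊝unit a (cong corner (disjoint t (leave-∈ d∈t s∼) ∈t near (covers-arrival s a)))

    leaves-corner : s ∼[ L ] corner d → leaves a s ≡ ⟦ axis d ≟ₐ a ⟧
    leaves-corner s∼ = ⟦⟧-cong (member? _) (axis d ≟ₐ a)
      (λ ∈t → cong axis (disjoint t (leave-∈ d∈t s∼) ∈t near near))
      (λ where refl → leave-∈ d∈t s∼)

    leaves-far : s ∼[ L ] far d → leaves a s ≡ 0ℙ
    leaves-far s∼ = ⟦⟧-no (member? _) λ ∈t →
      s≢s⊝unit (axis d) (cong corner (disjoint t ∈t (arrive-∈ {s = s} d∈t s∼) near (covers-arrival s (axis d))))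

-- Entries of the Kasteleyn matrix as steps of the glued rectangle

module _ {L : ValidLattice} (X : KasteleynData L) where
  open KasteleynData X
  open Kasteleyn X
  open Board (board X)

  -- The step `e` is the image of `d` modulo `L`. The Kasteleyn sign is negative exactly for a
  -- horizontal step with black source.
  record Realises (d : Domino) {s s′} (e : Joined {x₀} {x₁} {y₁} s s′) : Set where
    field
      source∼corner : square (source e) ∼[ L ] corner d
      target∼far    : square (target e) ∼[ L ] far d
      same-axis     : isVertical (joined-step e) ≡ isVerticalAxis (axis d)
      edge-sign     : edgeSign d ≡ toSign ((1ℙ + isVertical (joined-step e)) * isForward e)

  open Realises

  private
    b-square : ∀ i → square (b i) ≡ at blacks i
    b-square i = square-cell X (proj₁ (sound blacks i))
    w-square : ∀ j → square (w j) ≡ at whites j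
    w-square j = square-cell X (proj₁ (sound whites j))

  realise-forward : ∀ a i j → whiteCell (domino (at blacks i) a) ∼[ L ] at whites j →
                    ∃ λ (e : Joined (b i) (w j)) → Realises (domino (at blacks i) a) e
  realise-forward a i j white∼ with stepAlong X a (b-inside i) (w-inside j) far∼
    where
    d = domino (at blacks i) a
    far∼ : square (b i) ⊕ unit a ∼[ L ] square (w j)
    far∼ = subst₂ (λ s s′ → s ⊕ unit a ∼[ L ] s′) (sym (b-square i)) (sym (w-square j))
      (subst (λ s → s ∼[ L ] at whites j) (whiteCell-unique {d} away (far-white d (proj₂ (sound blacks i)))) white∼)
  ... | e , e-axis = inj₁ e , record
    { source∼corner = subst (λ s → s ∼[ L ] at blacks i) (sym (b-square i)) (∼-refl L (at blacks i))
    ; target∼far    = subst (λ s → s ∼[ L ] far d) (sym (w-square j)) (∼-sym L {far d} {at whites j}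
        (subst (λ s → s ∼[ L ] at whites j) (whiteCell-unique {d} away (far-white d (proj₂ (sound blacks i)))) white∼))
    ; same-axis     = e-axis
    ; edge-sign     = trans (sign a) (cong (λ v → toSign ((1ℙ + v) * 1ℙ)) (sym e-axis))
    }
    where
    d = domino (at blacks i) a
    sign : ∀ a → edgeSign (domino (at blacks i) a) ≡ toSign ((1ℙ + isVerticalAxis a) * 1ℙ)
    sign horizontal = if-yes (black? (at blacks i)) (proj₂ (sound blacks i))
    sign vertical   = refl

  realise-backward : ∀ a i j → whiteCell (domino (at blacks i ⊝ unit a) a) ∼[ L ] at whites j →
                     ∃ λ (e : Joined (b i) (w j)) → Realises (domino (at blacks i ⊝ unit a) a) e
  realise-backward a i j white∼ = inj₂ e , record
    { source∼corner = subst (λ s → s ∼[ L ] corner d) (sym (w-square j)) (∼-sym L {corner d} {at whites j} corner∼)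
    ; target∼far    = subst₂ (λ s s′ → s ∼[ L ] s′) (sym (b-square i)) (sym far≡) (∼-refl L (at blacks i))
    ; same-axis     = e-axis
    ; edge-sign     = trans (sign a corner-white) (cong toSign (sym (ℙ.*-zeroʳ (1ℙ + isVertical e))))
    }
    where
    d = domino (at blacks i ⊝ unit a) a
    far≡ : far d ≡ at blacks i
    far≡ = ⊝-⊕-cancel (at blacks i) (unit a)
    corner-white : White (corner d)
    corner-white black = far-white d black (subst Black (sym far≡) (proj₂ (sound blacks i)))
    corner∼ : corner d ∼[ L ] at whites j
    corner∼ = subst (λ s → s ∼[ L ] at whites j) (whiteCell-unique {d} near corner-white) white∼
    opposite-∼ : ∀ {s s′} → s ⊝ unit a ∼[ L ] s′ → s′ ⊕ unit a ∼[ L ] s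
    opposite-∼ {i , j} {i′ , j′} p = subst (vectors L)
      (cong₂ _,_ (lemma i i′ (proj₁ (unit a))) (lemma j j′ (proj₂ (unit a)))) (combine L -1ℤ 0ℤ p p)
      where
      lemma : ∀ i i′ u → -1ℤ ℤ.* (i ℤ.- u ℤ.- i′) ℤ.+ 0ℤ ℤ.* (i ℤ.- u ℤ.- i′) ≡ i′ ℤ.+ u ℤ.- i
      lemma = solve-∀
    along : StepAlong X a (w j) (b i)
    along = stepAlong X a (w-inside j) (b-inside i) (subst₂ (λ s s′ → s ⊕ unit a ∼[ L ] s′)
      (sym (w-square j)) (sym (b-square i)) (opposite-∼ {at blacks i} {at whites j} corner∼))
    e = proj₁ along
    e-axis = proj₂ along
    sign : ∀ a → White (at blacks i ⊝ unit a) → edgeSign (domino (at blacks i ⊝ unit a) a) ≡ Sign.+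
    sign horizontal white = if-no (black? (at blacks i ⊝ unit horizontal)) white
    sign vertical   _     = refl

  realise : ∀ {d} i j → d ∈ˡ orbits i j → ∃ λ (e : Joined (b i) (w j)) → Realises d e
  realise {d} i j d∈ with ∈-filter⁻ (λ d → ∼? L (whiteCell d) (at whites j)) {xs = dominoesAt (at blacks i)} d∈
  ... | here refl                         , white∼ = realise-forward  horizontal i j white∼
  ... | there (here refl)                 , white∼ = realise-backward horizontal i j white∼
  ... | there (there (here refl))         , white∼ = realise-forward  vertical   i j white∼
  ... | there (there (there (here refl))) , white∼ = realise-backward vertical   i j white∼

-- The sign of a term through dominoes crossing the paths

product-sign : ∀ {n} (f : Fin n → Monomial) → proj₁ (product f) ≡ ∏ (λ i → proj₁ (f i))
product-sign {zero}  f = refl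
product-sign {suc n} f = cong (proj₁ (f zero) Sign.*_) (product-sign λ i → f (suc i))

module _ {L : ValidLattice} (X : KasteleynData L) where
  open KasteleynData X
  open Kasteleyn X

  module _ {t : Tiling L} (T : Term t) where
    open Term T
    open Realises

    private
      e = λ i → proj₁ (realise X i (σ ⟨$⟩ʳ i) (edge∈row i))
      r = λ i → proj₂ (realise X i (σ ⟨$⟩ʳ i) (edge∈row i))
      M = torusMatching (board X) σ e
      open TorusMatching M

    -- Lifting dominoes are those arriving vertically in the bottom row. No arrival takes place at a
    -- source, so the sum over targets extends to all cells and `partition` applies.
    lifts-path : lifts M ≡ ∑< x₀ λ c → arrives t vertical (+ c , 0ℤ)
    lifts-path = begin
      lifts M
        ≡⟨ ∑-cong (λ i → trans (sym (vertical-bottom (step i))) (trans (ℙ.*-comm _ ⟦ row (q i) ℕ.≟ 0 ⟧)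
             (cong (⟦ row (q i) ℕ.≟ 0 ⟧ *_) (sym (arrives-q i))))) ⟩
      ∑ (λ i → F (q i))
        ≡⟨ cong (_+ ∑ (λ i → F (q i))) (∑-0 {size} λ i → trans (cong (⟦ row (p i) ℕ.≟ 0 ⟧ *_)
             (arrives-corner t (edge∈t i) vertical {square (p i)} (source∼corner (r i)))) (ℙ.*-zeroʳ _)) ⟨
      ∑ (λ i → F (p i)) + ∑ (λ i → F (q i))
        ≡⟨ partition F ⟩
      ∑< y₁ (λ r → ∑< x₀ λ c → F (c , r))
        ≡⟨ ∑<-cong y₁ (λ {r} _ → sym (*-distribˡ-∑< x₀ ⟦ r ℕ.≟ 0 ⟧ _)) ⟩
      ∑< y₁ (λ r → ⟦ r ℕ.≟ 0 ⟧ * ∑< x₀ λ c → arrives t vertical (+ c , + r))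
        ≡⟨ ∑<-δ y₁-positive (λ r → ∑< x₀ λ c → arrives t vertical (+ c , + r)) ⟩
      ∑< x₀ (λ c → arrives t vertical (+ c , 0ℤ)) ∎
      where
      F : Cell → Parity
      F s = ⟦ row s ℕ.≟ 0 ⟧ * arrives t vertical (square s)
      arrives-q : ∀ i → arrives t vertical (square (q i)) ≡ isVertical (step i)
      arrives-q i = trans (arrives-far t (edge∈t i) vertical {square (q i)} (target∼far (r i)))
        (trans (⟦≟vertical⟧ (axis (edge i))) (sym (same-axis (r i))))

    wraps-path : wraps M ≡ ∑< y₁ λ r → arrives t horizontal (0ℤ , + r)
    wraps-path = begin
      wraps M
        ≡⟨ ∑-cong (λ i → trans (sym (wrap-left (step i)))
             (cong (⟦ col (q i) ℕ.≟ 0 ⟧ *_) (sym (arrives-q i)))) ⟩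
      ∑ (λ i → F (q i))
        ≡⟨ cong (_+ ∑ (λ i → F (q i))) (∑-0 {size} λ i → trans (cong (⟦ col (p i) ℕ.≟ 0 ⟧ *_)
             (arrives-corner t (edge∈t i) horizontal {square (p i)} (source∼corner (r i)))) (ℙ.*-zeroʳ _)) ⟨
      ∑ (λ i → F (p i)) + ∑ (λ i → F (q i))
        ≡⟨ partition F ⟩
      ∑< y₁ (λ r → ∑< x₀ λ c → ⟦ c ℕ.≟ 0 ⟧ * arrives t horizontal (+ c , + r))
        ≡⟨ ∑<-cong y₁ (λ {r} _ → ∑<-δ x₀-positive (λ c → arrives t horizontal (+ c , + r))) ⟩
      ∑< y₁ (λ r → arrives t horizontal (0ℤ , + r)) ∎
      where
      F : Cell → Parity
      F s = ⟦ col s ℕ.≟ 0 ⟧ * arrives t horizontal (square s)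
      arrives-q : ∀ i → arrives t horizontal (square (q i)) ≡ 1ℙ + isVertical (step i)
      arrives-q i = trans (arrives-far t (edge∈t i) horizontal {square (q i)} (target∼far (r i)))
        (trans (⟦≟horizontal⟧ (axis (edge i))) (cong (λ v → 1ℙ + v) (sym (same-axis (r i)))))

    -- Here the sources are counted, in the top row: the domino leaving (c , y₁ - 1) upwards is the
    -- one arriving at (c , y₁), across the horizontal part of u(1).
    twists-path : twists M ≡ ∑< x₁ λ c → arrives t vertical (+ c , + y₁)
    twists-path = begin
      twists M
        ≡⟨ ∑-cong (λ i → trans (sym (twist-top (step i) (q-inside i)))
             (cong (⟦ suc (row (p i)) ℕ.≟ y₁ ⟧ * ⟦ col (p i) ℕ.<? x₁ ⟧ *_) (sym (leaves-p i)))) ⟩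
      ∑ (λ i → F (p i))
        ≡⟨ ℙ.+-identityʳ _ ⟨
      ∑ (λ i → F (p i)) + 0ℙ
        ≡⟨ cong (λ x → ∑ (λ i → F (p i)) + x) (∑-0 {size} λ i → trans (cong (⟦ suc (row (q i)) ℕ.≟ y₁ ⟧ * ⟦ col (q i) ℕ.<? x₁ ⟧ *_)
             (leaves-far t (edge∈t i) vertical {square (q i)} (target∼far (r i)))) (ℙ.*-zeroʳ _)) ⟨
      ∑ (λ i → F (p i)) + ∑ (λ i → F (q i))
        ≡⟨ partition F ⟩
      ∑< y₁ (λ r → ∑< x₀ λ c → ⟦ suc r ℕ.≟ y₁ ⟧ * ⟦ c ℕ.<? x₁ ⟧ * leaves t vertical (+ c , + r))
        ≡⟨ ∑<-cong y₁ (λ {r} _ → trans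
             (∑<-cong x₀ λ {c} _ → ℙ.*-assoc ⟦ suc r ℕ.≟ y₁ ⟧ ⟦ c ℕ.<? x₁ ⟧ (leaves t vertical (+ c , + r)))
             (trans (sym (*-distribˡ-∑< x₀ ⟦ suc r ℕ.≟ y₁ ⟧ _))
               (cong₂ _*_ (⟦⟧-cong (suc r ℕ.≟ y₁) (r ℕ.≟ ℕ.pred y₁) (cong ℕ.pred) (λ eq → trans (cong suc eq) top))
                 (∑<-truncate (ℕ.<⇒≤ x₁-bound) (λ c → leaves t vertical (+ c , + r)))))) ⟩
      ∑< y₁ (λ r → ⟦ r ℕ.≟ ℕ.pred y₁ ⟧ * ∑< x₁ λ c → leaves t vertical (+ c , + r))
        ≡⟨ ∑<-δ (ℕ.≤-reflexive top) (λ r → ∑< x₁ λ c → leaves t vertical (+ c , + r)) ⟩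
      ∑< x₁ (λ c → leaves t vertical (+ c , + ℕ.pred y₁))
        ≡⟨ ∑<-cong x₁ (λ {c} _ → cong (λ s → leaves t vertical s) (cong₂ _,_ (sym (ℤ.+-identityʳ (+ c)))
             (trans (lemma (+ ℕ.pred y₁)) (cong (λ n → + n ℤ.- 1ℤ) top)))) ⟩
      ∑< x₁ (λ c → arrives t vertical (+ c , + y₁)) ∎
      where
      F : Cell → Parity
      F s = ⟦ suc (row s) ℕ.≟ y₁ ⟧ * ⟦ col s ℕ.<? x₁ ⟧ * leaves t vertical (square s)
      top : suc (ℕ.pred y₁) ≡ y₁
      top = ℕ.suc-pred y₁
      lemma : ∀ i → i ≡ 1ℤ ℤ.+ i ℤ.- 1ℤ
      lemma = solve-∀
      leaves-p : ∀ i → leaves t vertical (square (p i)) ≡ isVertical (step i)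
      leaves-p i = trans (leaves-corner t (edge∈t i) vertical {square (p i)} (source∼corner (r i)))
        (trans (⟦≟vertical⟧ (axis (edge i))) (sym (same-axis (r i))))

    term-sign : proj₁ value ≡ toSign (
      Board.signConstant (board X) + lifts M * (∑< y₁ parity + 1ℙ) +
      (lifts M + 1ℙ) * (wraps M + twists M))
    term-sign = begin
      permSign σ Sign.* proj₁ (product λ i → weight (edge i))
        ≡⟨ cong₂ Sign._*_ (permSign-inversions σ) edge-signs ⟩
      toSign (inversions σ) Sign.* toSign (∑ signs)
        ≡⟨ ℙ.+-homo-* (inversions σ) (∑ signs) ⟨
      toSign (inversions σ + ∑ signs)
        ≡⟨ cong toSign (sign-formula (board X) (x₀-even X) σ e) ⟩
      toSign (Board.signConstant (board X) + lifts M * (∑< y₁ parity + 1ℙ) +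
        (lifts M + 1ℙ) * (wraps M + twists M)) ∎
      where
      signs : Fin size → Parity
      signs i = (1ℙ + isVertical (step i)) * isForward (e i)
      edge-signs : proj₁ (product λ i → weight (edge i)) ≡ toSign (∑ signs)
      edge-signs = begin
        proj₁ (product λ i → weight (edge i)) ≡⟨ product-sign (λ i → weight (edge i)) ⟩
        ∏ (λ i → edgeSign (edge i))           ≡⟨ ∏-cong (λ i → edge-sign (r i)) ⟩
        ∏ (λ i → toSign (signs i))            ≡⟨ toSign-∑ signs ⟨
        toSign (∑ signs)                      ∎

    term-sign-path : proj₁ value ≡ toSign (
      Board.signConstant (board X) + ∑< x₀ (λ c → arrives t vertical (+ c , 0ℤ)) * (∑< y₁ parity + 1ℙ) +
      (∑< x₀ (λ c → arrives t vertical (+ c , 0ℤ)) + 1ℙ) *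
      (∑< y₁ (λ r → arrives t horizontal (0ℤ , + r)) + ∑< x₁ (λ c → arrives t vertical (+ c , + y₁))))
    term-sign-path = trans term-sign (cong toSign (cong₂ (λ n m → Board.signConstant (board X) + n * (∑< y₁ parity + 1ℙ) + (n + 1ℙ) * m)
      lifts-path (cong₂ _+_ wraps-path twists-path)))

-- Heights and fluxes

∑ℤ : ℕ → (ℕ → ℤ) → ℤ
∑ℤ zero    f = 0ℤ
∑ℤ (suc n) f = ∑ℤ n f ℤ.+ f n

-- The height gained along an edge that is not the common side of a domino.
slope : UnitEdge → ℤ
slope e = if does (black? (rightOf e)) then 1ℤ else -1ℤ

module _ {L : ValidLattice} (t : Tiling L) where

  -- A domino across `e` changes the gain from `slope e` to -3 times it, that is by 4 times
  -- `flow e`. Modulo 2 this signed crossing number is a plain count.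
  flow : UnitEdge → ℤ
  flow e = if does (member? t (across e)) then ℤ.- slope e else 0ℤ

  parity-flow : ∀ e → parityℤ (flow e) ≡ ⟦ member? t (across e) ⟧
  parity-flow e with does (black? (rightOf e)) | does (member? t (across e))
  ... | true  | true  = refl
  ... | true  | false = refl
  ... | false | true  = refl
  ... | false | false = refl

  parity-flow-path : ∀ n (e : ℕ → UnitEdge) →
    parityℤ (∑ℤ n (λ k → flow (e k))) ≡ ∑< n (λ k → ⟦ member? t (across (e k)) ⟧)
  parity-flow-path zero    e = refl
  parity-flow-path (suc n) e = trans (parityℤ-+ (∑ℤ n λ k → flow (e k)) (flow (e n)))
    (cong₂ _+_ (parity-flow-path n e) (parity-flow (e n)))

  module _ {h : ℤ² → ℤ} (H : IsHeight t h) where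
    open IsHeight H

    private
      climb : ℤ → ℤ → ℤ
      climb s f = s ℤ.+ + 4 ℤ.* f
      add-back : ∀ x y → x ≡ x ℤ.- y ℤ.+ y
      add-back = solve-∀

    height-edge : ∀ e → h (end e) ≡ h (start e) ℤ.+ (slope e ℤ.+ + 4 ℤ.* flow e)
    height-edge e with black? (rightOf e) | member? t (across e)
    ... | yes b | yes ∈t = trans (cong h (sym (if-yes (black? (rightOf e)) b))) (trans (inside e ∈t)
          (cong₂ ℤ._+_ (cong h (if-yes (black? (rightOf e)) b)) (sym (trans
            (cong₂ climb (if-yes (black? (rightOf e)) b) (if-yes (member? t (across e)) ∈t))
            (cong (λ s → climb 1ℤ (ℤ.- s)) (if-yes (black? (rightOf e)) b))))))
    ... | yes b | no ∉t  = trans (cong h (sym (if-yes (black? (rightOf e)) b))) (trans (along e ∉t)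
          (cong₂ ℤ._+_ (cong h (if-yes (black? (rightOf e)) b)) (sym
            (cong₂ climb (if-yes (black? (rightOf e)) b) (if-no (member? t (across e)) ∉t)))))
    -- The edge is oriented from `end e` to `start e`, so the height equation is read backwards.
    ... | no w  | yes ∈t = trans (add-back (h (end e)) (+ 3)) (cong₂ ℤ._+_
          (trans (cong (λ s → h s ℤ.- + 3) (sym (if-no (black? (rightOf e)) w)))
            (trans (sym (inside e ∈t)) (cong h (if-no (black? (rightOf e)) w))))
          (sym (trans
            (cong₂ climb (if-no (black? (rightOf e)) w) (if-yes (member? t (across e)) ∈t))
            (cong (λ s → climb -1ℤ (ℤ.- s)) (if-no (black? (rightOf e)) w)))))
    ... | no w  | no ∉t  = trans (add-back (h (end e)) -1ℤ) (cong₂ ℤ._+_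
          (trans (cong (λ s → h s ℤ.+ 1ℤ) (sym (if-no (black? (rightOf e)) w)))
            (trans (sym (along e ∉t)) (cong h (if-no (black? (rightOf e)) w))))
          (sym (cong₂ climb (if-no (black? (rightOf e)) w) (if-no (member? t (across e)) ∉t))))

    height-path : (e : ℕ → UnitEdge) → (∀ k → end (e k) ≡ start (e (suc k))) → ∀ n →
      h (start (e n)) ≡ h (start (e 0)) ℤ.+ (∑ℤ n (λ k → slope (e k)) ℤ.+ + 4 ℤ.* ∑ℤ n (λ k → flow (e k)))
    height-path e link zero    = sym (ℤ.+-identityʳ _)
    height-path e link (suc n) = begin
      h (start (e (suc n)))
        ≡⟨ cong h (link n) ⟨
      h (end (e n))
        ≡⟨ height-edge (e n) ⟩
      h (start (e n)) ℤ.+ (slope (e n) ℤ.+ + 4 ℤ.* flow (e n))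
        ≡⟨ cong (ℤ._+ (slope (e n) ℤ.+ + 4 ℤ.* flow (e n))) (height-path e link n) ⟩
      h (start (e 0)) ℤ.+ (∑ℤ n (λ k → slope (e k)) ℤ.+ + 4 ℤ.* ∑ℤ n (λ k → flow (e k))) ℤ.+
      (slope (e n) ℤ.+ + 4 ℤ.* flow (e n))
        ≡⟨ lemma (h (start (e 0))) (∑ℤ n (λ k → slope (e k))) (∑ℤ n (λ k → flow (e k))) (slope (e n)) (flow (e n)) ⟩
      h (start (e 0)) ℤ.+ (∑ℤ n (λ k → slope (e k)) ℤ.+ slope (e n) ℤ.+ + 4 ℤ.* (∑ℤ n (λ k → flow (e k)) ℤ.+ flow (e n))) ∎
      where
      lemma : ∀ h s f s′ f′ → h ℤ.+ (s ℤ.+ + 4 ℤ.* f) ℤ.+ (s′ ℤ.+ + 4 ℤ.* f′) ≡ h ℤ.+ (s ℤ.+ s′ ℤ.+ + 4 ℤ.* (f ℤ.+ f′))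
      lemma = solve-∀

rightward upward : ℤ → ℕ → UnitEdge
rightward y k = unitEdge (+ k , y) horizontal
upward    x k = unitEdge (x , + k) vertical

rightward-link : ∀ y k → end (rightward y k) ≡ start (rightward y (suc k))
rightward-link y k = cong₂ _,_ (ℤ.+-comm (+ k) 1ℤ) (ℤ.+-identityʳ y)

upward-link : ∀ x k → end (upward x k) ≡ start (upward x (suc k))
upward-link x k = cong₂ _,_ (ℤ.+-identityʳ x) (ℤ.+-comm (+ k) 1ℤ)

module _ {L : ValidLattice} (X : KasteleynData L) where
  open KasteleynData X
  open Kasteleyn X

  v₀ v₁ : ℤ²
  v₀ = + x₀ , 0ℤ
  v₁ = + x₁ , + y₁

  slope₀ slope₁ : ℤ
  slope₀ = ∑ℤ x₀ λ k → slope (rightward 0ℤ k)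
  slope₁ = ∑ℤ y₁ (λ k → slope (upward 0ℤ k)) ℤ.+ ∑ℤ x₁ λ k → slope (rightward (+ y₁) k)

  -- Parity of the sign exponent; `∑< y₁ parity + 1ℙ` is the constant κ, where the sum of the row
  -- numbers comes from the vertical dominoes.
  quadratic : Parity → Parity → Parity
  quadratic m n = Board.signConstant (board X) + m * (∑< y₁ parity + 1ℙ) + (m + 1ℙ) * n

  -- The flux φ has integral coordinates n₀ and n₁ up to an offset that depends
  -- only on the lattice.
  record FluxCoordinates (φ : ℚ²) (s : Sign) : Set where
    field
      n₀ n₁ : ℤ
      flux₀ : fromℤ (+ 4) ℚ.* ⟨ φ , v₀ ⟩ ≡ fromℤ (slope₀ ℤ.+ + 4 ℤ.* n₀)
      flux₁ : fromℤ (+ 4) ℚ.* ⟨ φ , v₁ ⟩ ≡ fromℤ (slope₁ ℤ.+ + 4 ℤ.* n₁)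
      sign  : s ≡ toSign (quadratic (parityℤ n₀) (parityℤ n₁))

  opaque
    fluxCoordinates : ∀ φ (p : φ ∈ 𝓕 L) → FluxCoordinates φ (sgn φ p)
    fluxCoordinates φ (t , h , H , flux) = record
      { n₀    = n₀
      ; n₁    = n₁
      ; flux₀ = trans (flux x₀-period 0²) (cong fromℤ height₀)
      ; flux₁ = trans (flux x₁y₁-period 0²) (cong fromℤ height₁)
      ; sign  = trans (term-sign-path X (term t)) (cong toSign (sym (cong₂ quadratic parity₀ parity₁)))
      }
      where
      f : UnitEdge → ℤ
      f = flow t
      n₀ n₁ : ℤ
      n₀ = ∑ℤ x₀ λ k → f (rightward 0ℤ k)
      n₁ = ∑ℤ y₁ (λ k → f (upward 0ℤ k)) ℤ.+ ∑ℤ x₁ λ k → f (rightward (+ y₁) k)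
      -- The domino across an edge of the path is by definition the one that `arrives` tests.
      parity₀ : parityℤ n₀ ≡ ∑< x₀ λ c → arrives t vertical (+ c , 0ℤ)
      parity₀ = parity-flow-path t x₀ (rightward 0ℤ)
      parity₁ : parityℤ n₁ ≡ ∑< y₁ (λ r → arrives t horizontal (0ℤ , + r)) + ∑< x₁ (λ c → arrives t vertical (+ c , + y₁))
      parity₁ = trans (parityℤ-+ (∑ℤ y₁ λ k → f (upward 0ℤ k)) (∑ℤ x₁ λ k → f (rightward (+ y₁) k)))
        (cong₂ _+_ (parity-flow-path t y₁ (upward 0ℤ)) (parity-flow-path t x₁ (rightward (+ y₁))))
      height₀ : h v₀ ℤ.- h 0² ≡ slope₀ ℤ.+ + 4 ℤ.* n₀
      height₀ = trans (cong (ℤ._- h 0²) (height-path t H (rightward 0ℤ) (rightward-link 0ℤ) x₀)) (lemma (h 0²) _)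
        where
        lemma : ∀ h x → h ℤ.+ x ℤ.- h ≡ x
        lemma = solve-∀
      height₁ : h v₁ ℤ.- h 0² ≡ slope₁ ℤ.+ + 4 ℤ.* n₁
      height₁ = trans (cong (ℤ._- h 0²) (trans
          (height-path t H (rightward (+ y₁)) (rightward-link (+ y₁)) x₁)
          (cong (ℤ._+ _) (height-path t H (upward 0ℤ) (upward-link 0ℤ) y₁))))
        (lemma (h 0²) (∑ℤ y₁ λ k → slope (upward 0ℤ k)) _ (∑ℤ x₁ λ k → slope (rightward (+ y₁) k)) _)
        where
        lemma : ∀ h s f s′ f′ → h ℤ.+ (s ℤ.+ + 4 ℤ.* f) ℤ.+ (s′ ℤ.+ + 4 ℤ.* f′) ℤ.- h ≡ s ℤ.+ s′ ℤ.+ + 4 ℤ.* (f ℤ.+ f′)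
        lemma = solve-∀

-- Integral values of the rational pairing

fromℤ-+ : ∀ i j → fromℤ (i ℤ.+ j) ≡ fromℤ i ℚ.+ fromℤ j
fromℤ-+ i j = ℚ.toℚᵘ-injective (ℚᵘ.≃-trans (ℚᵘ.*≡* (lemma i j)) (ℚᵘ.≃-sym (ℚ.toℚᵘ-homo-+ (fromℤ i) (fromℤ j))))
  where
  lemma : ∀ i j → (i ℤ.+ j) ℤ.* 1ℤ ≡ (i ℤ.* 1ℤ ℤ.+ j ℤ.* 1ℤ) ℤ.* 1ℤ
  lemma = solve-∀

fromℤ-* : ∀ i j → fromℤ (i ℤ.* j) ≡ fromℤ i ℚ.* fromℤ j
fromℤ-* i j = ℚ.toℚᵘ-injective (ℚᵘ.≃-sym (ℚ.toℚᵘ-homo-* (fromℤ i) (fromℤ j)))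

fromℤ-injective : ∀ {i j} → fromℤ i ≡ fromℤ j → i ≡ j
fromℤ-injective = cong ℚ.numerator

pairing-+ : ∀ φ ψ v → ⟨ φ ⊕ℚ ψ , v ⟩ ≡ ⟨ φ , v ⟩ ℚ.+ ⟨ ψ , v ⟩
pairing-+ (a , b) (c , d) (x , y) = solveℚ 6
  (λ a b c d x y → (a ⊞ c) ⊠ x ⊞ (b ⊞ d) ⊠ y ⊜ (a ⊠ x ⊞ b ⊠ y) ⊞ (c ⊠ x ⊞ d ⊠ y)) refl
  a b c d (fromℤ x) (fromℤ y)

pairing-· : ∀ k φ v → ⟨ k ·ℚ φ , v ⟩ ≡ fromℤ k ℚ.* ⟨ φ , v ⟩
pairing-· k (a , b) (x , y) = solveℚ 5
  (λ k a b x y → (k ⊠ a) ⊠ x ⊞ (k ⊠ b) ⊠ y ⊜ k ⊠ (a ⊠ x ⊞ b ⊠ y)) refl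
  (fromℤ k) a b (fromℤ x) (fromℤ y)

⊕ℚ-⊝ℚ : ∀ φ φ′ → φ′ ≡ φ ⊕ℚ (φ′ ⊝ℚ φ)
⊕ℚ-⊝ℚ (a , b) (a′ , b′) = cong₂ _,_ (lemma a a′) (lemma b b′)
  where
  lemma : ∀ a a′ → a′ ≡ a ℚ.+ (a′ ℚ.- a)
  lemma = solveℚ 2 (λ a a′ → a′ ⊜ a ⊞ (a′ ⊟ a)) refl

pairing-combination : ∀ k l φ ψ v {i j} → ⟨ φ , v ⟩ ≡ fromℤ i → ⟨ ψ , v ⟩ ≡ fromℤ j →
  ⟨ k ·ℚ φ ⊕ℚ l ·ℚ ψ , v ⟩ ≡ fromℤ (k ℤ.* i ℤ.+ l ℤ.* j)
pairing-combination k l φ ψ v {i} {j} φv ψv = begin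
  ⟨ k ·ℚ φ ⊕ℚ l ·ℚ ψ , v ⟩
    ≡⟨ pairing-+ (k ·ℚ φ) (l ·ℚ ψ) v ⟩
  ⟨ k ·ℚ φ , v ⟩ ℚ.+ ⟨ l ·ℚ ψ , v ⟩
    ≡⟨ cong₂ ℚ._+_ (trans (pairing-· k φ v) (cong (fromℤ k ℚ.*_) φv)) (trans (pairing-· l ψ v) (cong (fromℤ l ℚ.*_) ψv)) ⟩
  fromℤ k ℚ.* fromℤ i ℚ.+ fromℤ l ℚ.* fromℤ j
    ≡⟨ sym (cong₂ ℚ._+_ (fromℤ-* k i) (fromℤ-* l j)) ⟩
  fromℤ (k ℤ.* i) ℚ.+ fromℤ (l ℤ.* j)
    ≡⟨ sym (fromℤ-+ (k ℤ.* i) (l ℤ.* j)) ⟩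
  fromℤ (k ℤ.* i ℤ.+ l ℤ.* j) ∎

-- The offset `s` is common to both fluxes and drops out of their difference.
coordinate-shift : ∀ φ ψ v {s n n′ a} →
  fromℤ (+ 4) ℚ.* ⟨ φ , v ⟩ ≡ fromℤ (s ℤ.+ + 4 ℤ.* n) →
  fromℤ (+ 4) ℚ.* ⟨ φ ⊕ℚ ψ , v ⟩ ≡ fromℤ (s ℤ.+ + 4 ℤ.* n′) →
  ⟨ ψ , v ⟩ ≡ fromℤ a → n′ ≡ n ℤ.+ a
coordinate-shift φ ψ v {s} {n} {n′} {a} φv φψv ψv =
  ℤ.*-cancelˡ-≡ (+ 4) n′ (n ℤ.+ a) (∙-cancelˡ ℤ.+-0-abelianGroup s _ _ (fromℤ-injective (begin
    fromℤ (s ℤ.+ + 4 ℤ.* n′)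
      ≡⟨ sym φψv ⟩
    fromℤ (+ 4) ℚ.* ⟨ φ ⊕ℚ ψ , v ⟩
      ≡⟨ cong (fromℤ (+ 4) ℚ.*_) (pairing-+ φ ψ v) ⟩
    fromℤ (+ 4) ℚ.* (⟨ φ , v ⟩ ℚ.+ ⟨ ψ , v ⟩)
      ≡⟨ ℚ.*-distribˡ-+ (fromℤ (+ 4)) (⟨ φ , v ⟩) (⟨ ψ , v ⟩) ⟩
    fromℤ (+ 4) ℚ.* ⟨ φ , v ⟩ ℚ.+ fromℤ (+ 4) ℚ.* ⟨ ψ , v ⟩
      ≡⟨ cong₂ ℚ._+_ φv (trans (cong (fromℤ (+ 4) ℚ.*_) ψv) (sym (fromℤ-* (+ 4) a))) ⟩
    fromℤ (s ℤ.+ + 4 ℤ.* n) ℚ.+ fromℤ (+ 4 ℤ.* a)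
      ≡⟨ sym (fromℤ-+ (s ℤ.+ + 4 ℤ.* n) (+ 4 ℤ.* a)) ⟩
    fromℤ (s ℤ.+ + 4 ℤ.* n ℤ.+ + 4 ℤ.* a)
      ≡⟨ cong fromℤ (lemma s n a) ⟩
    fromℤ (s ℤ.+ + 4 ℤ.* (n ℤ.+ a)) ∎)))
  where
  lemma : ∀ s n a → s ℤ.+ + 4 ℤ.* n ℤ.+ + 4 ℤ.* a ≡ s ℤ.+ + 4 ℤ.* (n ℤ.+ a)
  lemma = solve-∀

-- The dual lattice and the sign changes

module _ {L : ValidLattice} (X : KasteleynData L) where
  open KasteleynData X
  open Kasteleyn X

  -- Division with remainder by `y₁`, then by `x₀`; the minimality of each divisor makes its
  -- remainder vanish.
  v₀v₁-generate : ∀ {v} → v ∈ vectors L → ∃₂ λ k l → v ≡ k · v₀ X ⊕ l · v₁ X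
  v₀v₁-generate {x , y} v∈ = p , q , cong₂ _,_
      (trans (add-back x (q ℤ.* + x₁)) (cong (ℤ._+ q ℤ.* + x₁) (trans (ℤ.a≡a%ℕn+[a/ℕn]*n x′ x₀)
        (trans (cong (λ n → + n ℤ.+ p ℤ.* + x₀) r≡0) (ℤ.+-identityˡ (p ℤ.* + x₀))))))
      (trans (ℤ.a≡a%ℕn+[a/ℕn]*n y y₁) (trans (cong (λ n → + n ℤ.+ q ℤ.* + y₁) r′≡0) (lemma p (q ℤ.* + y₁))))
    where
    q  = y ℤ./ℕ y₁
    r′ = y ℤ.%ℕ y₁
    x′ = x ℤ.- q ℤ.* + x₁
    p  = x′ ℤ./ℕ x₀
    r  = x′ ℤ.%ℕ x₀
    add-back : ∀ x z → x ≡ x ℤ.- z ℤ.+ z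
    add-back = solve-∀
    lemma : ∀ p y → 0ℤ ℤ.+ y ≡ p ℤ.* 0ℤ ℤ.+ y
    lemma = solve-∀
    lemma₁ : ∀ x q z → 1ℤ ℤ.* x ℤ.+ ℤ.- q ℤ.* z ≡ x ℤ.- q ℤ.* z
    lemma₁ = solve-∀
    lemma₂ : ∀ r q y → 1ℤ ℤ.* (r ℤ.+ q ℤ.* y) ℤ.+ ℤ.- q ℤ.* y ≡ r
    lemma₂ = solve-∀
    lemma₃ : ∀ r p x → 1ℤ ℤ.* (r ℤ.+ p ℤ.* x) ℤ.+ ℤ.- p ℤ.* x ≡ r
    lemma₃ = solve-∀
    lemma₄ : ∀ p → 1ℤ ℤ.* 0ℤ ℤ.+ ℤ.- p ℤ.* 0ℤ ≡ 0ℤ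
    lemma₄ = solve-∀
    row-∈ : (x′ , + r′) ∈ vectors L
    row-∈ = subst (vectors L) (cong₂ _,_ (lemma₁ x q (+ x₁))
      (trans (cong (λ z → 1ℤ ℤ.* z ℤ.+ ℤ.- q ℤ.* + y₁) (ℤ.a≡a%ℕn+[a/ℕn]*n y y₁)) (lemma₂ (+ r′) q (+ y₁))))
      (combine L 1ℤ (ℤ.- q) v∈ x₁y₁-period)
    r′≡0 : r′ ≡ 0
    r′≡0 = ℕ.≤-antisym (ℕ.≮⇒≥ λ 0<r′ → ℕ.<⇒≱ (ℤ.n%ℕd<d y y₁) (y₁-minimal 0<r′ row-∈)) ℕ.z≤n
    col-∈ : (+ r , 0ℤ) ∈ vectors L
    col-∈ = subst (vectors L) (cong₂ _,_
      (trans (cong (λ z → 1ℤ ℤ.* z ℤ.+ ℤ.- p ℤ.* + x₀) (ℤ.a≡a%ℕn+[a/ℕn]*n x′ x₀)) (lemma₃ (+ r) p (+ x₀)))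
      (lemma₄ p))
      (combine L 1ℤ (ℤ.- p) (subst (λ n → (x′ , + n) ∈ vectors L) r′≡0 row-∈) x₀-period)
    r≡0 : r ≡ 0
    r≡0 = ℕ.≤-antisym (ℕ.≮⇒≥ λ 0<r → ℕ.<⇒≱ (ℤ.n%ℕd<d x′ x₀) (x₀-minimal 0<r col-∈)) ℕ.z≤n

  private
    X₀ X₁ Y₁ X₀⁻¹ Y₁⁻¹ : ℚ
    X₀ = fromℤ (+ x₀)
    X₁ = fromℤ (+ x₁)
    Y₁ = fromℤ (+ y₁)
    instance
      X₀≢0 : ℚ.NonZero X₀
      X₀≢0 = x₀≢0
      Y₁≢0 : ℚ.NonZero Y₁
      Y₁≢0 = y₁≢0
    X₀⁻¹ = 1/ X₀
    Y₁⁻¹ = 1/ Y₁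

  -- The basis dual to v₀ , v₁.
  e₀ e₁ : ℚ²
  e₀ = X₀⁻¹ , ℚ.- (X₁ ℚ.* X₀⁻¹ ℚ.* Y₁⁻¹)
  e₁ = 0ℚ , Y₁⁻¹

  private
    fromℤ-combination : ∀ k i l j → fromℤ (k ℤ.* i ℤ.+ l ℤ.* j) ≡ fromℤ k ℚ.* fromℤ i ℚ.+ fromℤ l ℚ.* fromℤ j
    fromℤ-combination k i l j = trans (fromℤ-+ (k ℤ.* i) (l ℤ.* j)) (cong₂ ℚ._+_ (fromℤ-* k i) (fromℤ-* l j))

  e₀-pairing : ∀ k l → ⟨ e₀ , k · v₀ X ⊕ l · v₁ X ⟩ ≡ fromℤ k
  e₀-pairing k l = begin
    X₀⁻¹ ℚ.* fromℤ (k ℤ.* + x₀ ℤ.+ l ℤ.* + x₁) ℚ.+ ℚ.- (X₁ ℚ.* X₀⁻¹ ℚ.* Y₁⁻¹) ℚ.* fromℤ (k ℤ.* 0ℤ ℤ.+ l ℤ.* + y₁)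
      ≡⟨ cong₂ (λ x y → X₀⁻¹ ℚ.* x ℚ.+ ℚ.- (X₁ ℚ.* X₀⁻¹ ℚ.* Y₁⁻¹) ℚ.* y)
           (fromℤ-combination k (+ x₀) l (+ x₁)) (fromℤ-combination k 0ℤ l (+ y₁)) ⟩
    X₀⁻¹ ℚ.* (fromℤ k ℚ.* X₀ ℚ.+ fromℤ l ℚ.* X₁) ℚ.+
    ℚ.- (X₁ ℚ.* X₀⁻¹ ℚ.* Y₁⁻¹) ℚ.* (fromℤ k ℚ.* 0ℚ ℚ.+ fromℤ l ℚ.* Y₁)
      ≡⟨ lemma X₀ X₀⁻¹ X₁ Y₁ Y₁⁻¹ (fromℤ k) (fromℤ l) ⟩
    fromℤ k ℚ.* (X₀ ℚ.* X₀⁻¹) ℚ.+ fromℤ l ℚ.* X₁ ℚ.* X₀⁻¹ ℚ.* (1ℚ ℚ.- Y₁ ℚ.* Y₁⁻¹)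
      ≡⟨ cong₂ (λ x y → fromℤ k ℚ.* x ℚ.+ fromℤ l ℚ.* X₁ ℚ.* X₀⁻¹ ℚ.* (1ℚ ℚ.- y)) (ℚ.*-inverseʳ X₀) (ℚ.*-inverseʳ Y₁) ⟩
    fromℤ k ℚ.* 1ℚ ℚ.+ fromℤ l ℚ.* X₁ ℚ.* X₀⁻¹ ℚ.* 0ℚ
      ≡⟨ trans (cong₂ ℚ._+_ (ℚ.*-identityʳ (fromℤ k)) (ℚ.*-zeroʳ (fromℤ l ℚ.* X₁ ℚ.* X₀⁻¹))) (ℚ.+-identityʳ (fromℤ k)) ⟩
    fromℤ k ∎
    where
    lemma : ∀ x i x₁ y j k l → i ℚ.* (k ℚ.* x ℚ.+ l ℚ.* x₁) ℚ.+ ℚ.- (x₁ ℚ.* i ℚ.* j) ℚ.* (k ℚ.* 0ℚ ℚ.+ l ℚ.* y) ≡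
      k ℚ.* (x ℚ.* i) ℚ.+ l ℚ.* x₁ ℚ.* i ℚ.* (1ℚ ℚ.- y ℚ.* j)
    lemma = solveℚ 7 (λ x i x₁ y j k l →
      i ⊠ (k ⊠ x ⊞ l ⊠ x₁) ⊞ ⊟ (x₁ ⊠ i ⊠ j) ⊠ (k ⊠ conℚ 0ℚ ⊞ l ⊠ y) ⊜
      k ⊠ (x ⊠ i) ⊞ l ⊠ x₁ ⊠ i ⊠ (conℚ 1ℚ ⊟ y ⊠ j)) refl

  e₁-pairing : ∀ k l → ⟨ e₁ , k · v₀ X ⊕ l · v₁ X ⟩ ≡ fromℤ l
  e₁-pairing k l = begin
    0ℚ ℚ.* fromℤ (k ℤ.* + x₀ ℤ.+ l ℤ.* + x₁) ℚ.+ Y₁⁻¹ ℚ.* fromℤ (k ℤ.* 0ℤ ℤ.+ l ℤ.* + y₁)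
      ≡⟨ cong (λ y → 0ℚ ℚ.* fromℤ (k ℤ.* + x₀ ℤ.+ l ℤ.* + x₁) ℚ.+ Y₁⁻¹ ℚ.* y) (fromℤ-combination k 0ℤ l (+ y₁)) ⟩
    0ℚ ℚ.* fromℤ (k ℤ.* + x₀ ℤ.+ l ℤ.* + x₁) ℚ.+ Y₁⁻¹ ℚ.* (fromℤ k ℚ.* 0ℚ ℚ.+ fromℤ l ℚ.* Y₁)
      ≡⟨ lemma (fromℤ (k ℤ.* + x₀ ℤ.+ l ℤ.* + x₁)) Y₁ Y₁⁻¹ (fromℤ k) (fromℤ l) ⟩
    fromℤ l ℚ.* (Y₁ ℚ.* Y₁⁻¹)
      ≡⟨ trans (cong (fromℤ l ℚ.*_) (ℚ.*-inverseʳ Y₁)) (ℚ.*-identityʳ (fromℤ l)) ⟩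
    fromℤ l ∎
    where
    lemma : ∀ z y j k l → 0ℚ ℚ.* z ℚ.+ j ℚ.* (k ℚ.* 0ℚ ℚ.+ l ℚ.* y) ≡ l ℚ.* (y ℚ.* j)
    lemma = solveℚ 5 (λ z y j k l → conℚ 0ℚ ⊠ z ⊞ j ⊠ (k ⊠ conℚ 0ℚ ⊞ l ⊠ y) ⊜ l ⊠ (y ⊠ j)) refl

  module _ {b : Fin 2 → ℚ²} (basis : IsBasis L b) where
    open IsBasis basis

    private
      integral : ∀ i {v} → v ∈ vectors L → ℤ
      integral i v∈ = proj₁ (dual i v∈)

      a₀ a₁ : Fin 2 → ℤ
      a₀ i = integral i x₀-period
      a₁ i = integral i x₁y₁-period

      α₀ α₁ : Fin 2 → Parity
      α₀ i = parityℤ (a₀ i)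
      α₁ i = parityℤ (a₁ i)

    e₀-dual : e₀ ∈ Dual L
    e₀-dual v∈ with k , l , refl ← v₀v₁-generate v∈ = k , e₀-pairing k l

    e₁-dual : e₁ ∈ Dual L
    e₁-dual v∈ with k , l , refl ← v₀v₁-generate v∈ = l , e₁-pairing k l

    private
      v₀-combination : 1ℤ · v₀ X ⊕ 0ℤ · v₁ X ≡ v₀ X
      v₀-combination = cong₂ _,_ (lemma (+ x₀) (+ x₁)) (lemma 0ℤ (+ y₁))
        where
        lemma : ∀ x y → 1ℤ ℤ.* x ℤ.+ 0ℤ ℤ.* y ≡ x
        lemma = solve-∀

      v₁-combination : 0ℤ · v₀ X ⊕ 1ℤ · v₁ X ≡ v₁ X
      v₁-combination = cong₂ _,_ (lemma (+ x₀) (+ x₁)) (lemma 0ℤ (+ y₁))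
        where
        lemma : ∀ x y → 0ℤ ℤ.* x ℤ.+ 1ℤ ℤ.* y ≡ y
        lemma = solve-∀

      -- One entry of a matrix product modulo 2: the base change to `b` times the pairings of `b`
      -- with `v`.
      coefficients : ∀ {e v} k l {a b′ c} → e ≡ k ·ℚ b zero ⊕ℚ l ·ℚ b (suc zero) →
        ⟨ b zero , v ⟩ ≡ fromℤ a → ⟨ b (suc zero) , v ⟩ ≡ fromℤ b′ → ⟨ e , v ⟩ ≡ fromℤ c →
        parityℤ k * parityℤ a + parityℤ l * parityℤ b′ ≡ parityℤ c
      coefficients {v = v} k l {a} {b′} {c} refl b₀v b₁v ev = begin
        parityℤ k * parityℤ a + parityℤ l * parityℤ b′
          ≡⟨ cong₂ _+_ (sym (parityℤ-* k a)) (sym (parityℤ-* l b′)) ⟩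
        parityℤ (k ℤ.* a) + parityℤ (l ℤ.* b′)
          ≡⟨ sym (parityℤ-+ (k ℤ.* a) (l ℤ.* b′)) ⟩
        parityℤ (k ℤ.* a ℤ.+ l ℤ.* b′)
          ≡⟨ cong parityℤ (fromℤ-injective (trans (sym (pairing-combination k l (b zero) (b (suc zero)) v b₀v b₁v)) ev)) ⟩
        parityℤ c ∎

      *-odd : ∀ x {y} → x * y ≡ 1ℙ → y ≡ 1ℙ
      *-odd 1ℙ eq = eq

    -- Both b and e₀ , e₁ generate the dual lattice, so the base change is unimodular.
    determinant-odd : α₀ zero * α₁ (suc zero) + α₁ zero * α₀ (suc zero) ≡ 1ℙ
    determinant-odd with generating {e₀} e₀-dual | generating {e₁} e₁-dual
    -- The determinant is multiplicative, and `e₀`, `e₁` pair with `v₀`, `v₁` in the identity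
    -- matrix.
    ... | k , l , e₀≡ | k′ , l′ , e₁≡ = *-odd (parityℤ k * parityℤ l′ + parityℤ l * parityℤ k′) (begin
      (parityℤ k * parityℤ l′ + parityℤ l * parityℤ k′) * (α₀ zero * α₁ (suc zero) + α₁ zero * α₀ (suc zero))
        ≡⟨ solve 8 (λ k l k′ l′ a b c d →
             (k :* l′ :+ l :* k′) :* (a :* d :+ b :* c) :=
             (k :* a :+ l :* c) :* (k′ :* b :+ l′ :* d) :+ (k :* b :+ l :* d) :* (k′ :* a :+ l′ :* c)) refl
             (parityℤ k) (parityℤ l) (parityℤ k′) (parityℤ l′) (α₀ zero) (α₁ zero) (α₀ (suc zero)) (α₁ (suc zero)) ⟩
      (parityℤ k * α₀ zero + parityℤ l * α₀ (suc zero)) * (parityℤ k′ * α₁ zero + parityℤ l′ * α₁ (suc zero)) +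
      (parityℤ k * α₁ zero + parityℤ l * α₁ (suc zero)) * (parityℤ k′ * α₀ zero + parityℤ l′ * α₀ (suc zero))
        ≡⟨ cong₂ _+_
             (cong₂ _*_ (row₀ k l e₀≡ e₀v₀) (row₁ k′ l′ e₁≡ e₁v₁))
             (cong₂ _*_ (row₁ k l e₀≡ e₀v₁) (row₀ k′ l′ e₁≡ e₁v₀)) ⟩
      1ℙ ∎)
      where
      row₀ : ∀ {e} k l {c} → e ≡ k ·ℚ b zero ⊕ℚ l ·ℚ b (suc zero) → ⟨ e , v₀ X ⟩ ≡ fromℤ c →
             parityℤ k * α₀ zero + parityℤ l * α₀ (suc zero) ≡ parityℤ c
      row₀ k l e≡ = coefficients k l e≡ (proj₂ (dual zero x₀-period)) (proj₂ (dual (suc zero) x₀-period))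
      row₁ : ∀ {e} k l {c} → e ≡ k ·ℚ b zero ⊕ℚ l ·ℚ b (suc zero) → ⟨ e , v₁ X ⟩ ≡ fromℤ c →
             parityℤ k * α₁ zero + parityℤ l * α₁ (suc zero) ≡ parityℤ c
      row₁ k l e≡ = coefficients k l e≡ (proj₂ (dual zero x₁y₁-period)) (proj₂ (dual (suc zero) x₁y₁-period))
      e₀v₀ : ⟨ e₀ , v₀ X ⟩ ≡ fromℤ 1ℤ
      e₀v₀ = trans (cong ⟨ e₀ ,_⟩ (sym v₀-combination)) (e₀-pairing 1ℤ 0ℤ)
      e₀v₁ : ⟨ e₀ , v₁ X ⟩ ≡ fromℤ 0ℤ
      e₀v₁ = trans (cong ⟨ e₀ ,_⟩ (sym v₁-combination)) (e₀-pairing 0ℤ 1ℤ)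
      e₁v₀ : ⟨ e₁ , v₀ X ⟩ ≡ fromℤ 0ℤ
      e₁v₀ = trans (cong ⟨ e₁ ,_⟩ (sym v₀-combination)) (e₁-pairing 1ℤ 0ℤ)
      e₁v₁ : ⟨ e₁ , v₁ X ⟩ ≡ fromℤ 1ℤ
      e₁v₁ = trans (cong ⟨ e₁ ,_⟩ (sym v₁-combination)) (e₁-pairing 0ℤ 1ℤ)

    determinant-odd-≢ : ∀ {i j} → i ≢ j → α₀ j * α₁ i + α₁ j * α₀ i ≡ 1ℙ
    determinant-odd-≢ {zero}     {zero}     i≢j = contradiction refl i≢j
    determinant-odd-≢ {zero}     {suc zero} _   = trans
      (solve 4 (λ a b c d → c :* b :+ d :* a := a :* d :+ b :* c) refl
        (α₀ zero) (α₁ zero) (α₀ (suc zero)) (α₁ (suc zero))) determinant-odd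
    determinant-odd-≢ {suc zero} {zero}     _   = determinant-odd
    determinant-odd-≢ {suc zero} {suc zero} i≢j = contradiction refl i≢j

    -- A ratio of signs is a first difference of the quadratic function `Q`. Moving the base point
    -- by `ψ` changes it by a second difference, from which constant and linear parts vanish; what
    -- remains is the polar form of `ψ` and `b i`.
    sign-change : ∀ i φ ψ (p : φ ∈ 𝓕 L) (p⁺ : φ ⊕ℚ b i ∈ 𝓕 L) (p′ : φ ⊕ℚ ψ ∈ 𝓕 L) (p′⁺ : φ ⊕ℚ ψ ⊕ℚ b i ∈ 𝓕 L) →
      ∀ {c d} → ⟨ ψ , v₀ X ⟩ ≡ fromℤ c → ⟨ ψ , v₁ X ⟩ ≡ fromℤ d →
      sgn φ p ÷ sgn (φ ⊕ℚ b i) p⁺ ≡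
      toSign (parityℤ c * α₁ i + parityℤ d * α₀ i) Sign.* (sgn (φ ⊕ℚ ψ) p′ ÷ sgn (φ ⊕ℚ ψ ⊕ℚ b i) p′⁺)
    sign-change i φ ψ p p⁺ p′ p′⁺ {c} {d} ψv₀ ψv₁ = begin
      sgn φ p ÷ sgn (φ ⊕ℚ b i) p⁺
        ≡⟨ ratio C C⁺ ⟩
      toSign (Q (x C) (y C) + Q (x C⁺) (y C⁺))
        ≡⟨ cong (λ z → toSign (Q (x C) (y C) + z)) (cong₂ Q (x-shift φ (b i) C C⁺ bv₀) (y-shift φ (b i) C C⁺ bv₁)) ⟩
      toSign (Q (x C) (y C) + Q (x C + α₀ i) (y C + α₁ i))
        ≡⟨ cong toSign (polar (x C) (y C) (α₀ i) (α₁ i) (parityℤ c) (parityℤ d)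
             (Board.signConstant (board X)) (∑< y₁ parity)) ⟩
      toSign (parityℤ c * α₁ i + parityℤ d * α₀ i +
        (Q (x C + parityℤ c) (y C + parityℤ d) + Q (x C + parityℤ c + α₀ i) (y C + parityℤ d + α₁ i)))
        ≡⟨ cong₂ (λ z w → toSign (parityℤ c * α₁ i + parityℤ d * α₀ i + (Q z w + Q (z + α₀ i) (w + α₁ i))))
             (sym (x-shift φ ψ C C′ ψv₀)) (sym (y-shift φ ψ C C′ ψv₁)) ⟩
      toSign (parityℤ c * α₁ i + parityℤ d * α₀ i + (Q (x C′) (y C′) + Q (x C′ + α₀ i) (y C′ + α₁ i)))
        ≡⟨ cong (λ z → toSign (parityℤ c * α₁ i + parityℤ d * α₀ i + (Q (x C′) (y C′) + z)))
             (cong₂ Q (sym (x-shift (φ ⊕ℚ ψ) (b i) C′ C′⁺ bv₀)) (sym (y-shift (φ ⊕ℚ ψ) (b i) C′ C′⁺ bv₁))) ⟩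
      toSign (parityℤ c * α₁ i + parityℤ d * α₀ i + (Q (x C′) (y C′) + Q (x C′⁺) (y C′⁺)))
        ≡⟨ trans (ℙ.+-homo-* (parityℤ c * α₁ i + parityℤ d * α₀ i) _) (cong (toSign (parityℤ c * α₁ i + parityℤ d * α₀ i) Sign.*_)
             (sym (ratio C′ C′⁺))) ⟩
      toSign (parityℤ c * α₁ i + parityℤ d * α₀ i) Sign.* (sgn (φ ⊕ℚ ψ) p′ ÷ sgn (φ ⊕ℚ ψ ⊕ℚ b i) p′⁺) ∎
      where
      open FluxCoordinates
      Q = quadratic X
      C   = fluxCoordinates X φ p
      C⁺  = fluxCoordinates X (φ ⊕ℚ b i) p⁺
      C′  = fluxCoordinates X (φ ⊕ℚ ψ) p′
      C′⁺ = fluxCoordinates X (φ ⊕ℚ ψ ⊕ℚ b i) p′⁺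
      bv₀ = proj₂ (dual i x₀-period)
      bv₁ = proj₂ (dual i x₁y₁-period)
      x y : ∀ {φ s} → FluxCoordinates X φ s → Parity
      x C = parityℤ (n₀ C)
      y C = parityℤ (n₁ C)
      ratio : ∀ {φ φ′ s s′} (C : FluxCoordinates X φ s) (C′ : FluxCoordinates X φ′ s′) →
              s ÷ s′ ≡ toSign (Q (x C) (y C) + Q (x C′) (y C′))
      ratio C C′ = trans (cong₂ _÷_ (sign C) (sign C′)) (sym (ℙ.+-homo-* (Q (x C) (y C)) _))
      x-shift : ∀ φ ψ {s s′ a} (C : FluxCoordinates X φ s) (C′ : FluxCoordinates X (φ ⊕ℚ ψ) s′) →
                ⟨ ψ , v₀ X ⟩ ≡ fromℤ a → x C′ ≡ x C + parityℤ a
      x-shift φ ψ {a = a} C C′ ψv = trans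
        (cong parityℤ (coordinate-shift φ ψ (v₀ X) {slope₀ X} {n₀ C} (flux₀ C) (flux₀ C′) ψv)) (parityℤ-+ (n₀ C) a)
      y-shift : ∀ φ ψ {s s′ a} (C : FluxCoordinates X φ s) (C′ : FluxCoordinates X (φ ⊕ℚ ψ) s′) →
                ⟨ ψ , v₁ X ⟩ ≡ fromℤ a → y C′ ≡ y C + parityℤ a
      y-shift φ ψ {a = a} C C′ ψv = trans
        (cong parityℤ (coordinate-shift φ ψ (v₁ X) {slope₁ X} {n₁ C} (flux₁ C) (flux₁ C′) ψv)) (parityℤ-+ (n₁ C) a)
      polar : ∀ x y a b c d k r →
        (k + x * (r + 1ℙ) + (x + 1ℙ) * y) + (k + (x + a) * (r + 1ℙ) + (x + a + 1ℙ) * (y + b)) ≡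
        c * b + d * a + ((k + (x + c) * (r + 1ℙ) + (x + c + 1ℙ) * (y + d)) +
                         (k + (x + c + a) * (r + 1ℙ) + (x + c + a + 1ℙ) * (y + d + b)))
      polar = solve 8 (λ x y a b c d k r →
        (k :+ x :* (r :+ con 1ℙ) :+ (x :+ con 1ℙ) :* y) :+
        (k :+ (x :+ a) :* (r :+ con 1ℙ) :+ (x :+ a :+ con 1ℙ) :* (y :+ b)) :=
        c :* b :+ d :* a :+ ((k :+ (x :+ c) :* (r :+ con 1ℙ) :+ (x :+ c :+ con 1ℙ) :* (y :+ d)) :+
          (k :+ (x :+ c :+ a) :* (r :+ con 1ℙ) :+ (x :+ c :+ a :+ con 1ℙ) :* (y :+ d :+ b)))) refl

    private
      pairing-multiple : ∀ i k {v} (v∈ : v ∈ vectors L) → ⟨ k ·ℚ b i , v ⟩ ≡ fromℤ (k ℤ.* integral i v∈)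
      pairing-multiple i k {v} v∈ = trans (pairing-· k (b i) v)
        (trans (cong (fromℤ k ℚ.*_) (proj₂ (dual i v∈))) (sym (fromℤ-* k (integral i v∈))))

      pairing-affine : ∀ i j k {v} (v∈ : v ∈ vectors L) →
                       ⟨ b j ⊕ℚ k ·ℚ b i , v ⟩ ≡ fromℤ (integral j v∈ ℤ.+ k ℤ.* integral i v∈)
      pairing-affine i j k {v} v∈ = trans (pairing-+ (b j) (k ·ℚ b i) v)
        (trans (cong₂ ℚ._+_ (proj₂ (dual j v∈)) (pairing-multiple i k v∈))
          (sym (fromℤ-+ (integral j v∈) (k ℤ.* integral i v∈))))

    -- The polar form is alternating, so it vanishes on `b i` and a multiple of `b i`.
    same-line : ∀ i k φ {φ′} → φ′ ≡ φ ⊕ℚ k ·ℚ b i →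
      (p : φ ∈ 𝓕 L) (p⁺ : φ ⊕ℚ b i ∈ 𝓕 L) (p′ : φ′ ∈ 𝓕 L) (p′⁺ : φ′ ⊕ℚ b i ∈ 𝓕 L) →
      sgn φ p ÷ sgn (φ ⊕ℚ b i) p⁺ ≡ sgn φ′ p′ ÷ sgn (φ′ ⊕ℚ b i) p′⁺
    same-line i k φ {φ′} refl p p⁺ p′ p′⁺ = trans
      (sign-change i φ (k ·ℚ b i) p p⁺ p′ p′⁺ (pairing-multiple i k x₀-period) (pairing-multiple i k x₁y₁-period))
      (cong (λ z → toSign z Sign.* (sgn φ′ p′ ÷ sgn (φ′ ⊕ℚ b i) p′⁺)) (begin
        parityℤ (k ℤ.* a₀ i) * α₁ i + parityℤ (k ℤ.* a₁ i) * α₀ i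
          ≡⟨ cong₂ (λ z w → z * α₁ i + w * α₀ i) (parityℤ-* k (a₀ i)) (parityℤ-* k (a₁ i)) ⟩
        parityℤ k * α₀ i * α₁ i + parityℤ k * α₁ i * α₀ i
          ≡⟨ solve 3 (λ k a b → k :* a :* b :+ k :* b :* a := con 0ℙ) refl (parityℤ k) (α₀ i) (α₁ i) ⟩
        0ℙ ∎))

    -- The multiple of `b i` contributes nothing to the alternating polar form, which leaves the odd
    -- determinant of `b j` and `b i`.
    adjacent-lines : ∀ {i j} → i ≢ j → ∀ k φ {φ′} → φ′ ≡ φ ⊕ℚ (b j ⊕ℚ k ·ℚ b i) →
      (p : φ ∈ 𝓕 L) (p⁺ : φ ⊕ℚ b i ∈ 𝓕 L) (p′ : φ′ ∈ 𝓕 L) (p′⁺ : φ′ ⊕ℚ b i ∈ 𝓕 L) →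
      sgn φ p ÷ sgn (φ ⊕ℚ b i) p⁺ ≡ opposite (sgn φ′ p′ ÷ sgn (φ′ ⊕ℚ b i) p′⁺)
    adjacent-lines {i} {j} i≢j k φ {φ′} refl p p⁺ p′ p′⁺ = trans
      (sign-change i φ (b j ⊕ℚ k ·ℚ b i) p p⁺ p′ p′⁺ (pairing-affine i j k x₀-period) (pairing-affine i j k x₁y₁-period))
      (trans (cong (λ z → toSign z Sign.* ratio′) (begin
        parityℤ (a₀ j ℤ.+ k ℤ.* a₀ i) * α₁ i + parityℤ (a₁ j ℤ.+ k ℤ.* a₁ i) * α₀ i
          ≡⟨ cong₂ (λ z w → z * α₁ i + w * α₀ i) (affine (a₀ j) (a₀ i)) (affine (a₁ j) (a₁ i)) ⟩
        (α₀ j + parityℤ k * α₀ i) * α₁ i + (α₁ j + parityℤ k * α₁ i) * α₀ i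
          ≡⟨ solve 5 (λ k a b c d → (c :+ k :* a) :* b :+ (d :+ k :* b) :* a := c :* b :+ d :* a) refl
               (parityℤ k) (α₀ i) (α₁ i) (α₀ j) (α₁ j) ⟩
        α₀ j * α₁ i + α₁ j * α₀ i
          ≡⟨ determinant-odd-≢ i≢j ⟩
        1ℙ ∎)) (-*-opposite ratio′))
      where
      ratio′ : Sign
      ratio′ = sgn φ′ p′ ÷ sgn (φ′ ⊕ℚ b i) p′⁺
      affine : ∀ m n → parityℤ (m ℤ.+ k ℤ.* n) ≡ parityℤ m + parityℤ k * parityℤ n
      affine m n = trans (parityℤ-+ m (k ℤ.* n)) (cong (λ z → parityℤ m + z) (parityℤ-* k n))
      -*-opposite : ∀ s → Sign.- Sign.* s ≡ opposite s
      -*-opposite Sign.+ = refl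
      -*-opposite Sign.- = refl

proposition8p3p4 : ∀ (L : ValidLattice) (X : KasteleynData L) (v* : Fin 2 → ℚ²) →
    IsFluxConnectingBasis L v* →
    let open Kasteleyn X in
    ∀ (i j : Fin 2) → i ≢ j →
    ∀ (φ φ′ : ℚ²)
    (p  : φ ∈ 𝓕 L)  (p⁺  : φ ⊕ℚ v* i ∈ 𝓕 L)
    (p′ : φ′ ∈ 𝓕 L) (p′⁺ : φ′ ⊕ℚ v* i ∈ 𝓕 L) →
    ((∃ λ k → φ′ ⊝ℚ φ ≡ k ·ℚ v* i) →
    sgn φ p ÷ sgn (φ ⊕ℚ v* i) p⁺ ≡ sgn φ′ p′ ÷ sgn (φ′ ⊕ℚ v* i) p′⁺)
    ×
    ((∃ λ k → φ′ ⊝ℚ φ ≡ v* j ⊕ℚ k ·ℚ v* i) →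
    sgn φ p ÷ sgn (φ ⊕ℚ v* i) p⁺ ≡ opposite (sgn φ′ p′ ÷ sgn (φ′ ⊕ℚ v* i) p′⁺))
proposition8p3p4 L X v* connecting i j i≢j φ φ′ p p⁺ p′ p′⁺ =
  (λ (k , eq) → same-line X basis i k φ (translate eq) p p⁺ p′ p′⁺) ,
  (λ (k , eq) → adjacent-lines X basis i≢j k φ (translate eq) p p⁺ p′ p′⁺)
  where
  basis = IsFluxConnectingBasis.isBasis connecting
  translate : ∀ {ψ} → φ′ ⊝ℚ φ ≡ ψ → φ′ ≡ φ ⊕ℚ ψ
  translate eq = trans (⊕ℚ-⊝ℚ φ φ′) (cong (φ ⊕ℚ_) eq)
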